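{- Let $G$ be a graph of order $n\ge 4$ such that both $G$ and its complement $\overline G$ are connected. Then: (1) $n\le \operatorname{th}_+(G)+\operatorname{th}_+(\overline G)\le 2n-o(n)$; for $n\ne 5$, $\max\{2n,3n-9\}\le \operatorname{th}_+(G)\cdot\operatorname{th}_+(\overline G)\le n^2-o(n^2)$; for $n=5$, $9\le \operatorname{th}_+(G)\cdot\operatorname{th}_+(\overline G)\le 12$. (2) $n-2\le \operatorname{th}_+^{\ast}(G)+\operatorname{th}_+^{\ast}(\overline G)\le 2n-o(n)$ and $\max\{n-1,2n-8\}\le \operatorname{th}_+^{\ast}(G)\cdot\operatorname{th}_+^{\ast}(\overline G)\le n^2-o(n^2)$. (3) $n\le \operatorname{th}_+^{\times}(G)+\operatorname{th}_+^{\times}(\overline G)\le 2n$; for $n\ge 6$, $3n\le \operatorname{th}_+^{\times}(G)\cdot\operatorname{th}_+^{\times}(\overline G)\le n^2$; for $n=4$, $\operatorname{th}_+^{\times}(G)\cdot\operatorname{th}_+^{\times}(\overline G)=9$; and for $n=5$, $12\le \operatorname{th}_+^{\times}(G)\cdot\operatorname{th}_+^{\times}(\overline G)\le 20$. For (1) and (2), the upper bounds (sum and product) are tight and the lower bounds (sum and product) are almost sharp. For (3), the upper bounds (sum and product) and the product lower bound are sharp, and the sum lower bound is almost sharp.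
   Context: Graphs are finite, simple, undirected, with nonempty vertex set; the order of $G$ is $|V(G)|$; $\overline G$ is the complement of $G$. PSD forcing: each vertex is filled or unfilled. PSD color change rule: let $B$ be the set of currently filled vertices and let $W_1,\dots,W_k$ be the vertex sets of the components of $G[V(G)\setminus B]$; if $v\in B$, $w\in W_i$, and $w$ is the only unfilled neighbor of $v$ in $G[W_i\cup B]$, then fill $w$. For $B\subseteq V(G)$ put $B^{[0]}=B$, and let $B^{[i+1]}$ be $B^{[i]}$ together with all vertices that can be filled by one application of the rule when exactly the vertices of $B^{[i]}$ are filled. $\operatorname{pt}_+(G;B)$ is the least $t$ with $B^{[t]}=V(G)$ ($\infty$ if none exists), and $\operatorname{pt}_+(G,k)=\min_{|B|=k}\operatorname{pt}_+(G;B)$. For $G$ of order $n$: $\operatorname{th}_+(G)=\min_{1\le k\le n}(k+\operatorname{pt}_+(G,k))$; $\operatorname{th}_+^{\times}(G)=\min_{1\le k\le n}k(1+\operatorname{pt}_+(G,k))$; and, if $G$ has an edge, $\operatorname{th}_+^{\ast}(G)=\min_{1\le k\le n-1}k\cdot\operatorname{pt}_+(G,k)$. Asymptotic notation: $f$ is $o(g)$ if $f,g$ are positive real valued functions of $n$ with $f(n)/g(n)\to0$ as $n\to\infty$. An upper bound $b(n)-o(b(n))$ means an upper bound $b(n)-f(n)$ for some function $f$ that is $o(b)$, valid for all graphs in the class. Here all graphs are in the class with $G,\overline G$ both connected. A bound $b(n)$ on $\zeta(G)+\zeta(\overline G)$ (or $\zeta(G)\cdot\zeta(\overline G)$) is sharp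 if it is attained by infinitely many graphs $G$ in the class; it is almost sharp if, for some positive integer $k<10$, infinitely many $G$ in the class satisfy $\zeta(G)+\zeta(\overline G)=b(n)\pm k$ (respectively with the product). A bound $b(n)\pm o(b(n))$ is tight if infinitely many $G$ in the class satisfy $\zeta(G)+\zeta(\overline G)=b(n)\pm o(b(n))$ (respectively with the product). -}

module Defs where

open import Data.Fin.Base using (Fin)
open import Data.Fin.Properties using (_≟_)
import Data.Fin.Subset as Subset
open import Data.Integer.Base using (+_)
open import Data.List.Base using (List)
open import Data.List.Relation.Unary.All using (All)
open import Data.Nat.Base using (ℕ; zero; suc; _+_; _*_; _≤_; _<_)
open import Data.Product.Base using (Σ; ∃; ∃₂; ∃-syntax; _×_; _,_)
import Data.Rational.Base as ℚ
open ℚ using (ℚ; 0ℚ)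
open import Data.Sum.Base using (_⊎_)
open import Function.Base using (_∘_)
open import Function.Bundles using (_↔_; _⇔_; Inverse)
open import Level using (0ℓ)
open import Relation.Binary.Core using (Rel)
open import Relation.Binary.Construct.Closure.ReflexiveTransitive using (Star)
open import Relation.Binary.Definitions using (Decidable; Irreflexive; Symmetric)
open import Relation.Binary.PropositionalEquality using (_≡_; _≢_) renaming (sym to ≡-sym)
open import Relation.Nullary using (¬_)
open import Relation.Nullary.Decidable using (¬?; _×-dec_)
open import Relation.Unary using (Pred; _∈_; _∉_; _∪_; ∁; Universal)

record Graph (n : ℕ) : Set₁ where
  infix 4 _~_ _~?_
  field
    _~_    : Rel (Fin n) 0ℓ
    _~?_   : Decidable _~_
    sym    : Symmetric _~_
    irrefl : Irreflexive _≡_ _~_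

complement : ∀ {n} → Graph n → Graph n
complement G = record
  { _~_    = λ u v → u ≢ v × ¬ (u ~ v)
  ; _~?_   = λ u v → ¬? (u ≟ v) ×-dec ¬? (u ~? v)
  ; sym    = λ (u≢v , u≁v) → u≢v ∘ ≡-sym , u≁v ∘ sym
  ; irrefl = λ u≡v (u≢v , _) → u≢v u≡v
  } where open Graph G

_≅_ : ∀ {m n} → Graph m → Graph n → Set
_≅_ {m} {n} G H =
  Σ (Fin m ↔ Fin n) λ φ → let open Inverse φ in
    ∀ u v → Graph._~_ G u v ⇔ Graph._~_ H (to u) (to v)

Connected : ∀ {n} → Graph n → Set
Connected G = ∀ u v → Star (Graph._~_ G) u v

BothConnected : ∀ {n} → Graph n → Set
BothConnected G = Connected G × Connected (complement G)

module _ {n : ℕ} (G : Graph n) where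
  open Graph G

  Induced : Pred (Fin n) 0ℓ → Rel (Fin n) 0ℓ
  Induced S u v = u ∈ S × v ∈ S × u ~ v

  -- Vertex set of the component of G[S] containing w (for w ∈ S).
  Component : Pred (Fin n) 0ℓ → Fin n → Pred (Fin n) 0ℓ
  Component S w u = u ∈ S × Star (Induced S) w u

  -- With B filled, v may fill w.
  Forces : Pred (Fin n) 0ℓ → Rel (Fin n) 0ℓ
  Forces B v w = v ∈ B × w ∉ B × Induced (W ∪ B) v w
               × (∀ u → u ∉ B → Induced (W ∪ B) v u → u ≡ w)
    where W = Component (∁ B) w

  infixl 9 _^[_]
  _^[_] : Pred (Fin n) 0ℓ → ℕ → Pred (Fin n) 0ℓ
  B ^[ zero  ] = B
  B ^[ suc i ] = B ^[ i ] ∪ λ w → ∃[ v ] Forces (B ^[ i ]) v w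

-- Propagation times can be ∞ and th₊* is undefined for edgeless graphs, so
-- numerical quantities are functional relations: Q G m reads "Q(G) = m".
-- A value ∞ is represented by there being no m at all; in a minimum over k or
-- over B the infinite entries then simply do not contribute.

_IsMinimumOf_ : ℕ → Pred ℕ 0ℓ → Set
m IsMinimumOf P = P m × (∀ k → P k → m ≤ k)

Quantity : Set₁
Quantity = ∀ {n} → Graph n → ℕ → Set

pt₊[_] : ∀ {n} → Subset.Subset n → Graph n → ℕ → Set
pt₊[ B ] G t =
  t IsMinimumOf λ s → Universal (_^[_] G (Subset._∈ B) s)

pt₊ : ℕ → Quantity
pt₊ k G t =
  t IsMinimumOf λ s → ∃[ B ] (Subset.∣ B ∣ ≡ k × pt₊[ B ] G s)

th₊ : Quantity
th₊ {n} G m =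
  m IsMinimumOf λ s →
    ∃₂ λ k t → 1 ≤ k × k ≤ n × pt₊ k G t × s ≡ k + t

th₊* : Quantity
th₊* {n} G m =
  m IsMinimumOf λ s →
    ∃₂ λ k t → 1 ≤ k × k < n × pt₊ k G t × s ≡ k * t

th₊× : Quantity
th₊× {n} G m =
  m IsMinimumOf λ s →
    ∃₂ λ k t → 1 ≤ k × k ≤ n × pt₊ k G t × s ≡ k * (1 + t)

-- ζ(G) + ζ(G̅) and ζ(G) · ζ(G̅).

Sum : Quantity → Quantity
Sum ζ G m = ∃₂ λ a b → ζ G a × ζ (complement G) b × m ≡ a + b

Prod : Quantity → Quantity
Prod ζ G m = ∃₂ λ a b → ζ G a × ζ (complement G) b × m ≡ a * b

ι : ℕ → ℚ
ι m = + m ℚ./ 1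

-- f is o(g).  Since g n > 0, the inequality says f(n)/g(n) < ε.  Rational
-- values lose nothing compared with real ones here: o-terms are only compared
-- with integers, so a real o-term may be replaced by its ceiling, and g → ∞ in
-- all uses.
LittleO : (ℕ → ℚ) → (ℕ → ℕ) → Set
LittleO f g =
    (∀ n → 1 ≤ n → 0ℚ ℚ.< f n × 0 < g n)
  × (∀ ε → 0ℚ ℚ.< ε → ∃[ N ] ∀ n → N ≤ n → f n ℚ.< ε ℚ.* ι (g n))

-- Bounds for all G with G and G̅ connected whose order n satisfies C n.  Each
-- also asserts that the quantity is defined (finite) for these G.

LowerBound : Pred ℕ 0ℓ → Quantity → (ℕ → ℕ) → Set₁
LowerBound C Q b =
  ∀ {n} (G : Graph n) → C n → BothConnected G → ∃[ m ] (Q G m × b n ≤ m)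

UpperBound : Pred ℕ 0ℓ → Quantity → (ℕ → ℕ) → Set₁
UpperBound C Q b =
  ∀ {n} (G : Graph n) → C n → BothConnected G → ∃[ m ] (Q G m × m ≤ b n)

-- The upper bound b(n) − o(g(n)).
UpperBound-o : Pred ℕ 0ℓ → Quantity → (ℕ → ℕ) → (ℕ → ℕ) → Set₁
UpperBound-o C Q b g =
  ∃[ f ] (LittleO f g ×
    (∀ {n} (G : Graph n) → C n → BothConnected G →
       ∃[ m ] (Q G m × ι m ℚ.≤ ι (b n) ℚ.- f n)))

-- Infinitely many graphs, up to isomorphism, satisfy P: no finite list
-- contains all of them.
InfinitelyMany : (∀ {n} → Graph n → Set) → Set₁
InfinitelyMany P =
  ∀ (Hs : List (∃ Graph)) →
    ∃₂ λ n (G : Graph n) → P G × All (λ (_ , H) → ¬ (G ≅ H)) Hs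

Sharp : Quantity → (ℕ → ℕ) → Set₁
Sharp Q b = InfinitelyMany λ {n} G → BothConnected G × Q G (b n)

AlmostSharp : Quantity → (ℕ → ℕ) → Set₁
AlmostSharp Q b =
  ∃[ k ] (1 ≤ k × k < 10 ×
    InfinitelyMany λ {n} G → BothConnected G ×
      ∃[ m ] (Q G m × (m ≡ b n + k ⊎ m + k ≡ b n)))

-- Tightness of the upper bound b(n) − o(g(n)).
Tight-o : Quantity → (ℕ → ℕ) → (ℕ → ℕ) → Set₁
Tight-o Q b g =
  ∃[ f ] (LittleO f g ×
    InfinitelyMany λ {n} G → BothConnected G ×
      ∃[ m ] (Q G m × ι m ≡ ι (b n) ℚ.- f n))

{-# OPTIONS --safe #-}

-- If the vertices are filled one at a time from a PSD forcing set of size k, every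
-- component of the unfilled part keeps at most k filled neighbours.  Playing such
-- fillings of G and of its complement against each other shows that forcing sets
-- of sizes k and l satisfy n ≤ k + l + 2, and n ≤ k + l + 1 if both need a single
-- step; together with the fact that a single vertex never forces everything in one
-- step, this gives the lower bounds.  The upper bounds come from filling all
-- vertices, or all but two nonadjacent ones; for n = 4 and n = 5 all adjacency
-- matrices are inspected.  Two tree-like families come close to the lower bounds.
-- For the upper bounds, take a graph whose adjacency is given by inner products of
-- binary vectors: neither it nor its complement has two large disjoint vertex sets
-- without edges between them, whereas a forcing set of size k leaves such a pair of
-- sets of size about (n − k) / 4.

module Submission where

open import Defs
open import Data.Bool.Base using (Bool; true; false; not; _∧_; _∨_; _xor_; if_then_else_)
import Data.Bool.Properties as Bool
open import Data.Empty using (⊥; ⊥-elim)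
open import Data.Fin.Base using (Fin; zero; suc; toℕ; fromℕ<)
open import Data.Fin.Patterns using (0F; 1F; 2F; 3F; 4F)
open import Data.Fin.Properties using (_≟_; any?; all?; suc-injective; toℕ<n; <⇒notInjective; toℕ-injective; toℕ-fromℕ<)
open import Data.Fin.Subset using (Subset; inside; outside; _∈_; _∉_; ∣_∣; ⁅_⁆)
import Data.Fin.Subset as Subset
open import Data.Fin.Subset.Properties using (_∈?_; anySubset?; x∈⁅x⁆; x∈⁅y⁆⇒x≡y; x∈p∪q⁺; x∈p∪q⁻)
open import Data.List.Base using (List; []; _∷_)
open import Data.List.Relation.Unary.All using (All; []; _∷_)
open import Data.Nat.Base
open import Data.Nat.Properties hiding (_≟_; suc-injective; ≡-decSetoid)
import Data.Nat.Properties as ℕ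
open import Data.Nat.Tactic.RingSolver using (solve-∀)
open import Data.Product.Base using (∃; ∃₂; ∃-syntax; _×_; _,_; proj₁; proj₂)
open import Data.Sum.Base as Sum using (_⊎_; inj₁; inj₂; [_,_]′)
open import Data.Unit.Base using (⊤; tt)
open import Data.Vec.Base as Vec using (Vec; []; _∷_; lookup; tabulate; here; there)
open import Data.Vec.Properties using (lookup∘tabulate; ≡-dec)
open import Function.Base using (_∘_; id; flip; case_of_)
open import Function.Bundles using (Inverse)
open import Level using (0ℓ)
open import Relation.Binary.Construct.Closure.ReflexiveTransitive as Star using (Star; ε; _◅_; _◅◅_)
open import Relation.Binary.Core using (Rel)
import Relation.Binary.Definitions as B
open import Relation.Binary.PropositionalEquality
open import Relation.Nullary using (¬_; Dec; yes; no; does)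
open import Relation.Nullary.Decidable using (¬?; _×-dec_; _⊎-dec_; _→-dec_; map′; decidable-stable)
open import Relation.Unary using (Pred; Decidable; ∁; Universal)
import Data.Integer.Base as ℤ
import Data.Integer.Properties as ℤ
import Data.Rational.Base as ℚ
import Data.Rational.Properties as ℚ
import Data.Rational.Unnormalised.Base as ℚᵘ
import Data.Rational.Unnormalised.Properties as ℚᵘ
open import Algebra.Properties.Group ℚ.+-0-group using (//-rightDividesʳ)
import Data.Vec.Properties as Vec
open import Data.Nat.DivMod using (_/_; m≡m%n+[m/n]*n; m%n<n; m/n*n≤m)

-- The boundary bound lets a filling play the part of a tree decomposition of width k, and n ≤ k + l
-- + 2 is the counterpart of the Nordhaus-Gaddum bound for tree width. It is not strong enough on
-- its own: n = 6, k = l = 2 with one step on each side satisfies it, yet would give products 9, 4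
-- and 16 where 12, 5 and 18 are required. All other combinations of times get by with it, hence the
-- separate bound for two one-step sets. The o-term of an upper bound and the o-term of its
-- tightness are chosen independently: the constant 1 serves for the former, the exact shortfall of
-- the inner product family for the latter. Any graphs would do that, together with their
-- complements, have only sublinear pairs of sets without edges between them. Random graphs are of
-- this kind; inner products give an explicit family with sets of order √n.

-- Counting decidable subsets of `Fin n`

card : ∀ {n} {P : Pred (Fin n) 0ℓ} → Decidable P → ℕ
card {zero}  P? = 0
card {suc n} P? = (if does (P? zero) then 1 else 0) + card (P? ∘ suc)

card-⊎ : ∀ {n} {P Q R : Pred (Fin n) 0ℓ} (P? : Decidable P) (Q? : Decidable Q) (R? : Decidable R) →
         (∀ x → R x → P x ⊎ Q x) → card R? ≤ card P? + card Q?
card-⊎ {zero}  P? Q? R? sub = z≤n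
card-⊎ {suc n} P? Q? R? sub
  with P? zero | Q? zero | R? zero | card-⊎ (P? ∘ suc) (Q? ∘ suc) (R? ∘ suc) (sub ∘ suc)
... | yes _ | yes _ | yes _ | ih = s≤s (≤-trans ih (+-monoʳ-≤ _ (n≤1+n _)))
... | yes _ | no  _ | yes _ | ih = s≤s ih
... | no  _ | yes _ | yes _ | ih = ≤-trans (s≤s ih) (≤-reflexive (sym (+-suc _ _)))
... | no ¬p | no ¬q | yes r | ih = ⊥-elim ([ ¬p , ¬q ]′ (sub zero r))
... | yes _ | yes _ | no  _ | ih = ≤-trans ih (+-mono-≤ (n≤1+n _) (n≤1+n _))
... | yes _ | no  _ | no  _ | ih = m≤n⇒m≤1+n ih
... | no  _ | yes _ | no  _ | ih = ≤-trans ih (+-monoʳ-≤ _ (n≤1+n _))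
... | no  _ | no  _ | no  _ | ih = ih

card-disjoint : ∀ {n} {P Q R : Pred (Fin n) 0ℓ} (P? : Decidable P) (Q? : Decidable Q) (R? : Decidable R) →
                (∀ x → P x → R x) → (∀ x → Q x → R x) → (∀ x → P x → ¬ Q x) →
                card P? + card Q? ≤ card R?
card-disjoint {zero}  P? Q? R? P⊆R Q⊆R dis = z≤n
card-disjoint {suc n} P? Q? R? P⊆R Q⊆R dis
  with P? zero | Q? zero | R? zero
     | card-disjoint (P? ∘ suc) (Q? ∘ suc) (R? ∘ suc) (P⊆R ∘ suc) (Q⊆R ∘ suc) (dis ∘ suc)
... | yes p | yes q | _     | ih = ⊥-elim (dis zero p q)
... | yes p | no  _ | no ¬r | ih = ⊥-elim (¬r (P⊆R zero p))
... | no  _ | yes q | no ¬r | ih = ⊥-elim (¬r (Q⊆R zero q))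
... | yes _ | no  _ | yes _ | ih = s≤s ih
... | no  _ | yes _ | yes _ | ih = ≤-trans (≤-reflexive (+-suc _ _)) (s≤s ih)
... | no  _ | no  _ | yes _ | ih = m≤n⇒m≤1+n ih
... | no  _ | no  _ | no  _ | ih = ih

card-none : ∀ {n} {P : Pred (Fin n) 0ℓ} (P? : Decidable P) → (∀ x → ¬ P x) → card P? ≡ 0
card-none {zero}  P? ¬P = refl
card-none {suc n} P? ¬P with P? zero
... | yes p = ⊥-elim (¬P zero p)
... | no  _ = card-none (P? ∘ suc) (¬P ∘ suc)

card-mono : ∀ {n} {P Q : Pred (Fin n) 0ℓ} (P? : Decidable P) (Q? : Decidable Q) →
            (∀ x → P x → Q x) → card P? ≤ card Q?
card-mono {n} P? Q? P⊆Q =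
  ≤-trans (card-⊎ Q? (λ _ → no id) P? (λ x → inj₁ ∘ P⊆Q x))
          (≤-reflexive (trans (cong (card Q? +_) (card-none {n} {λ _ → ⊥} (λ _ → no id) (λ _ → id))) (+-identityʳ _)))

card-cong : ∀ {n} {P Q : Pred (Fin n) 0ℓ} (P? : Decidable P) (Q? : Decidable Q) →
            (∀ x → P x → Q x) → (∀ x → Q x → P x) → card P? ≡ card Q?
card-cong P? Q? f g = ≤-antisym (card-mono P? Q? f) (card-mono Q? P? g)

card-pos : ∀ {n} {P : Pred (Fin n) 0ℓ} (P? : Decidable P) x → P x → 1 ≤ card P?
card-pos P? zero p with P? zero
... | yes _ = s≤s z≤n
... | no ¬p = ⊥-elim (¬p p)
card-pos P? (suc x) p = ≤-trans (card-pos (P? ∘ suc) x p) (m≤n+m _ _)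

card-all : ∀ {n} {P : Pred (Fin n) 0ℓ} (P? : Decidable P) → (∀ x → P x) → card P? ≡ n
card-all {zero}  P? all = refl
card-all {suc n} P? all with P? zero
... | yes _ = cong suc (card-all (P? ∘ suc) (all ∘ suc))
... | no ¬p = ⊥-elim (¬p (all zero))

card-≤n : ∀ {n} {P : Pred (Fin n) 0ℓ} (P? : Decidable P) → card P? ≤ n
card-≤n P? = ≤-trans (card-mono P? (λ _ → yes tt) (λ _ _ → tt)) (≤-reflexive (card-all (λ _ → yes tt) (λ _ → tt)))

card-singleton : ∀ {n} (x : Fin n) → card (_≟ x) ≡ 1
card-singleton {suc n} zero    = cong suc (card-none {n} (λ y → suc y ≟ zero) λ _ ())
card-singleton {suc n} (suc x) =
  trans (card-cong (λ y → suc y ≟ suc x) (_≟ x) (λ _ → suc-injective) (λ _ → cong suc)) (card-singleton x)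

card-inj : ∀ {n m} {P : Pred (Fin n) 0ℓ} {Q : Pred (Fin m) 0ℓ} (P? : Decidable P) (Q? : Decidable Q)
           (f : ∀ x → P x → Fin m) → (∀ x p → Q (f x p)) →
           (∀ {x y} p q → f x p ≡ f y q → x ≡ y) → card P? ≤ card Q?
card-inj {zero}  P? Q? f Qf inj = z≤n
card-inj {suc n} {Q = Q} P? Q? f Qf inj with P? zero
... | no  _ = card-inj (P? ∘ suc) Q? (f ∘ suc) (λ x → Qf (suc x)) (λ p q → suc-injective ∘ inj p q)
... | yes p = begin
    1 + card (P? ∘ suc)              ≤⟨ +-mono-≤ (≤-reflexive (sym (card-singleton y)))
                                         (card-inj (P? ∘ suc) Q∖y? (f ∘ suc)
                                            (λ x q → Qf (suc x) q , λ eq → case inj q p eq of λ ())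
                                            (λ p q → suc-injective ∘ inj p q)) ⟩
    card (_≟ y) + card Q∖y?          ≤⟨ card-disjoint (_≟ y) Q∖y? Q? (λ { _ refl → Qf zero p }) (λ _ → proj₁)
                                         (λ _ eq (_ , ne) → ne eq) ⟩
    card Q?                          ∎
  where
  open ≤-Reasoning
  y = f zero p
  Q∖y? : Decidable (λ x → Q x × x ≢ y)
  Q∖y? x = Q? x ×-dec ¬? (x ≟ y)

card-compl : ∀ {n} {P : Pred (Fin n) 0ℓ} (P? : Decidable P) → card P? + card (¬? ∘ P?) ≡ n
card-compl P? = ≤-antisym
  (≤-trans (card-disjoint P? (¬? ∘ P?) (λ _ → yes tt) _ _ (λ _ p ¬p → ¬p p)) (card-≤n {P = λ _ → ⊤} (λ _ → yes tt)))
  (≤-trans (≤-reflexive (sym (card-all (λ _ → yes tt) (λ _ → tt))))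
           (card-⊎ P? (¬? ∘ P?) (λ _ → yes tt) (λ x _ → split x)))
  where
  split : ∀ x → _
  split x with P? x
  ... | yes p = inj₁ p
  ... | no ¬p = inj₂ ¬p

card-remove : ∀ {n} {P : Pred (Fin n) 0ℓ} (P? : Decidable P) x →
              card P? ≤ 1 + card (λ y → P? y ×-dec ¬? (y ≟ x))
card-remove P? x =
  ≤-trans (card-⊎ (_≟ x) (λ y → P? y ×-dec ¬? (y ≟ x)) P? split) (+-monoˡ-≤ _ (≤-reflexive (card-singleton x)))
  where
  split : ∀ y → _ → _
  split y p with y ≟ x
  ... | yes eq = inj₁ eq
  ... | no  ne = inj₂ (p , ne)

card-∈ : ∀ {n} (S : Subset n) → card (_∈? S) ≡ ∣ S ∣
card-∈ []            = refl
card-∈ (inside ∷ S)  = cong suc (trans (card-cong (λ x → suc x ∈? (inside ∷ S)) (_∈? S) (λ { _ (there p) → p }) (λ _ → there)) (card-∈ S))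
card-∈ (outside ∷ S) = trans (card-cong (λ x → suc x ∈? (outside ∷ S)) (_∈? S) (λ { _ (there p) → p }) (λ _ → there)) (card-∈ S)

toSubset : ∀ {n} {P : Pred (Fin n) 0ℓ} → Decidable P → Subset n
toSubset P? = tabulate (does ∘ P?)

∈-toSubset⁺ : ∀ {n} {P : Pred (Fin n) 0ℓ} (P? : Decidable P) x → P x → x ∈ toSubset P?
∈-toSubset⁺ P? zero p with P? zero
... | yes _ = here
... | no ¬p = ⊥-elim (¬p p)
∈-toSubset⁺ P? (suc x) p = there (∈-toSubset⁺ (P? ∘ suc) x p)

∈-toSubset⁻ : ∀ {n} {P : Pred (Fin n) 0ℓ} (P? : Decidable P) x → x ∈ toSubset P? → P x
∈-toSubset⁻ P? zero x∈ with P? zero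
∈-toSubset⁻ P? zero x∈ | yes p = p
∈-toSubset⁻ P? zero () | no _
∈-toSubset⁻ P? (suc x) (there x∈) = ∈-toSubset⁻ (P? ∘ suc) x x∈

∣toSubset∣ : ∀ {n} {P : Pred (Fin n) 0ℓ} (P? : Decidable P) → ∣ toSubset P? ∣ ≡ card P?
∣toSubset∣ P? = trans (sym (card-∈ (toSubset P?)))
  (card-cong (_∈? toSubset P?) P? (∈-toSubset⁻ P?) (∈-toSubset⁺ P?))

-- Decidability of reachability

-- Floyd–Warshall: Path k u v says that some path from u to v has all its inner
-- vertices among the first k.
module _ {n} {R : Rel (Fin n) 0ℓ} (R? : B.Decidable R) where

  private
    Path : ℕ → Rel (Fin n) 0ℓ
    Path zero    u v = u ≡ v ⊎ R u v
    Path (suc k) u v = Path k u v ⊎ ∃[ x ] (toℕ x ≡ k × Path k u x × Path k x v)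

    path? : ∀ k → B.Decidable (Path k)
    path? zero    u v = (u ≟ v) ⊎-dec R? u v
    path? (suc k) u v = path? k u v ⊎-dec any? λ x → (toℕ x ℕ.≟ k) ×-dec path? k u x ×-dec path? k x v

    path⇒star : ∀ k {u v} → Path k u v → Star R u v
    path⇒star zero    (inj₁ refl)            = ε
    path⇒star zero    (inj₂ r)               = r ◅ ε
    path⇒star (suc k) (inj₁ p)               = path⇒star k p
    path⇒star (suc k) (inj₂ (_ , _ , p , q)) = path⇒star k p ◅◅ path⇒star k q

    path-trans : ∀ k {u x v} → toℕ x < k → Path k u x → Path k x v → Path k u v
    path-trans (suc k) {x = x} (s≤s x≤k) p q with m≤n⇒m<n∨m≡n x≤k
    path-trans (suc k) _ p q | inj₂ refl = inj₂ (_ , refl , to p , from q)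
      where
      to : ∀ {u x} → Path (suc (toℕ x)) u x → Path (toℕ x) u x
      to (inj₁ p) = p
      to (inj₂ (y , eq , p , _)) rewrite toℕ-injective eq = p
      from : ∀ {v x} → Path (suc (toℕ x)) x v → Path (toℕ x) x v
      from (inj₁ p) = p
      from (inj₂ (y , eq , _ , p)) rewrite toℕ-injective eq = p
    path-trans (suc k) _ (inj₁ p) (inj₁ q) | inj₁ x<k = inj₁ (path-trans k x<k p q)
    path-trans (suc k) _ (inj₁ p) (inj₂ (y , eq , q , q′)) | inj₁ x<k = inj₂ (y , eq , path-trans k x<k p q , q′)
    path-trans (suc k) _ (inj₂ (y , eq , p , p′)) (inj₁ q) | inj₁ x<k = inj₂ (y , eq , p , path-trans k x<k p′ q)
    -- Both halves visit the vertex with index `k`; the loop between the two visits is cut out.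
    path-trans (suc k) _ (inj₂ (y , eq , p , _)) (inj₂ (z , eq′ , _ , q)) | inj₁ _
      with toℕ-injective (trans eq (sym eq′))
    ... | refl = inj₂ (y , eq , p , q)

    path-lift : ∀ k {u v} → Path 0 u v → Path k u v
    path-lift zero    p = p
    path-lift (suc k) p = inj₁ (path-lift k p)

    star⇒path : ∀ {u v} → Star R u v → Path n u v
    star⇒path ε                = path-lift n (inj₁ refl)
    star⇒path (_◅_ {j = x} r p) = path-trans n (toℕ<n x) (path-lift n (inj₂ r)) (star⇒path p)

  star? : B.Decidable (Star R)
  star? u v = map′ (path⇒star n) star⇒path (path? n u v)

-- Components of the unfilled part and the forcing rule

module _ {n} (G : Graph n) where
  open Graph G using (_~_; _~?_)

  Reach : Pred (Fin n) 0ℓ → Rel (Fin n) 0ℓ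
  Reach S = Star (Induced G (∁ S))

  -- For unfilled `b`, this is the component of `b` together with its neighbours. Because `c ≡ a` is
  -- allowed, the failure of `Near` keeps `a` away from the whole component whether or not `a` is
  -- filled.
  Near : Pred (Fin n) 0ℓ → Rel (Fin n) 0ℓ
  Near S b a = ∃[ c ] (Reach S b c × (c ≡ a ⊎ c ~ a))

  Boundary : Pred (Fin n) 0ℓ → Rel (Fin n) 0ℓ
  Boundary S b a = S a × Near S b a

  -- `Forces` without the induced subgraph on `W ∪ B`: only unfilled vertices are tested, and those
  -- in `W ∪ B` are the ones reachable from `w`.
  Forcing : Pred (Fin n) 0ℓ → Rel (Fin n) 0ℓ
  Forcing S v w = S v × ¬ S w × v ~ w × (∀ u → ¬ S u → v ~ u → Reach S w u → u ≡ w)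

  reach-sym : ∀ {S u v} → Reach S u v → Reach S v u
  reach-sym = Star.reverse λ (p , q , r) → q , p , Graph.sym G r

  reach-unfilled : ∀ {S u v} → ¬ S u → Reach S u v → ¬ S v
  reach-unfilled ¬s ε             = ¬s
  reach-unfilled ¬s ((_ , q , _) ◅ p) = reach-unfilled q p

  reach-mono : ∀ {S S′ u v} → (∀ x → S x → S′ x) → Reach S′ u v → Reach S u v
  reach-mono sub = Star.map λ (p , q , r) → p ∘ sub _ , q ∘ sub _ , r

  reach-edge : ∀ {S u v w} → ¬ S u → Reach S u v → v ~ w → ¬ S w → Reach S u w
  reach-edge ¬s p e ¬t = p ◅◅ ((reach-unfilled ¬s p , ¬t , e) ◅ ε)

  near-mono : ∀ {S S′ u v} → (∀ x → S x → S′ x) → Near S′ u v → Near S u v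
  near-mono sub (c , r , e) = c , reach-mono sub r , e

  near⇒reach : ∀ {S u v} → ¬ S u → ¬ S v → Near S u v → Reach S u v
  near⇒reach ¬u ¬v (c , r , inj₁ refl) = r
  near⇒reach ¬u ¬v (c , r , inj₂ e)    = reach-edge ¬u r e ¬v

  boundary⇒adjacent : ∀ {S u v} → ¬ S u → Boundary S u v → ∃[ c ] (Reach S u c × c ~ v)
  boundary⇒adjacent ¬u (s , c , r , inj₁ refl) = ⊥-elim (reach-unfilled ¬u r s)
  boundary⇒adjacent ¬u (s , c , r , inj₂ e)    = c , r , e

  forces⇒forcing : ∀ {S v w} → Forces G S v w → Forcing S v w
  forces⇒forcing (Sv , ¬Sw , (_ , _ , v~w) , uniq) =
    Sv , ¬Sw , v~w , λ u ¬Su v~u r → uniq u ¬Su (inj₂ Sv , inj₁ (¬Su , r) , v~u)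

  forcing⇒forces : ∀ {S v w} → Forcing S v w → Forces G S v w
  forcing⇒forces {S} (Sv , ¬Sw , v~w , uniq) =
    Sv , ¬Sw , (inj₂ Sv , inj₁ (¬Sw , ε) , v~w) ,
    λ { u ¬Su (_ , inj₁ (_ , r) , v~u) → uniq u ¬Su v~u r
      ; u ¬Su (_ , inj₂ Su , _)        → ⊥-elim (¬Su Su) }

  module _ {S : Pred (Fin n) 0ℓ} (S? : Decidable S) where

    reach? : B.Decidable (Reach S)
    reach? = star? λ u v → ¬? (S? u) ×-dec ¬? (S? v) ×-dec (u ~? v)

    near? : B.Decidable (Near S)
    near? b a = any? λ c → reach? b c ×-dec ((c ≟ a) ⊎-dec (c ~? a))

    boundary? : B.Decidable (Boundary S)
    boundary? b a = S? a ×-dec near? b a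

    forcing? : B.Decidable (Forcing S)
    forcing? v w = S? v ×-dec ¬? (S? w) ×-dec (v ~? w) ×-dec
      all? λ u → ¬? (S? u) →-dec ((v ~? u) →-dec (reach? w u →-dec (u ≟ w)))

  filled? : ∀ {S} → Decidable S → ∀ t → Decidable (_^[_] G S t)
  filled? S? zero    = S?
  filled? S? (suc t) w = filled? S? t w ⊎-dec any? λ v →
    map′ forcing⇒forces forces⇒forcing (forcing? (filled? S? t) v w)

  -- Consider the earliest round that fills a vertex outside `F`. Its forcer lies in `F`, and since
  -- the components of the unfilled part only shrink when more is filled, the forcer may still act
  -- with `F` filled. This is what allows rounds to be replaced by single forces in any order.
  progress : ∀ {B F} (B? : Decidable B) (F? : Decidable F) → (∀ x → B x → F x) →
             ∀ t {x} → _^[_] G B t x → ¬ F x → ∃₂ (Forcing F)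
  progress B? F? B⊆F zero b ¬f = ⊥-elim (¬f (B⊆F _ b))
  progress {B} {F} B? F? B⊆F (suc t) (inj₁ b) ¬f = progress B? F? B⊆F t b ¬f
  progress {B} {F} B? F? B⊆F (suc t) {x} (inj₂ (v , force)) ¬f
    with any? (λ z → filled? B? t z ×-dec ¬? (F? z)) | forces⇒forcing force
  ... | yes (z , b , ¬f′) | _ = progress B? F? B⊆F t b ¬f′
  ... | no none | Bv , _ , v~x , uniq =
    v , x , sub v Bv , ¬f , v~x , λ u ¬Fu v~u r → uniq u (¬Fu ∘ sub u) v~u (reach-mono sub r)
    where
    sub : ∀ z → _^[_] G B t z → F z
    sub z b = decidable-stable (F? z) λ ¬Fz → none (z , b , ¬Fz)

-- Filling one vertex at a time

Achieves : ∀ {n} → Graph n → ℕ → ℕ → Set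
Achieves {n} G k t = ∃[ B ] (∣ B ∣ ≡ k × Universal (_^[_] G (_∈ B) t))

-- The vertices filled one at a time; every component of the unfilled part keeps
-- at most k filled neighbours, since a forcer loses contact with it.
record Filling {n} (G : Graph n) (k : ℕ) : Set where
  field
    stage    : ℕ → Subset n
    size     : card (_∈? stage 0) ≡ k
    grows    : ∀ i {x} → x ∈ stage i → x ∈ stage (suc i)
    adds     : ∀ i {x} → x ∉ stage i → ∃[ w ] (w ∉ stage i × w ∈ stage (suc i) ×
                 (∀ {y} → y ∈ stage (suc i) → y ∈ stage i ⊎ y ≡ w))
    boundary : ∀ i {b} → b ∉ stage i → card (boundary? G (_∈? stage i) b) ≤ k

  grows* : ∀ {i j} → i ≤ j → ∀ {x} → x ∈ stage i → x ∈ stage j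
  grows* {i} {j} i≤j = go (≤⇒≤′ i≤j)
    where
    go : ∀ {j} → i ≤′ j → ∀ {x} → x ∈ stage i → x ∈ stage j
    go ≤′-refl     s = s
    go (≤′-step p) s = grows _ (go p s)

module _ {n} (G : Graph n) where
  open Graph G using (_~_; _~?_)

  -- A component not containing `w` gains no boundary. A component left over from that of `w` may
  -- gain `w`, but loses `v`, whose only neighbour in the old component was `w`; so sending `w` to
  -- `v` and fixing all else injects its boundary into the old one.
  boundary-step : ∀ {S S′ : Pred (Fin n) 0ℓ} (S? : Decidable S) (S′? : Decidable S′) {k v w} →
    (∀ x → S x → S′ x) → S′ w → (∀ x → S′ x → S x ⊎ x ≡ w) → Forcing G S v w →
    (∀ b → ¬ S b → card (boundary? G S? b) ≤ k) →
    ∀ b → ¬ S′ b → card (boundary? G S′? b) ≤ k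
  boundary-step {S} {S′} S? S′? {k} {v} {w} S⊆S′ S′w S′⊆ (Sv , ¬Sw , v~w , uniq) bd b ¬S′b
    with reach? G S? w b
  ... | no ¬r = ≤-trans (card-mono (boundary? G S′? b) (boundary? G S? b) sub) (bd b ¬Sb)
    where
    ¬Sb = ¬S′b ∘ S⊆S′ b
    sub : ∀ a → Boundary G S′ b a → Boundary G S b a
    sub a (S′a , near) with S′⊆ a S′a
    ... | inj₁ Sa   = Sa , near-mono G S⊆S′ near
    ... | inj₂ refl = ⊥-elim (¬r (reach-sym G (near⇒reach G ¬Sb ¬Sw (near-mono G S⊆S′ near))))
  ... | yes r = ≤-trans (card-inj (boundary? G S′? b) (boundary? G S? w) (λ a _ → f a) f∈ f-inj) (bd w ¬Sw)
    where
    f : Fin n → Fin n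
    f a with a ≟ w
    ... | yes _ = v
    ... | no  _ = a
    ¬bdv : ∀ {a} → Boundary G S′ b a → a ≢ v
    ¬bdv bd refl with boundary⇒adjacent G ¬S′b bd
    ... | c , r′ , c~v = reach-unfilled G ¬S′b r′ (subst S′ (sym c≡w) S′w)
      where
      c≡w : c ≡ w
      c≡w = uniq c (reach-unfilled G ¬S′b r′ ∘ S⊆S′ c) (Graph.sym G c~v) (r ◅◅ reach-mono G S⊆S′ r′)
    f∈ : ∀ a → Boundary G S′ b a → Boundary G S w (f a)
    f∈ a (S′a , c , r′ , e) with a ≟ w
    ... | yes _ = Sv , w , ε , inj₂ (Graph.sym G v~w)
    ... | no a≢w with S′⊆ a S′a
    ...   | inj₁ Sa  = Sa , c , r ◅◅ reach-mono G S⊆S′ r′ , e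
    ...   | inj₂ a≡w = ⊥-elim (a≢w a≡w)
    f-inj : ∀ {x y} → Boundary G S′ b x → Boundary G S′ b y → f x ≡ f y → x ≡ y
    f-inj {x} {y} p q eq with x ≟ w | y ≟ w
    ... | yes refl | yes refl = refl
    ... | yes refl | no _     = ⊥-elim (¬bdv q (sym eq))
    ... | no _     | yes refl = ⊥-elim (¬bdv p eq)
    ... | no _     | no _     = eq

  forcible? : ∀ (S : Subset n) → Dec (∃₂ λ w v → Forcing G (_∈ S) v w)
  forcible? S = any? λ w → any? λ v → forcing? G (_∈? S) v w

  -- Standing still is a default that makes the stages total; along the stages of a forcing set,
  -- `progress` shows that it occurs only when every vertex is filled.
  advance : ∀ {S} → Dec (∃₂ λ w v → Forcing G (_∈ S) v w) → Subset n
  advance {S} (yes (w , _)) = S Subset.∪ ⁅ w ⁆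
  advance {S} (no _)        = S

  filling : ∀ {k t} → Achieves G k t → Filling G k
  filling {k} {t} (B , ∣B∣≡k , all) = record
    { stage    = stage
    ; size     = trans (card-∈ B) ∣B∣≡k
    ; grows    = λ i → advance⊇ (forcible? (stage i))
    ; adds     = λ i x∉ → advance-adds (forcible? (stage i))
                   (let v , w , f = progress G (_∈? B) (_∈? stage i) (λ _ → B⊆stage i) t (all _) x∉ in w , v , f)
    ; boundary = λ i → bd i _
    }
    where
    stage : ℕ → Subset n
    stage zero    = B
    stage (suc i) = advance (forcible? (stage i))

    advance⊇ : ∀ {S} d {x} → x ∈ S → x ∈ advance {S} d
    advance⊇ (yes _) s = x∈p∪q⁺ (inj₁ s)
    advance⊇ (no _)  s = s

    split : ∀ (S : Subset n) w {y} → y ∈ S Subset.∪ ⁅ w ⁆ → y ∈ S ⊎ y ≡ w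
    split S w = Sum.map₂ (x∈⁅y⁆⇒x≡y w) ∘ x∈p∪q⁻ S ⁅ w ⁆

    advance-adds : ∀ {S} d → (∃₂ λ w v → Forcing G (_∈ S) v w) → ∃[ w ] (w ∉ S × w ∈ advance {S} d ×
                 (∀ {y} → y ∈ advance {S} d → y ∈ S ⊎ y ≡ w))
    advance-adds {S} (yes (w , _ , _ , w∉ , _)) _ = w , w∉ , x∈p∪q⁺ (inj₂ (x∈⁅x⁆ w)) , split S w
    advance-adds (no ¬f) f = ⊥-elim (¬f f)

    B⊆stage : ∀ i {x} → x ∈ B → x ∈ stage i
    B⊆stage zero    b = b
    B⊆stage (suc i) b = advance⊇ (forcible? (stage i)) (B⊆stage i b)

    advance-bd : ∀ {S} d → (∀ b → b ∉ S → card (boundary? G (_∈? S) b) ≤ k) →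
                 ∀ b → b ∉ advance {S} d → card (boundary? G (_∈? advance {S} d) b) ≤ k
    advance-bd {S} (yes (w , v , f)) bd =
      boundary-step (_∈? S) (_∈? (S Subset.∪ ⁅ w ⁆)) (λ _ s → x∈p∪q⁺ (inj₁ s)) (x∈p∪q⁺ (inj₂ (x∈⁅x⁆ w)))
        (λ _ → split S w) f bd
    advance-bd (no _) bd = bd

    bd : ∀ i b → b ∉ stage i → card (boundary? G (_∈? stage i) b) ≤ k
    bd zero    b _ = ≤-trans (card-mono (boundary? G (_∈? B) b) (_∈? B) (λ _ → proj₁))
                       (≤-reflexive (trans (card-∈ B) ∣B∣≡k))
    bd (suc i) = advance-bd (forcible? (stage i)) (bd i)

-- Forcing sets of a graph and of its complement

-- A relation instead of the function `complement`, so that the two graphs can exchange roles: a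
-- double complement is not definitionally the original graph.
record Complementary {n} (G H : Graph n) : Set where
  field
    cover : ∀ {u v} → u ≢ v → Graph._~_ G u v ⊎ Graph._~_ H u v
    excl  : ∀ {u v} → Graph._~_ G u v → ¬ Graph._~_ H u v

  ¬H⇒G : ∀ {u v} → u ≢ v → ¬ Graph._~_ H u v → Graph._~_ G u v
  ¬H⇒G u≢v ¬h with cover u≢v
  ... | inj₁ g = g
  ... | inj₂ h = ⊥-elim (¬h h)

  ¬G⇒H : ∀ {u v} → u ≢ v → ¬ Graph._~_ G u v → Graph._~_ H u v
  ¬G⇒H u≢v ¬g with cover u≢v
  ... | inj₁ g = ⊥-elim (¬g g)
  ... | inj₂ h = h

complementary : ∀ {n} (G : Graph n) → Complementary G (complement G)
complementary G = record { cover = cover ; excl = λ g (_ , ¬g) → ¬g g }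
  where
  cover : ∀ {u v} → u ≢ v → _
  cover {u} {v} u≢v with Graph._~?_ G u v
  ... | yes g = inj₁ g
  ... | no ¬g = inj₂ (u≢v , ¬g)

Complementary-sym : ∀ {n} {G H : Graph n} → Complementary G H → Complementary H G
Complementary-sym GH = record { cover = Sum.swap ∘ cover ; excl = flip excl }
  where open Complementary GH

module _ {n k} {G : Graph n} (F : Filling G k) where
  open Graph G using (_~_)
  open Filling F

  unfilled? : ∀ i → Decidable (_∉ stage i)
  unfilled? i = ¬? ∘ (_∈? stage i)

  shrinks : ∀ i {x} → x ∉ stage i → card (unfilled? (suc i)) < card (unfilled? i)
  shrinks i x∉ with adds i x∉
  ... | w , w∉ , w∈ , _ = ≤-trans (+-monoˡ-≤ _ (≤-reflexive (sym (card-singleton w))))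
    (card-disjoint (_≟ w) (unfilled? (suc i)) (unfilled? i)
      (λ { _ refl → w∉ }) (λ _ y∉ → y∉ ∘ grows i) (λ { _ refl y∉ → y∉ w∈ }))

  -- Nonadjacency with a time stamp. Nonadjacency alone would be too weak: two nonadjacent pairs can
  -- form a 4-cycle, which is the configuration that two separated pairs must avoid.
  Separated : Rel (Fin n) 0ℓ
  Separated a b = ∃[ i ] (b ∉ stage i × ¬ Near G (_∈ stage i) b a)

  separated⇒≁ : ∀ {a b} → Separated a b → ¬ a ~ b
  separated⇒≁ {a} {b} (i , _ , far) e = far (b , ε , inj₂ (Graph.sym G e))

  separated⇒≢ : ∀ {a b} → Separated a b → a ≢ b
  separated⇒≢ {a} (i , _ , far) refl = far (a , ε , inj₁ refl)

  -- c and d lie between a and b, hence are filled before b, and vice versa.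
  separated-cross : ∀ {a b c d} → Separated a b → Separated c d →
                    a ~ c → a ~ d → b ~ c → b ~ d → ⊥
  separated-cross {a} {b} {c} {d} (i , b∉ , far) (j , d∉ , far′) a~c a~d b~c b~d = [ case₁ , case₂ ]′ (≤-total i j)
    where
    between : ∀ {a b c i} → b ∉ stage i → ¬ Near G (_∈ stage i) b a → a ~ c → b ~ c → c ∈ stage i
    between {c = c} {i} b∉ far a~c b~c with c ∈? stage i
    ... | yes c∈ = c∈
    ... | no  c∉ = ⊥-elim (far (c , (b∉ , c∉ , b~c) ◅ ε , inj₂ (Graph.sym G a~c)))
    case₁ : i ≤ j → ⊥
    case₁ i≤j = d∉ (grows* i≤j (between b∉ far a~d b~d))
    case₂ : j ≤ i → ⊥
    case₂ j≤i = b∉ (grows* j≤i (between d∉ far′ (Graph.sym G b~c) (Graph.sym G b~d)))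

  -- Stop just before the last vertex `w` of `A` is filled. The rest of `A` is then filled, so those
  -- of its vertices that are near `w` belong to the boundary of `w`, which has at most `k`
  -- vertices. With `w` itself this accounts for at most `k + 1` elements of `A`; any further one is
  -- separated from `w`.
  large⇒separated : ∀ {A} (A? : Decidable A) → k + 1 < card A? → ∃₂ λ a b → A a × A b × Separated a b
  large⇒separated {A} A? k+1<A with any? (λ x → A? x ×-dec unfilled? 0 x)
  ... | no none = ⊥-elim (<-irrefl refl (<-≤-trans (≤-<-trans (m≤m+n k 1) k+1<A)
        (≤-trans (card-mono A? (_∈? stage 0) λ x a → decidable-stable (x ∈? stage 0) λ x∉ → none (x , a , x∉))
                 (≤-reflexive size))))
  ... | yes (x , a , x∉) = go _ 0 ≤-refl a x∉
    where
    go : ∀ fuel i → card (unfilled? i) ≤ fuel → ∀ {x} → A x → x ∉ stage i →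
         ∃₂ λ a b → A a × A b × Separated a b
    go zero i le {x} a x∉ = case ≤-trans (card-pos (unfilled? i) x x∉) le of λ ()
    go (suc fuel) i le {x} a x∉ with any? (λ y → A? y ×-dec unfilled? (suc i) y)
    ... | yes (y , a′ , y∉) = go fuel (suc i) (≤-pred (≤-trans (shrinks i x∉) le)) a′ y∉
    ... | no none with adds i x∉
    ...   | w , w∉ , _ , split with any? (λ y → A? y ×-dec ¬? (near? G (_∈? stage i) w y))
    ...     | yes (y , a′ , far) = y , w , a′ , subst A (last x∉ a) a , i , w∉ , far
      where
      last : ∀ {x} → x ∉ stage i → A x → x ≡ w
      last {x} x∉ a with split (decidable-stable (x ∈? stage (suc i)) λ x∉′ → none (x , a , x∉′))
      ... | inj₁ x∈ = ⊥-elim (x∉ x∈)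
      ... | inj₂ eq = eq
    ...     | no near = ⊥-elim (<⇒≱ k+1<A (≤-trans (card-⊎ (boundary? G (_∈? stage i) w) (_≟ w) A? cov)
                          (+-mono-≤ (boundary i w∉) (≤-reflexive (card-singleton w)))))
      where
      cov : ∀ y → A y → Boundary G (_∈ stage i) w y ⊎ y ≡ w
      cov y a = Sum.map₁ (λ y∈ → y∈ , decidable-stable (near? G (_∈? stage i) w y) (λ far → near (y , a , far)))
        (split (decidable-stable (y ∈? stage (suc i)) λ y∉ → none (y , a , y∉)))

-- In the filling of H, take the component of the unfilled part containing a pair
-- that is separated in G.  Off its boundary, and off the next vertex to be filled,
-- G separates another pair; by separated-cross that pair lies in the same
-- component, so it is still unfilled one stage later.
nordhaus : ∀ {n k l} {G H : Graph n} → Complementary G H → Filling G k → Filling H l → n ≤ k + l + 2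
nordhaus {n} {k} {l} {G} {H} GH FG FH = ≮⇒≥ λ big →
  let a , b , a∉ , b∉ , sep = large⇒separated FG (unfilled? FH 0) (start big)
  in go big _ 0 ≤-refl a∉ b∉ sep
  where
  open Complementary GH
  open Filling FH
  _~_ = Graph._~_ G
  start : k + l + 2 < n → k + 1 < card (unfilled? FH 0)
  start big = +-cancelˡ-≤ l _ _ (begin
    l + suc (k + 1)                    ≡⟨ arith k l ⟩
    k + l + 2                          ≤⟨ <⇒≤ big ⟩
    n                                  ≡⟨ card-compl (_∈? stage 0) ⟨
    card (_∈? stage 0) + card (unfilled? FH 0) ≡⟨ cong (_+ card (unfilled? FH 0)) size ⟩
    l + card (unfilled? FH 0)          ∎)
    where
    open ≤-Reasoning
    arith : ∀ k l → l + suc (k + 1) ≡ k + l + 2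
    arith = solve-∀

  go : k + l + 2 < n → ∀ fuel j → card (unfilled? FH j) ≤ fuel →
       ∀ {a b} → a ∉ stage j → b ∉ stage j → Separated FG a b → ⊥
  go big zero j le {a} a∉ b∉ sep = case ≤-trans (card-pos (unfilled? FH j) a a∉) le of λ ()
  go big (suc fuel) j le {a} {b} a∉ b∉ sep with adds j a∉
  ... | w , w∉ , w∈ , split with large⇒separated FG (¬? ∘ P?) largeA
    where
    P? : Decidable (λ x → Boundary H (_∈ stage j) a x ⊎ x ≡ w)
    P? x = boundary? H (_∈? stage j) a x ⊎-dec (x ≟ w)
    smallP : card P? ≤ l + 1
    smallP = ≤-trans (card-⊎ (boundary? H (_∈? stage j) a) (_≟ w) P? (λ _ → id))
               (+-mono-≤ (boundary j a∉) (≤-reflexive (card-singleton w)))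
    largeA : k + 1 < card (¬? ∘ P?)
    largeA = +-cancelˡ-≤ (l + 1) _ _ (begin
      l + 1 + suc (k + 1)           ≡⟨ arith k l ⟩
      suc (k + l + 2)               ≤⟨ big ⟩
      n                             ≡⟨ card-compl P? ⟨
      card P? + card (¬? ∘ P?)      ≤⟨ +-monoˡ-≤ _ smallP ⟩
      l + 1 + card (¬? ∘ P?)        ∎)
      where
      open ≤-Reasoning
      arith : ∀ k l → l + 1 + suc (k + 1) ≡ suc (k + l + 2)
      arith = solve-∀
  ... | c , d , Ac , Ad , sep′ = finish (reach? H (_∈? stage j) a c) (reach? H (_∈? stage j) a d)
    where
    R : Fin n → Set
    R = Reach H (_∈ stage j) a
    A : Fin n → Set
    A x = ¬ (Boundary H (_∈ stage j) a x ⊎ x ≡ w)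
    -- Off the component and off its boundary, `y` has no H-neighbour in the component, whether `y`
    -- is filled or not.
    outside-adj : ∀ {x y} → R x → ¬ R y → A y → x ~ y
    outside-adj {x} {y} Rx ¬Ry Ay = ¬H⇒G (λ { refl → ¬Ry Rx }) λ h → case y ∈? stage j of λ
      { (yes y∈) → Ay (inj₁ (y∈ , x , Rx , inj₂ h))
      ; (no y∉)  → ¬Ry (reach-edge H a∉ Rx h y∉) }
    still : ∀ {x} → R x → A x → x ∉ stage (suc j)
    still Rx Ax x∈ with split x∈
    ... | inj₁ x∈′ = reach-unfilled H a∉ Rx x∈′
    ... | inj₂ eq  = Ax (inj₂ eq)
    Rb : R b
    Rb = reach-edge H a∉ ε (¬G⇒H (separated⇒≢ FG sep) (separated⇒≁ FG sep)) b∉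
    finish : Dec (R c) → Dec (R d) → ⊥
    finish (yes Rc) (yes Rd) =
      go big fuel (suc j) (≤-pred (≤-trans (shrinks FH j a∉) le)) (still Rc Ac) (still Rd Ad) sep′
    finish (yes Rc) (no ¬Rd) = separated⇒≁ FG sep′ (outside-adj Rc ¬Rd Ad)
    finish (no ¬Rc) (yes Rd) = separated⇒≁ FG sep′ (Graph.sym G (outside-adj Rd ¬Rc Ac))
    finish (no ¬Rc) (no ¬Rd) = separated-cross FG sep sep′
      (outside-adj ε ¬Rc Ac) (outside-adj ε ¬Rd Ad) (outside-adj Rb ¬Rc Ac) (outside-adj Rb ¬Rd Ad)

-- Two forcing sets that both need a single step

OneStep : ∀ {n} → Graph n → Pred (Fin n) 0ℓ → Set
OneStep G B = ∀ w → ¬ B w → ∃[ v ] Forcing G B v w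

-- `I` stands for the vertices outside both sets and `D` for those in both. They are kept abstract
-- so that the lemmas can be applied with G and H exchanged while the counts stay the same.
module _ {n} {G H : Graph n} (GH : Complementary G H)
         {B C : Pred (Fin n) 0ℓ} (B? : Decidable B) (C? : Decidable C)
         (stepG : OneStep G B) (stepH : OneStep H C)
         {I D : Pred (Fin n) 0ℓ} (I? : Decidable I) (D? : Decidable D)
         (I⇒¬B : ∀ {x} → I x → ¬ B x) (I⇒¬C : ∀ {x} → I x → ¬ C x) (BC⇒D : ∀ {x} → B x → C x → D x) where
  open Complementary GH
  private
    _~G_ = Graph._~_ G
    _~H_ = Graph._~_ H

    distinct : ∀ {S : Pred (Fin n) 0ℓ} {u v} → S u → ¬ S v → u ≢ v
    distinct Su ¬Sv refl = ¬Sv Su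

  -- A vertex forcing z in H is G-adjacent to the rest of the component of z, in
  -- particular to x and y; were it outside B, it would link them.
  disconnected-intersection : (∀ {a b} → I a → I b → Reach H C a b) →
    ∀ {x y} → I x → I y → ¬ Reach G B x y → card I? ≤ card D? + 1
  disconnected-intersection same {x} {y} Ix Iy apart =
    case B? ψy of λ { (yes Bψy) → conclude ψy (BC⇒D Bψy (proj₁ (ψ-forces ¬Cy))) (λ Iz z≢y _ eq → z≢y (ψ-inj Iz Iy eq))
                    ; (no ¬Bψy) → second ¬Bψy }
    where
    ¬Cx = I⇒¬C Ix
    ¬Cy = I⇒¬C Iy
    x≢y : x ≢ y
    x≢y refl = apart ε
    ψ : ∀ {z} → ¬ C z → Fin n
    ψ ¬Cz = proj₁ (stepH _ ¬Cz)
    ψ-forces : ∀ {z} (¬Cz : ¬ C z) → Forcing H C (ψ ¬Cz) z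
    ψ-forces ¬Cz = proj₂ (stepH _ ¬Cz)
    ψ-adj : ∀ {z u} (¬Cz : ¬ C z) → ¬ C u → Reach H C z u → u ≢ z → ψ ¬Cz ~G u
    ψ-adj ¬Cz ¬Cu r u≢z with ψ-forces ¬Cz
    ... | Cv , _ , _ , uniq = ¬H⇒G (distinct Cv ¬Cu) λ h → u≢z (uniq _ ¬Cu h r)
    ψy = ψ ¬Cy
    ψ-inj : ∀ {z z′} (Iz : I z) (Iz′ : I z′) → ψ (I⇒¬C Iz) ≡ ψ (I⇒¬C Iz′) → z ≡ z′
    ψ-inj Iz Iz′ eq with ψ-forces (I⇒¬C Iz) | ψ-forces (I⇒¬C Iz′)
    ... | _ , _ , _ , uniq | _ , _ , e , _ =
      sym (uniq _ (I⇒¬C Iz′) (subst (_~H _) (sym eq) e) (same Iz Iz′))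
    ψ∈D : ∀ {z} (¬Cz : ¬ C z) → Reach H C x z → z ≢ x → z ≢ y → D (ψ ¬Cz)
    ψ∈D ¬Cz r z≢x z≢y = BC⇒D (decidable-stable (B? _) λ ¬Bv → apart
        ((I⇒¬B Ix , ¬Bv , Graph.sym G (ψ-adj ¬Cz ¬Cx (reach-sym H r) (z≢x ∘ sym))) ◅
         (¬Bv , I⇒¬B Iy , ψ-adj ¬Cz ¬Cy (reach-sym H r ◅◅ same Ix Iy) (z≢y ∘ sym)) ◅ ε))
      (proj₁ (ψ-forces ¬Cz))

    -- `ψ` maps `I` without `x` and `y` into `D`, which by itself leaves an excess of two; a further
    -- element `d` of `D`, missed by `ψ`, is assigned to `x`.
    conclude : ∀ d → D d → (∀ {z} (Iz : I z) → z ≢ y → z ≢ x → ψ (I⇒¬C Iz) ≢ d) → card I? ≤ card D? + 1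
    conclude d Dd fresh = ≤-trans (card-remove I? y) (≤-trans (+-monoʳ-≤ 1 (card-inj _ D? f f∈D f-inj))
                                    (≤-reflexive (+-comm 1 _)))
      where
      f : ∀ z → I z × z ≢ y → Fin n
      f z (Iz , _) with z ≟ x
      ... | yes _ = d
      ... | no  _ = ψ (I⇒¬C Iz)
      f∈D : ∀ z p → D (f z p)
      f∈D z (Iz , z≢y) with z ≟ x
      ... | yes _  = Dd
      ... | no z≢x = ψ∈D (I⇒¬C Iz) (same Ix Iz) z≢x z≢y
      f-inj : ∀ {z z′} p q → f z p ≡ f z′ q → z ≡ z′
      f-inj {z} {z′} (Iz , z≢y) (Iz′ , z′≢y) eq with z ≟ x | z′ ≟ x
      ... | yes refl | yes refl = refl
      ... | yes _    | no z′≢x  = ⊥-elim (fresh Iz′ z′≢y z′≢x (sym eq))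
      ... | no z≢x   | yes _    = ⊥-elim (fresh Iz z≢y z≢x eq)
      ... | no _     | no _     = ψ-inj Iz Iz′ eq

    -- Let `p` force `ψy` in G. Since `ψy` and `x` are joined off `B`, `p` cannot be G-adjacent to
    -- `x`, whereas every `ψ z` with `z ≢ x` is. If `p` is in `C`, then `p` is the extra element.
    -- Otherwise `p` is H-linked to `x` off `C`, and its own H-forcer lies in `D`, distinct from the
    -- forcers of vertices of `I`.
    second : ¬ B ψy → card I? ≤ card D? + 1
    second ¬Bψy with stepG ψy ¬Bψy
    ... | p , Bp , _ , p~ψy , uniq = case C? p of λ
      { (yes Cp) → conclude p (BC⇒D Bp Cp) λ { Iz z≢y z≢x refl →
          excl (ψ-adj (I⇒¬C Iz) ¬Cx (same Iz Ix) (z≢x ∘ sym)) p~Hx }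
      ; (no ¬Cp) → conclude (ψ ¬Cp)
          (ψ∈D ¬Cp (Rp ¬Cp) (distinct Bp (I⇒¬B Ix)) (distinct Bp (I⇒¬B Iy)))
          λ {z} Iz z≢y z≢x eq → I⇒¬B Iz (subst B (same-forcer Iz ¬Cp eq) Bp) }
      where
      ψy~x : ψy ~G x
      ψy~x = ψ-adj ¬Cy ¬Cx (same Iy Ix) x≢y
      p~Hx : p ~H x
      p~Hx = ¬G⇒H (distinct Bp (I⇒¬B Ix)) λ p~x → distinct {S = C} (proj₁ (ψ-forces ¬Cy)) ¬Cx
        (sym (uniq x (I⇒¬B Ix) p~x ((¬Bψy , I⇒¬B Ix , ψy~x) ◅ ε)))
      Rp : ¬ C p → Reach H C x p
      Rp ¬Cp = (¬Cx , ¬Cp , Graph.sym H p~Hx) ◅ ε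
      same-forcer : ∀ {z} (Iz : I z) (¬Cp : ¬ C p) → ψ (I⇒¬C Iz) ≡ ψ ¬Cp → p ≡ z
      same-forcer Iz ¬Cp eq with ψ-forces (I⇒¬C Iz) | ψ-forces ¬Cp
      ... | _ , _ , _ , uniq′ | _ , _ , e , _ = uniq′ p ¬Cp (subst (_~H p) (sym eq) e) (same Iz Ix ◅◅ Rp ¬Cp)

  component? : ∀ (G : Graph n) {S} → Decidable S → ∀ i → Decidable (λ x → ¬ S x × Reach G S i x)
  component? G S? i x = ¬? (S? x) ×-dec reach? G S? i x

  -- The forcer in G of a vertex of the G-component lies in D, or else is linked to
  -- I in H.
  connected-intersection : ∀ {i j} → I i → I j → i ≢ j →
    (∀ {a b} → I a → I b → Reach G B a b) → (∀ {a b} → I a → I b → Reach H C a b) →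
    card (component? G B? i) + card I? ≤ card D? + card (component? H C? i)
  connected-intersection {i} {j} Ii Ij i≢j sameG sameH = begin
    card P? + card I?            ≤⟨ +-monoˡ-≤ _ (≤-trans (card-inj P? DQ? (λ _ (¬B , _) → φ ¬B) φ∈ φ-inj)
                                                  (card-⊎ D? Q∖I? DQ? λ _ → id)) ⟩
    card D? + card Q∖I? + card I? ≡⟨ +-assoc (card D?) _ _ ⟩
    card D? + (card Q∖I? + card I?) ≤⟨ +-monoʳ-≤ (card D?) (card-disjoint Q∖I? I? Q?
                                        (λ _ → proj₁) (λ _ Ix → I⇒¬C Ix , sameH Ii Ix) (λ _ (_ , ¬Ix) Ix → ¬Ix Ix)) ⟩
    card D? + card Q?            ∎
    where
    open ≤-Reasoning
    P? = component? G B? i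
    Q? = component? H C? i
    Q∖I? : Decidable (λ x → (¬ C x × Reach H C i x) × ¬ I x)
    Q∖I? x = Q? x ×-dec ¬? (I? x)
    DQ? : Decidable (λ x → D x ⊎ ((¬ C x × Reach H C i x) × ¬ I x))
    DQ? x = D? x ⊎-dec Q∖I? x
    φ : ∀ {z} → ¬ B z → Fin n
    φ ¬Bz = proj₁ (stepG _ ¬Bz)
    φ-inj : ∀ {x y} (p : ¬ B x × Reach G B i x) (q : ¬ B y × Reach G B i y) → φ (proj₁ p) ≡ φ (proj₁ q) → x ≡ y
    φ-inj {x} {y} (¬Bx , r) (¬By , s) eq with stepG x ¬Bx | stepG y ¬By
    ... | _ , _ , _ , _ , uniq | _ , _ , _ , e , _ =
      sym (uniq y ¬By (subst (λ v → Graph._~_ G v y) (sym eq) e) (reach-sym G r ◅◅ s))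
    other : ∀ x → ∃[ u ] (I u × u ≢ x)
    other x with i ≟ x
    ... | no i≢x   = i , Ii , i≢x
    ... | yes refl = j , Ij , i≢j ∘ sym
    φ∈ : ∀ x (p : ¬ B x × Reach G B i x) → D (φ (proj₁ p)) ⊎ ((¬ C (φ (proj₁ p)) × Reach H C i (φ (proj₁ p))) × ¬ I (φ (proj₁ p)))
    φ∈ x (¬Bx , r) with stepG x ¬Bx
    ... | v , Bv , _ , _ , uniq with C? v
    ...   | yes Cv = inj₁ (BC⇒D Bv Cv)
    ...   | no ¬Cv with other x
    ...     | u , Iu , u≢x = inj₂ ((¬Cv , sameH Ii Iu ◅◅ ((I⇒¬C Iu , ¬Cv , Graph.sym H v~u) ◅ ε)) , λ Iv → I⇒¬B Iv Bv)
      where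
      v~u : v ~H u
      v~u = ¬G⇒H (distinct Bv (I⇒¬B Iu)) λ g → u≢x (uniq u (I⇒¬B Iu) g (reach-sym G r ◅◅ sameG Ii Iu))

module _ {n} {G H : Graph n} (GH : Complementary G H)
         {B C : Pred (Fin n) 0ℓ} (B? : Decidable B) (C? : Decidable C)
         (stepG : OneStep G B) (stepH : OneStep H C) where
  open Complementary GH
  private
    HG = Complementary-sym GH

    I? : Decidable (λ x → ¬ B x × ¬ C x)
    I? x = ¬? (B? x) ×-dec ¬? (C? x)

    D? : Decidable (λ x → B x × C x)
    D? x = B? x ×-dec C? x

    apart? : ∀ (G : Graph n) {S} (S? : Decidable S) →
             Dec (∃₂ λ x y → (¬ B x × ¬ C x) × (¬ B y × ¬ C y) × ¬ Reach G S x y)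
    apart? G S? = any? λ x → any? λ y → I? x ×-dec I? y ×-dec ¬? (reach? G S? x y)

  -- If G splits the common outside of `B` and `C`, then H joins all of it, by the argument that a
  -- graph or its complement is connected. So either exactly one of the two graphs splits it, or
  -- both join it. In the latter case at least two vertices are needed for comparing the components;
  -- fewer are absorbed by the summand 1.
  intersection-bound : card I? ≤ card D? + 1
  intersection-bound with apart? G B? | apart? H C?
  ... | yes (x , y , Ix , Iy , apart) | _ =
    disconnected-intersection GH B? C? stepG stepH I? D? proj₁ proj₂ _,_ same Ix Iy apart
    where
    same : ∀ {a b} → ¬ B a × ¬ C a → ¬ B b × ¬ C b → Reach H C a b
    link : ∀ {a b} → ¬ B a × ¬ C a → ¬ B b × ¬ C b → ¬ Reach G B a b → Reach H C a b
    link (¬Ba , ¬Ca) (¬Bb , ¬Cb) ¬r =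
      (¬Ca , ¬Cb , ¬G⇒H (λ { refl → ¬r ε }) (λ g → ¬r ((¬Ba , ¬Bb , g) ◅ ε))) ◅ ε
    same {a} {b} Ia Ib with reach? G B? a b | reach? G B? a x
    ... | no ¬r | _ = link Ia Ib ¬r
    ... | yes r | no ¬s = link Ia Ix ¬s ◅◅ link Ix Ib λ s → ¬s (r ◅◅ reach-sym G s)
    ... | yes r | yes s = link Ia Iy (λ t → apart (reach-sym G s ◅◅ t)) ◅◅
                          link Iy Ib (λ t → apart (reach-sym G (t ◅◅ reach-sym G r ◅◅ s)))
  ... | no noG | yes (x , y , Ix , Iy , apart) =
    disconnected-intersection HG C? B? stepH stepG I? D? proj₂ proj₁ (flip _,_)
      (λ {a} {b} Ia Ib → decidable-stable (reach? G B? a b) λ ¬r → noG (a , b , Ia , Ib , ¬r)) Ix Iy apart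
  ... | no noG | no noH with any? (λ i → any? λ j → I? i ×-dec I? j ×-dec ¬? (i ≟ j))
  ...   | yes (i , j , Ii , Ij , i≢j) = ≤-trans (balance
            (connected-intersection GH B? C? stepG stepH I? D? proj₁ proj₂ _,_ Ii Ij i≢j sameG sameH)
            (connected-intersection HG C? B? stepH stepG I? D? proj₂ proj₁ (flip _,_) Ii Ij i≢j sameH sameG)) (m≤m+n _ 1)
    where
    sameG : ∀ {a b} → _ → _ → Reach G B a b
    sameG {a} {b} Ia Ib = decidable-stable (reach? G B? a b) λ ¬r → noG (a , b , Ia , Ib , ¬r)
    sameH : ∀ {a b} → _ → _ → Reach H C a b
    sameH {a} {b} Ia Ib = decidable-stable (reach? H C? a b) λ ¬r → noH (a , b , Ia , Ib , ¬r)
    -- The two inequalities differ by the exchange of G and H; in their sum the sizes of the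
    -- components cancel.
    balance : ∀ {p q i d} → p + i ≤ d + q → q + i ≤ d + p → i ≤ d
    balance {p} {q} {i} {d} le₁ le₂ = ≮⇒≥ λ d<i → <⇒≱ (+-mono-< d<i d<i) (+-cancelˡ-≤ (p + q) _ _
      (≤-trans (≤-reflexive (e₁ p q i)) (≤-trans (+-mono-≤ le₁ le₂) (≤-reflexive (e₂ p q d)))))
      where
      e₁ : ∀ p q i → p + q + (i + i) ≡ (p + i) + (q + i)
      e₁ = solve-∀
      e₂ : ∀ p q d → (d + q) + (d + p) ≡ p + q + (d + d)
      e₂ = solve-∀
  ...   | no single with any? I?
  ...     | no none = ≤-trans (≤-reflexive (card-none I? λ x Ix → none (x , Ix))) z≤n
  ...     | yes (i , Ii) = ≤-trans (card-mono I? (_≟ i) λ x Ix → decidable-stable (x ≟ i) λ x≢i → single (x , i , Ix , Ii , x≢i))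
                             (≤-trans (≤-reflexive (card-singleton i)) (m≤n+m 1 _))

  -- Inclusion and exclusion: the vertices counted twice make up, except for one, for those counted
  -- by neither set.
  one-step-bound : n ≤ card B? + card C? + 1
  one-step-bound = begin
    n                                     ≡⟨ card-all (λ _ → yes tt) (λ _ → tt) ⟨
    card {n} {λ _ → ⊤} (λ _ → yes tt)     ≤⟨ card-⊎ B? ¬B? (λ _ → yes tt) (λ x _ → split₁ x) ⟩
    card B? + card ¬B?                    ≤⟨ +-monoʳ-≤ (card B?) (card-⊎ C∖B? I? ¬B? split₂) ⟩
    card B? + (card C∖B? + card I?)       ≤⟨ +-monoʳ-≤ (card B?) (+-monoʳ-≤ (card C∖B?) intersection-bound) ⟩
    card B? + (card C∖B? + (card D? + 1)) ≡⟨ cong (card B? +_) (sym (+-assoc (card C∖B?) _ 1)) ⟩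
    card B? + (card C∖B? + card D? + 1)   ≤⟨ +-monoʳ-≤ (card B?) (+-monoˡ-≤ 1 (card-disjoint C∖B? D? C?
                                               (λ _ → proj₁) (λ _ → proj₂) (λ _ (_ , ¬b) (b , _) → ¬b b))) ⟩
    card B? + (card C? + 1)               ≡⟨ +-assoc (card B?) _ 1 ⟨
    card B? + card C? + 1                 ∎
    where
    open ≤-Reasoning
    ¬B? = ¬? ∘ B?
    C∖B? : Decidable (λ x → C x × ¬ B x)
    C∖B? x = C? x ×-dec ¬? (B? x)
    split₁ : ∀ x → B x ⊎ ¬ B x
    split₁ x with B? x
    ... | yes b = inj₁ b
    ... | no ¬b = inj₂ ¬b
    split₂ : ∀ x → ¬ B x → (C x × ¬ B x) ⊎ (¬ B x × ¬ C x)
    split₂ x ¬b with C? x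
    ... | yes c = inj₁ (c , ¬b)
    ... | no ¬c = inj₂ (¬b , ¬c)

one-step-nordhaus : ∀ {n k l} {G H : Graph n} → Complementary G H → Achieves G k 1 → Achieves H l 1 → n ≤ k + l + 1
one-step-nordhaus {G = G} {H} GH (B , ∣B∣≡k , allB) (C , ∣C∣≡l , allC) =
  ≤-trans (one-step-bound GH (_∈? B) (_∈? C) (step G allB) (step H allC))
    (≤-reflexive (cong₂ (λ k l → k + l + 1) (trans (card-∈ B) ∣B∣≡k) (trans (card-∈ C) ∣C∣≡l)))
  where
  step : ∀ G {B} → Universal (_^[_] G (_∈ B) 1) → OneStep G (_∈ B)
  step G all w w∉ with all w
  ... | inj₁ w∈      = ⊥-elim (w∉ w∈)
  ... | inj₂ (v , f) = v , forces⇒forcing G f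

-- Threshold numbers as attained minima

-- The rule refers to the filled set both positively and negatively, so both inclusions have to be
-- carried through the recursion.
fill-cong : ∀ {n} (G : Graph n) {S S′ : Pred (Fin n) 0ℓ} → (∀ x → S x → S′ x) → (∀ x → S′ x → S x) →
            ∀ t x → _^[_] G S t x → _^[_] G S′ t x
fill-cong G f g zero    x s        = f x s
fill-cong G f g (suc t) x (inj₁ s) = inj₁ (fill-cong G f g t x s)
fill-cong G f g (suc t) x (inj₂ (v , force)) with forces⇒forcing G force
... | Sv , ¬Sx , v~x , uniq = inj₂ (v , forcing⇒forces G
  (to v Sv , ¬Sx ∘ from x , v~x , λ u ¬Su v~u r → uniq u (¬Su ∘ to u) v~u (reach-mono G to r)))
  where
  to   = fill-cong G f g t
  from = fill-cong G g f t

achieves : ∀ {n} (G : Graph n) {B} (B? : Decidable B) t → (∀ x → _^[_] G B t x) → Achieves G (card B?) t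
achieves G B? t all = toSubset B? , ∣toSubset∣ B? ,
  λ x → fill-cong G (∈-toSubset⁺ B?) (∈-toSubset⁻ B?) t x (all x)

achieves? : ∀ {n} (G : Graph n) k t → Dec (Achieves G k t)
achieves? G k t = anySubset? λ B → (∣ B ∣ ℕ.≟ k) ×-dec all? (filled? G (_∈? B) t)

-- The three parameters differ only in the cost `c` and in the range `R` of sizes. `t≤c` and `R⇒≤`
-- make the search for something cheaper finite. `c-strict` shows that an optimum has the least time
-- for its size, so minimising over `Achieves` directly agrees with minimising over propagation
-- times.
module Threshold (c : ℕ → ℕ → ℕ) (t≤c : ∀ k t → 1 ≤ k → t ≤ c k t)
                 (c-strict : ∀ k {t t′} → 1 ≤ k → t < t′ → c k t < c k t′)
                 (R : ℕ → ℕ → Set) (R? : ∀ n k → Dec (R n k)) (R⇒≤ : ∀ {n k} → R n k → k ≤ n) where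

  th : Quantity
  th {n} G m = m IsMinimumOf λ s → ∃₂ λ k t → 1 ≤ k × R n k × pt₊ k G t × s ≡ c k t

  record Optimum {n} (G : Graph n) : Set where
    field
      {size time} : ℕ
      1≤size      : 1 ≤ size
      inRange     : R n size
      achieved    : Achieves G size time
      least       : ∀ k t → 1 ≤ k → R n k → Achieves G k t → c size time ≤ c k t

    value : ℕ
    value = c size time

    isTh : th G value
    isTh = (size , time , 1≤size , inRange , isPt , refl) ,
           λ { _ (k , t , 1≤k , r , pt , refl) → least k t 1≤k r (pt⇒achieves pt) }
      where
      pt⇒achieves : ∀ {k t} → pt₊ k G t → Achieves G k t
      pt⇒achieves ((B , ∣B∣ , (all , _)) , _) = B , ∣B∣ , all
      fastest : ∀ s → Achieves G size s → time ≤ s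
      fastest s a = ≮⇒≥ λ s<t → <⇒≱ (c-strict size 1≤size s<t) (least size s 1≤size inRange a)
      isPt : pt₊ size G time
      isPt = (let B , ∣B∣ , all = achieved in B , ∣B∣ , all , λ s all′ → fastest s (B , ∣B∣ , all′)) ,
             λ { s (B , ∣B∣ , (all , _)) → fastest s (B , ∣B∣ , all) }

  module _ {n} (G : Graph n) where

    Cheaper : ℕ → Set
    Cheaper m = ∃₂ λ k t → 1 ≤ k × R n k × Achieves G k t × c k t < m

    cheaper? : ∀ m → Dec (Cheaper m)
    cheaper? m = map′
      (λ (k , t , p) → toℕ k , toℕ t , p)
      (λ (k , t , 1≤k , r , a , lt) →
        fromℕ< (s≤s (R⇒≤ r)) , fromℕ< (≤-<-trans (t≤c k t 1≤k) lt) ,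
        subst₂ (λ k t → 1 ≤ k × R n k × Achieves G k t × c k t < m)
          (sym (toℕ-fromℕ< (s≤s (R⇒≤ r)))) (sym (toℕ-fromℕ< (≤-<-trans (t≤c k t 1≤k) lt)))
          (1≤k , r , a , lt))
      (any? {suc n} λ k → any? {m} λ t → (1 ≤? toℕ k) ×-dec R? n (toℕ k) ×-dec
        achieves? G (toℕ k) (toℕ t) ×-dec (c (toℕ k) (toℕ t) <? m))

    optimum : ∀ {k t} → 1 ≤ k → R n k → Achieves G k t → Optimum G
    optimum {k} {t} 1≤k r a = search (c k t) k t 1≤k r a ≤-refl
      where
      search : ∀ fuel k t → 1 ≤ k → R n k → Achieves G k t → c k t ≤ fuel → Optimum G
      search fuel k t 1≤k r a le with cheaper? (c k t)
      search zero k t 1≤k r a le | yes (_ , _ , _ , _ , _ , lt) = case <-≤-trans lt le of λ ()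
      search (suc fuel) k t 1≤k r a le | yes (k′ , t′ , 1≤k′ , r′ , a′ , lt) =
        search fuel k′ t′ 1≤k′ r′ a′ (≤-pred (<-≤-trans lt le))
      ... | no none = record { 1≤size = 1≤k ; inRange = r ; achieved = a
        ; least = λ k′ t′ 1≤k′ r′ a′ → ≮⇒≥ λ lt → none (k′ , t′ , 1≤k′ , r′ , a′ , lt) }

t≤k*t : ∀ k t → 1 ≤ k → t ≤ k * t
t≤k*t (suc k) t _ = m≤m+n t (k * t)

k*-strict : ∀ k {t t′} → 1 ≤ k → t < t′ → k * t < k * t′
k*-strict (suc k) _ = *-monoʳ-< (suc k)

t≤k*[1+t] : ∀ k t → 1 ≤ k → t ≤ k * (1 + t)
t≤k*[1+t] k t 1≤k = ≤-trans (n≤1+n t) (t≤k*t k (1 + t) 1≤k)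

k*[1+]-strict : ∀ k {t t′} → 1 ≤ k → t < t′ → k * (1 + t) < k * (1 + t′)
k*[1+]-strict k 1≤k = k*-strict k 1≤k ∘ s≤s

t≤k+t : ∀ k t → 1 ≤ k → t ≤ k + t
t≤k+t k t _ = m≤n+m t k

k+-strict : ∀ k {t t′} → 1 ≤ k → t < t′ → k + t < k + t′
k+-strict k _ = +-monoʳ-< k

module Th₊ = Threshold _+_ t≤k+t k+-strict (λ n k → k ≤ n) (λ n k → k ≤? n) id
module Th* = Threshold _*_ t≤k*t k*-strict (λ n k → k < n) (λ n k → k <? n) <⇒≤
module Th× = Threshold (λ k t → k * (1 + t)) t≤k*[1+t] k*[1+]-strict (λ n k → k ≤ n) (λ n k → k ≤? n) id

-- Cheap forcing sets, and the exclusion of one vertex in one step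

record Setting {n} (G H : Graph n) : Set where
  field
    4≤n    : 4 ≤ n
    compl  : Complementary G H
    connG  : Connected G
    connH  : Connected H
  open Complementary compl public

Setting-sym : ∀ {n} {G H : Graph n} → Setting G H → Setting H G
Setting-sym st = record { 4≤n = 4≤n ; compl = Complementary-sym compl ; connG = connH ; connH = connG }
  where open Setting st

setting : ∀ {n} (G : Graph n) → 4 ≤ n → BothConnected G → Setting G (complement G)
setting G 4≤n (c , c̄) = record { 4≤n = 4≤n ; compl = complementary G ; connG = c ; connH = c̄ }

another : ∀ {n} → 2 ≤ n → (u : Fin n) → ∃[ v ] v ≢ u
another (s≤s (s≤s _)) zero    = suc zero , λ ()
another (s≤s (s≤s _)) (suc u) = zero , λ ()

neighbour : ∀ {n} (G : Graph n) → 2 ≤ n → Connected G → ∀ u → ∃[ v ] Graph._~_ G u v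
neighbour G 2≤n conn u with another 2≤n u
... | v , v≢u with conn u v
...   | ε       = ⊥-elim (v≢u refl)
...   | _◅_ e _ = _ , e

achieves-all : ∀ {n} (G : Graph n) → Achieves G n 0
achieves-all {n} G = subst (λ k → Achieves G k 0) (card-all (λ _ → yes tt) (λ _ → tt)) (achieves G {λ _ → ⊤} (λ _ → yes tt) 0 (λ _ → tt))

-- Unfilled vertices that are pairwise nonadjacent are components by themselves, so each is forced
-- by any neighbour; connectedness supplies one, and it is filled.
achieves-independent : ∀ {n} (G : Graph n) → 2 ≤ n → Connected G → ∀ {P} (P? : Decidable P) →
  (∀ {u v} → P u → P v → ¬ Graph._~_ G u v) → Achieves G (n ∸ card P?) 1
achieves-independent {n} G 2≤n conn {P} P? indep =
  subst (λ k → Achieves G k 1)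
    (trans (sym (m+n∸m≡n (card P?) _)) (cong (_∸ card P?) (card-compl P?)))
    (achieves G (¬? ∘ P?) 1 fill)
  where
  fill : ∀ x → _^[_] G (λ y → ¬ P y) 1 x
  fill x with P? x
  ... | no ¬p = inj₁ ¬p
  ... | yes p with neighbour G 2≤n conn x
  ...   | v , x~v = inj₂ (v , forcing⇒forces G ((λ Pv → indep p Pv x~v) , (λ ¬p → ¬p p) , Graph.sym G x~v , only))
    where
    only : ∀ u → ¬ ¬ P u → Graph._~_ G v u → Reach G (λ y → ¬ P y) x u → u ≡ x
    only u _ _ ε = refl
    only u _ _ ((_ , ¬¬y , e) ◅ _) = ⊥-elim (indep p (decidable-stable (P? _) ¬¬y) e)

card-pair : ∀ {n} {x y : Fin n} → x ≢ y → card (λ z → (z ≟ x) ⊎-dec (z ≟ y)) ≡ 2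
card-pair {x = x} {y} x≢y = ≤-antisym
  (≤-trans (card-⊎ (_≟ x) (_≟ y) (λ z → (z ≟ x) ⊎-dec (z ≟ y)) (λ _ → id)) (≤-reflexive (cong₂ _+_ (card-singleton x) (card-singleton y))))
  (≤-trans (≤-reflexive (sym (cong₂ _+_ (card-singleton x) (card-singleton y))))
    (card-disjoint (_≟ x) (_≟ y) (λ z → (z ≟ x) ⊎-dec (z ≟ y)) (λ _ → inj₁) (λ _ → inj₂) (λ { _ refl → x≢y })))

∣S∣≡1⇒unique : ∀ {n} {S : Subset n} → ∣ S ∣ ≡ 1 → ∀ {x y} → x ∈ S → y ∈ S → x ≡ y
∣S∣≡1⇒unique {S = S} ∣S∣ {x} {y} x∈ y∈ = decidable-stable (x ≟ y) λ x≢y → <-irrefl refl (begin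
  2                                      ≡⟨ card-pair x≢y ⟨
  card (λ z → (z ≟ x) ⊎-dec (z ≟ y))     ≤⟨ card-mono _ (_∈? S) (λ { _ (inj₁ refl) → x∈ ; _ (inj₂ refl) → y∈ }) ⟩
  card (_∈? S)                           ≡⟨ trans (card-∈ S) ∣S∣ ⟩
  1                                      ∎)
  where open ≤-Reasoning

achieves-0⇒all : ∀ {n k} {G : Graph n} → Achieves G k 0 → k ≡ n
achieves-0⇒all {G = G} (B , ∣B∣ , all) = trans (sym ∣B∣) (trans (sym (card-∈ B)) (card-all (_∈? B) all))

module _ {n} {G H : Graph n} (st : Setting G H) where
  open Setting st

  2≤n : 2 ≤ n
  2≤n = ≤-trans (s≤s (s≤s z≤n)) 4≤n

  achieves-n∸2 : Achieves G (n ∸ 2) 1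
  achieves-n∸2 with neighbour H 2≤n connH (fromℕ< 4≤n)
  ... | v , u~v = subst (λ k → Achieves G (n ∸ k) 1) (card-pair (λ eq → Graph.irrefl H eq u~v))
    (achieves-independent G 2≤n connG (λ z → (z ≟ fromℕ< 4≤n) ⊎-dec (z ≟ v)) λ
      { (inj₁ refl) (inj₁ refl) → Graph.irrefl G refl
      ; (inj₁ refl) (inj₂ refl) → λ e → excl e u~v
      ; (inj₂ refl) (inj₁ refl) → λ e → excl (Graph.sym G e) u~v
      ; (inj₂ refl) (inj₂ refl) → Graph.irrefl G refl })

  -- The single vertex would have to be adjacent to all others, but it has a neighbour in the
  -- connected complement.
  ¬achieves-1-1 : ¬ Achieves G 1 1
  ¬achieves-1-1 (B , ∣B∣ , all) with any? (_∈? B)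
  ... | no none = case trans (sym ∣B∣) (trans (sym (card-∈ B)) (card-none (_∈? B) λ x x∈ → none (x , x∈))) of λ ()
  ... | yes (v , v∈) with neighbour H 2≤n connH v
  ...   | w , v~w with all w
  ...     | inj₁ w∈ = Graph.irrefl H (∣S∣≡1⇒unique ∣B∣ v∈ w∈) v~w
  ...     | inj₂ (v′ , force) with forces⇒forcing G force
  ...       | v′∈ , _ , v′~w , _ = excl v′~w (subst (λ v → Graph._~_ H v w) (∣S∣≡1⇒unique ∣B∣ v∈ v′∈) v~w)

-- Arithmetic of the lower bounds

-- The possible pairs of size and time: time 0 needs all vertices, time 1 at least two. Sizes and
-- times are written with successors, so that each inequality becomes a polynomial identity in the
-- free parameters.
data Shape (n : ℕ) : ℕ → ℕ → Set where
  full : Shape n n 0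
  once : ∀ x → Shape n (suc (suc x)) 1
  slow : ∀ x i → Shape n (suc x) (suc (suc i))

shape : ∀ {n k t} {G H : Graph n} → Setting G H → 1 ≤ k → Achieves G k t → Shape n k t
shape {t = zero} {G} st _ a with achieves-0⇒all {G = G} a
... | refl = full
shape {k = 1} {1} st _ a = ⊥-elim (¬achieves-1-1 st a)
shape {k = suc (suc x)} {1} st _ a = once x
shape {k = suc x} {suc (suc i)} st _ a = slow x i

record Pair (n k t l s : ℕ) : Set where
  field
    4≤n      : 4 ≤ n
    shapeG   : Shape n k t
    shapeH   : Shape n l s
    bound    : n ≤ k + l + 2
    bound₁   : t ≡ 1 → s ≡ 1 → n ≤ k + l + 1

pair : ∀ {n k t l s} {G H : Graph n} → Setting G H → 1 ≤ k → 1 ≤ l → Achieves G k t → Achieves H l s → Pair n k t l s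
pair {t = t} {s = s} {G = G} {H} st 1≤k 1≤l a b = record
  { 4≤n = 4≤n ; shapeG = shape st 1≤k a ; shapeH = shape (Setting-sym st) 1≤l b
  ; bound = nordhaus compl (filling G {t = t} a) (filling H {t = s} b)
  ; bound₁ = λ { refl refl → one-step-nordhaus compl a b } }
  where open Setting st

-- `e` is the explicit surplus of an inequality; with it only a ring identity remains.
slack : ∀ {a b c} e → a ≤ b → b + e ≡ c → a ≤ c
slack e a≤b refl = ≤-trans a≤b (m≤m+n _ e)

swap-sum : ∀ {m} a b → m ≤ a + b → m ≤ b + a
swap-sum a b h = ≤-trans h (≤-reflexive (+-comm a b))

swap-bound : ∀ {n} k l c → n ≤ k + l + c → n ≤ l + k + c
swap-bound k l c h = ≤-trans h (≤-reflexive (cong (_+ c) (+-comm k l)))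

module _ {n k t : ℕ} (4≤n : 4 ≤ n) where

  3≤k+t : Shape n k t → 3 ≤ k + t
  3≤k+t full       = ≤-trans (≤-trans (s≤s (s≤s (s≤s z≤n))) 4≤n) (m≤m+n n 0)
  3≤k+t (once x)   = s≤s (s≤s (m≤n+m 1 x))
  3≤k+t (slow x i) = s≤s (≤-trans (m≤m+n 2 i) (m≤n+m (2 + i) x))

  2≤k*t : k < n → Shape n k t → 2 ≤ k * t
  2≤k*t k<n full       = ⊥-elim (<-irrefl refl k<n)
  2≤k*t k<n (once x)   = s≤s (s≤s z≤n)
  2≤k*t k<n (slow x i) = s≤s (s≤s z≤n)

  3≤k*[1+t] : Shape n k t → 3 ≤ k * (1 + t)
  3≤k*[1+t] full       = ≤-trans (≤-trans (s≤s (s≤s (s≤s z≤n))) 4≤n) (≤-reflexive (sym (*-identityʳ n)))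
  3≤k*[1+t] (once x)   = s≤s (s≤s (s≤s z≤n))
  3≤k*[1+t] (slow x i) = s≤s (s≤s (s≤s z≤n))

pair-sym : ∀ {n k t l s} → Pair n k t l s → Pair n l s k t
pair-sym {k = k} {l = l} P = record
  { 4≤n = 4≤n ; shapeG = shapeH ; shapeH = shapeG ; bound = swap-bound k l 2 bound ; bound₁ = λ p q → swap-bound k l 1 (bound₁ q p) }
  where open Pair P

shape-elim : ∀ {n} (C : ℕ → ℕ → Set) → C n 0 → (∀ x → C (suc (suc x)) 1) → (∀ x i → C (suc x) (suc (suc i))) →
             ∀ {k t} → Shape n k t → C k t
shape-elim C f o s full       = f
shape-elim C f o s (once x)   = o x
shape-elim C f o s (slow x i) = s x i

≥-elim : ∀ m (C : ℕ → Set) → (∀ x → C (m + x)) → ∀ {a} → m ≤ a → C a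
≥-elim m C f {a} m≤a = subst C (m+[n∸m]≡n m≤a) (f (a ∸ m))

pair-elim : ∀ {n} (C : ℕ → ℕ → ℕ → ℕ → Set) → (∀ k t l s → C k t l s → C l s k t) →
            (∀ l s → 4 ≤ n → Shape n l s → C n 0 l s) →
            (∀ x y → n ≤ suc (suc x) + suc (suc y) + 1 → C (suc (suc x)) 1 (suc (suc y)) 1) →
            (∀ x y j → n ≤ suc (suc x) + suc y + 2 → C (suc (suc x)) 1 (suc y) (suc (suc j))) →
            (∀ x i y j → n ≤ suc x + suc y + 2 → C (suc x) (suc (suc i)) (suc y) (suc (suc j))) →
            ∀ {k t l s} → Pair n k t l s → C k t l s
pair-elim {n} C swap f oo os ss P =
  shape-elim (λ k t → ∀ {l s} → Pair n k t l s → C k t l s)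
    (λ {l} {s} P → f l s (Pair.4≤n P) (Pair.shapeH P))
    (λ x {l} {s} P → shape-elim (λ l s → Pair n (suc (suc x)) 1 l s → C (suc (suc x)) 1 l s)
      (λ P → swap _ _ _ _ (f _ _ (Pair.4≤n P) (Pair.shapeG P)))
      (λ y P → oo x y (Pair.bound₁ P refl refl))
      (λ y j P → os x y j (Pair.bound P)) (Pair.shapeH P) P)
    (λ x i {l} {s} P → shape-elim (λ l s → Pair n (suc x) (suc (suc i)) l s → C (suc x) (suc (suc i)) l s)
      (λ P → swap _ _ _ _ (f _ _ (Pair.4≤n P) (Pair.shapeG P)))
      (λ y P → swap _ _ _ _ (os y x i (Pair.bound (pair-sym P))))
      (λ y j P → ss x i y j (Pair.bound P)) (Pair.shapeH P) P)
    (Pair.shapeG P) P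

private
  identity1 : ∀ x y → suc (suc (suc x) + suc (suc y) + 1) + 0 ≡ (suc (suc x) + 1) + (suc (suc y) + 1)
  identity1 = solve-∀
  identity2 : ∀ x y j → suc (suc (suc x) + suc y + 2) + j ≡ (suc (suc x) + 1) + (suc y + suc (suc j))
  identity2 = solve-∀
  identity3 : ∀ x i y j → suc (suc x + suc y + 2) + (1 + i + j) ≡ (suc x + suc (suc i)) + (suc y + suc (suc j))
  identity3 = solve-∀
  identity4 : ∀ x y → suc (suc x) + suc (suc y) + 1 + 0 ≡ suc (suc x) * 1 + suc (suc y) * 1 + 1
  identity4 = solve-∀
  identity5 : ∀ x y j → suc (suc x) + suc y + 2 + (y + j + y * j) ≡ suc (suc x) * 1 + suc y * suc (suc j) + 1
  identity5 = solve-∀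
  identity6 : ∀ x i y j → suc x + suc y + 2 + (1 + x + i + x * i + y + j + y * j) ≡ suc x * suc (suc i) + suc y * suc (suc j) + 1
  identity6 = solve-∀
  identity7 : ∀ x y → suc (suc x) + suc (suc y) + 1 + (3 + x + y) ≡ suc (suc x) * (1 + 1) + suc (suc y) * (1 + 1)
  identity7 = solve-∀
  identity8 : ∀ x y j → suc (suc x) + suc y + 2 + (2 + x + 2 * y + j + y * j) ≡ suc (suc x) * (1 + 1) + suc y * (1 + suc (suc j))
  identity8 = solve-∀
  identity9 : ∀ x i y j → suc x + suc y + 2 + (2 + 2 * x + i + x * i + 2 * y + j + y * j) ≡ suc x * (1 + suc (suc i)) + suc y * (1 + suc (suc j))
  identity9 = solve-∀
  identity10 : ∀ x y → 3 * (suc (suc x) + suc (suc y) + 1) + (1 + 5 * x + 5 * y + 4 * (x * y)) ≡ suc (suc x) * (1 + 1) * (suc (suc y) * (1 + 1))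
  identity10 = solve-∀
  identity11 : ∀ x y → suc (suc x) + suc y + 2 + 0 ≡ 4 + (1 + x + y)
  identity11 = solve-∀
  identity12 : ∀ x y j → 6 + 6 * (1 + x + y) + (6 * y + 6 * (x * y) + (4 + 2 * x) * (1 + y) * j) ≡ suc (suc x) * (1 + 1) * (suc y * (1 + suc (suc j)))
  identity12 = solve-∀
  identity13 : ∀ x y → suc x + suc y + 2 + 0 ≡ 4 + (x + y)
  identity13 = solve-∀
  identity14 : ∀ x y → 6 + 6 * (x + y) + (3 + 3 * x + 3 * y + 9 * (x * y)) ≡ suc x * 3 * (suc y * 3)
  identity14 = solve-∀
  identity15 : ∀ z → 3 * (4 + z) ≡ 6 + 3 * z + 3 * 2
  identity15 = solve-∀
  identity16 : ∀ z → 6 + 3 * z + 3 * z ≡ 6 + 6 * z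
  identity16 = solve-∀
  identity17 : ∀ x y → 3 + x + (3 + y) ≡ suc (5 + x + y)
  identity17 = solve-∀
  identity18 : ∀ x y → 3 * (5 + x + y) + x * y ≡ (3 + x) * (3 + y) + 6
  identity18 = solve-∀
  identity19 : ∀ x y → 2 * (2 + x + (2 + y) + 1) + x * y ≡ (2 + x) * (2 + y) + 6
  identity19 = solve-∀
  identity20 : ∀ x y → 2 + x + (2 + y) + 1 + (x + y + x * y) ≡ (2 + x) * (2 + y) + 1
  identity20 = solve-∀

sum₊-bound : ∀ {n k t l s} → Pair n k t l s → suc n ≤ (k + t) + (l + s)
sum₊-bound {n} = pair-elim (λ k t l s → suc n ≤ (k + t) + (l + s))
  (λ k t l s → swap-sum (k + t) (l + s))
  (λ l s 4≤n h → ≤-trans (≤-reflexive (sym (trans (cong (_+ 1) (+-identityʳ n)) (+-comm n 1))))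
    (+-monoʳ-≤ (n + 0) (≤-trans (s≤s z≤n) (3≤k+t 4≤n h))))
  (λ x y h → slack 0 (s≤s h) (identity1 x y))
  (λ x y j h → slack j (s≤s h) (identity2 x y j))
  (λ x i y j h → slack (1 + i + j) (s≤s h) (identity3 x i y j))

sum*-bound : ∀ {n k t l s} → Pair n k t l s → k < n → l < n → n ≤ k * t + l * s + 1
sum*-bound {n} = pair-elim (λ k t l s → k < n → l < n → n ≤ k * t + l * s + 1)
  (λ k t l s h p q → swap-bound (k * t) (l * s) 1 (h q p))
  (λ l s _ _ n<n _ → ⊥-elim (<-irrefl refl n<n))
  (λ x y h _ _ → slack 0 h (identity4 x y))
  (λ x y j h _ _ → slack (y + j + y * j) h (identity5 x y j))
  (λ x i y j h _ _ → slack (1 + x + i + x * i + y + j + y * j) h (identity6 x i y j))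

sum×-bound : ∀ {n k t l s} → Pair n k t l s → n ≤ k * (1 + t) + l * (1 + s)
sum×-bound {n} = pair-elim (λ k t l s → n ≤ k * (1 + t) + l * (1 + s))
  (λ k t l s → swap-sum (k * (1 + t)) (l * (1 + s)))
  (λ l s _ _ → ≤-trans (≤-reflexive (sym (*-identityʳ n))) (m≤m+n (n * 1) (l * (1 + s))))
  (λ x y h → slack (3 + x + y) h (identity7 x y))
  (λ x y j h → slack (2 + x + 2 * y + j + y * j) h (identity8 x y j))
  (λ x i y j h → slack (2 + 2 * x + i + x * i + 2 * y + j + y * j) h (identity9 x i y j))

-- The second alternative remains when neither set is full and one takes at least two steps. With n
-- ≤ 4 + z, the value 6 + 6z reaches 3n once z ≥ 2, which n ≥ 6 guarantees; for n = 5 only z ≥ 1 is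
-- certain, which gives 12.
product×-cases : ∀ {n k t l s} → Pair n k t l s →
  3 * n ≤ k * (1 + t) * (l * (1 + s)) ⊎ ∃[ z ] (n ≤ 4 + z × 6 + 6 * z ≤ k * (1 + t) * (l * (1 + s)))
product×-cases {n} = pair-elim (λ k t l s → Goal (k * (1 + t) * (l * (1 + s))))
  (λ k t l s → subst Goal (*-comm (k * (1 + t)) (l * (1 + s))))
  (λ l s 4≤n h → inj₁ (≤-trans (≤-reflexive (trans (*-comm 3 n) (cong (_* 3) (sym (*-identityʳ n)))))
    (*-monoʳ-≤ (n * 1) (3≤k*[1+t] 4≤n h))))
  (λ x y h → inj₁ (slack (1 + 5 * x + 5 * y + 4 * (x * y)) (*-monoʳ-≤ 3 h) (identity10 x y)))
  (λ x y j h → inj₂ (1 + x + y , slack 0 h (identity11 x y) ,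
    slack (6 * y + 6 * (x * y) + (4 + 2 * x) * (1 + y) * j) ≤-refl (identity12 x y j)))
  (λ x i y j h → inj₂ (x + y , slack 0 h (identity13 x y) ,
    ≤-trans (slack (3 + 3 * x + 3 * y + 9 * (x * y)) ≤-refl (identity14 x y))
      (*-mono-≤ {suc x * 3} {suc x * (1 + suc (suc i))} (*-monoʳ-≤ (suc x) {3} {1 + suc (suc i)} (s≤s (s≤s (s≤s z≤n)))) (*-monoʳ-≤ (suc y) {3} {1 + suc (suc j)} (s≤s (s≤s (s≤s z≤n)))))))
  where
  Goal : ℕ → Set
  Goal m = 3 * n ≤ m ⊎ ∃[ z ] (n ≤ 4 + z × 6 + 6 * z ≤ m)

product×-bound : ∀ {n k t l s} → Pair n k t l s → 6 ≤ n → 3 * n ≤ k * (1 + t) * (l * (1 + s))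
product×-bound {n} P 6≤n = [ id , (λ (z , n≤ , h) → ≤-trans (small z n≤) h) ]′ (product×-cases P)
  where
  small : ∀ z → n ≤ 4 + z → 3 * n ≤ 6 + 6 * z
  small z n≤ = begin
    3 * n             ≤⟨ *-monoʳ-≤ 3 n≤ ⟩
    3 * (4 + z)       ≡⟨ identity15 z ⟩
    6 + 3 * z + 3 * 2 ≤⟨ +-monoʳ-≤ (6 + 3 * z) (*-monoʳ-≤ 3 (+-cancelˡ-≤ 4 _ _ (≤-trans 6≤n n≤))) ⟩
    6 + 3 * z + 3 * z ≡⟨ identity16 z ⟩
    6 + 6 * z         ∎
    where open ≤-Reasoning

12≤product× : ∀ {k t l s} → Pair 5 k t l s → 12 ≤ k * (1 + t) * (l * (1 + s))
12≤product× P = [ ≤-trans (m≤m+n 12 3) , (λ (z , n≤ , h) → ≤-trans (small z n≤) h) ]′ (product×-cases P)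
  where
  small : ∀ z → 5 ≤ 4 + z → 12 ≤ 6 + 6 * z
  small zero    (s≤s (s≤s (s≤s (s≤s ()))))
  small (suc z) _ = +-monoʳ-≤ 6 (*-monoʳ-≤ 6 (s≤s z≤n))

-- (a − 3)(b − 3) ≥ 0.
product₊-bound : ∀ {n a b} → 3 ≤ a → 3 ≤ b → n < a + b → 3 * n ≤ a * b + 6
product₊-bound {n} p q = ≥-elim 3 (λ a → ∀ {b} → 3 ≤ b → n < a + b → 3 * n ≤ a * b + 6)
  (λ x → ≥-elim 3 (λ b → n < 3 + x + b → 3 * n ≤ (3 + x) * b + 6)
    λ y h → slack (x * y) (*-monoʳ-≤ 3 (≤-pred (≤-trans h (≤-reflexive (identity17 x y))))) (identity18 x y)) p q

-- (a − 2)(b − 2) ≥ 0.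
product*-bound : ∀ {n a b} → 2 ≤ a → 2 ≤ b → n ≤ a + b + 1 → 2 * n ≤ a * b + 6
product*-bound {n} p q = ≥-elim 2 (λ a → ∀ {b} → 2 ≤ b → n ≤ a + b + 1 → 2 * n ≤ a * b + 6)
  (λ x → ≥-elim 2 (λ b → n ≤ 2 + x + b + 1 → 2 * n ≤ (2 + x) * b + 6)
    λ y h → slack (x * y) (*-monoʳ-≤ 2 h) (identity19 x y)) p q

-- (a - 1)(b - 1) ≥ 1.
product*-bound′ : ∀ {n a b} → 2 ≤ a → 2 ≤ b → n ≤ a + b + 1 → n ≤ a * b + 1
product*-bound′ {n} p q = ≥-elim 2 (λ a → ∀ {b} → 2 ≤ b → n ≤ a + b + 1 → n ≤ a * b + 1)
  (λ x → ≥-elim 2 (λ b → n ≤ 2 + x + b + 1 → n ≤ (2 + x) * b + 1)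
    λ y h → slack (x + y + x * y) h (identity20 x y)) p q

-- Natural numbers inside the rationals, and o-terms

-- `ι` normalises by a gcd that does not compute for a variable `m`; facts about `ι` are therefore
-- transferred from unnormalised fractions.
ι-unnormalised : ∀ m → ℚ.toℚᵘ (ι m) ℚᵘ.≃ ℚᵘ.mkℚᵘ (ℤ.+ m) 0
ι-unnormalised m = ℚ.toℚᵘ-fromℚᵘ (ℚᵘ.mkℚᵘ (ℤ.+ m) 0)

ι-+ : ∀ a b → ι (a + b) ≡ ι a ℚ.+ ι b
ι-+ a b = ℚ.toℚᵘ-injective (begin
  ℚ.toℚᵘ (ι (a + b))                              ≈⟨ ι-unnormalised (a + b) ⟩
  ℚᵘ.mkℚᵘ (ℤ.+ (a + b)) 0                         ≈⟨ ℚᵘ.*≡* (cong (ℤ._* ℤ.+ 1) eq) ⟩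
  ℚᵘ.mkℚᵘ (ℤ.+ a) 0 ℚᵘ.+ ℚᵘ.mkℚᵘ (ℤ.+ b) 0        ≈⟨ ℚᵘ.+-cong (ι-unnormalised a) (ι-unnormalised b) ⟨
  ℚ.toℚᵘ (ι a) ℚᵘ.+ ℚ.toℚᵘ (ι b)                  ≈⟨ ℚ.toℚᵘ-homo-+ (ι a) (ι b) ⟨
  ℚ.toℚᵘ (ι a ℚ.+ ι b)                            ∎)
  where
  open ℚᵘ.≃-Reasoning
  eq : ℤ.+ (a + b) ≡ ℤ.+ a ℤ.* ℤ.+ 1 ℤ.+ ℤ.+ b ℤ.* ℤ.+ 1
  eq = trans (ℤ.pos-+ a b) (sym (cong₂ ℤ._+_ (ℤ.*-identityʳ (ℤ.+ a)) (ℤ.*-identityʳ (ℤ.+ b))))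

ι-∸ : ∀ {c b} → c ≤ b → ι (b ∸ c) ≡ ι b ℚ.- ι c
ι-∸ {c} {b} c≤b = sym (begin
  ι b ℚ.- ι c                      ≡⟨ cong (λ m → ι m ℚ.- ι c) (m∸n+n≡m c≤b) ⟨
  ι (b ∸ c + c) ℚ.- ι c            ≡⟨ cong (ℚ._- ι c) (ι-+ (b ∸ c) c) ⟩
  (ι (b ∸ c) ℚ.+ ι c) ℚ.- ι c      ≡⟨ //-rightDividesʳ (ι c) (ι (b ∸ c)) ⟩
  ι (b ∸ c)                        ∎)
  where open ≡-Reasoning

ι-mono : ∀ {a b} → a ≤ b → ι a ℚ.≤ ι b
ι-mono {a} {b} a≤b = ℚ.toℚᵘ-cancel-≤ (ℚᵘ.≤-respˡ-≃ (ℚᵘ.≃-sym (ι-unnormalised a)) (ℚᵘ.≤-respʳ-≃ (ℚᵘ.≃-sym (ι-unnormalised b))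
  (ℚᵘ.*≤* (subst₂ ℤ._≤_ (sym (ℤ.*-identityʳ (ℤ.+ a))) (sym (ℤ.*-identityʳ (ℤ.+ b))) (ℤ.+≤+ a≤b)))))

-- `K` is the denominator of `δ`: a positive numerator is at least 1, so `δ` is at least 1 / K.
ι-archimedean : ∀ δ → ℚ.0ℚ ℚ.< δ → ∃[ K ] ∀ a b → K * a < b → ι a ℚ.< δ ℚ.* ι b
ι-archimedean δ@(ℚ.mkℚ ℤ.+[1+ p ] d _) _ = suc d , λ a b Ka<b →
  ℚ.toℚᵘ-cancel-< (ℚᵘ.<-respˡ-≃ (ℚᵘ.≃-sym (ι-unnormalised a))
    (ℚᵘ.<-respʳ-≃ (ℚᵘ.≃-sym (ℚᵘ.≃-trans (ℚ.toℚᵘ-homo-* δ (ι b)) (ℚᵘ.*-congˡ {ℚ.toℚᵘ δ} (ι-unnormalised b))))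
    (ℚᵘ.*<* (subst₂ ℤ._<_ (ℤ.pos-* a (suc d * 1))
                          (trans (cong ℤ.+_ (sym (*-identityʳ (suc p * b)))) (trans (ℤ.pos-* (suc p * b) 1) (cong (ℤ._* ℤ.+ 1) (ℤ.pos-* (suc p) b))))
      (ℤ.+<+ (≤-<-trans (≤-reflexive (trans (cong (a *_) (*-identityʳ (suc d))) (*-comm a (suc d))))
                        (<-≤-trans Ka<b (m≤m+n b (p * b)))))))))
ι-archimedean (ℚ.mkℚ (ℤ.+ 0) _ _)    (ℚ.*<* (ℤ.+<+ ()))
ι-archimedean (ℚ.mkℚ ℤ.-[1+ _ ] _ _) (ℚ.*<* ())

ι-pos : ∀ {m} → 1 ≤ m → ℚ.0ℚ ℚ.< ι m
ι-pos {m} 1≤m = ℚ.toℚᵘ-cancel-< (ℚᵘ.<-respʳ-≃ (ℚᵘ.≃-sym (ι-unnormalised m))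
  (ℚᵘ.*<* (subst (ℤ.0ℤ ℤ.<_) (sym (ℤ.*-identityʳ (ℤ.+ m))) (ℤ.+<+ 1≤m))))

littleO : ∀ (h g : ℕ → ℕ) → (∀ n → 1 ≤ n → 0 < h n × 0 < g n) →
          (∀ K → ∃[ N ] ∀ n → N ≤ n → K * h n < g n) → LittleO (ι ∘ h) g
littleO h g pos small = (λ n 1≤n → ι-pos (proj₁ (pos n 1≤n)) , proj₂ (pos n 1≤n)) , λ δ 0<δ →
  let K , lt = ι-archimedean δ 0<δ
      N , sm = small K
  in N , λ n N≤n → lt (h n) (g n) (sm n N≤n)

-- Bounds for the optimal values

1≤n∸2 : ∀ {n} → 4 ≤ n → 1 ≤ n ∸ 2
1≤n∸2 4≤n = ≤-trans (s≤s z≤n) (∸-monoˡ-≤ 2 4≤n)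

n∸2<n : ∀ {n} → 4 ≤ n → n ∸ 2 < n
n∸2<n (s≤s (s≤s _)) = n≤1+n _

abstract
  -- Only minimality matters later, never which minimiser the search returns. For `opt*` size n is
  -- excluded, so the search starts from all vertices but two nonadjacent ones.
  opt₊ : ∀ {n} {G H : Graph n} → Setting G H → Th₊.Optimum G
  opt₊ {G = G} st = Th₊.optimum G {t = 0} (≤-trans (s≤s z≤n) (Setting.4≤n st)) ≤-refl (achieves-all G)

  opt× : ∀ {n} {G H : Graph n} → Setting G H → Th×.Optimum G
  opt× {G = G} st = Th×.optimum G {t = 0} (≤-trans (s≤s z≤n) (Setting.4≤n st)) ≤-refl (achieves-all G)

  opt* : ∀ {n} {G H : Graph n} → Setting G H → Th*.Optimum G
  opt* {n} {G} st = Th*.optimum G {t = 1} (1≤n∸2 4≤n) (n∸2<n 4≤n) (achieves-n∸2 st)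
    where open Setting st

module Bounds {n} {G H : Graph n} (st : Setting G H) where
  open Setting st

  a₊ = Th₊.Optimum.value (opt₊ st)
  a* = Th*.Optimum.value (opt* st)
  a× = Th×.Optimum.value (opt× st)

  3≤a₊ : 3 ≤ a₊
  3≤a₊ = 3≤k+t 4≤n (shape {t = Th₊.Optimum.time o} st (Th₊.Optimum.1≤size o) (Th₊.Optimum.achieved o)) where o = opt₊ st

  2≤a* : 2 ≤ a*
  2≤a* = 2≤k*t 4≤n (Th*.Optimum.inRange o) (shape {t = Th*.Optimum.time o} st (Th*.Optimum.1≤size o) (Th*.Optimum.achieved o)) where o = opt* st

  3≤a× : 3 ≤ a×
  3≤a× = 3≤k*[1+t] 4≤n (shape {t = Th×.Optimum.time o} st (Th×.Optimum.1≤size o) (Th×.Optimum.achieved o)) where o = opt× st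

  a₊<n : a₊ + 1 ≤ n
  a₊<n = ≤-trans (+-monoˡ-≤ 1 (Th₊.Optimum.least (opt₊ st) (n ∸ 2) 1 (1≤n∸2 4≤n) (m∸n≤m n 2) (achieves-n∸2 st)))
    (≤-reflexive (trans (+-assoc (n ∸ 2) 1 1) (m∸n+n≡m (2≤n st))))

  a*<n : a* + 1 ≤ n
  a*<n = ≤-trans (+-monoˡ-≤ 1 (Th*.Optimum.least (opt* st) (n ∸ 2) 1 (1≤n∸2 4≤n) (n∸2<n 4≤n) (achieves-n∸2 st)))
    (≤-trans (≤-reflexive (trans (cong (_+ 1) (*-identityʳ (n ∸ 2))) (+-comm (n ∸ 2) 1))) (n∸2<n 4≤n))

  a×≤n : a× ≤ n
  a×≤n = ≤-trans (Th×.Optimum.least (opt× st) n 0 (≤-trans (s≤s z≤n) 4≤n) ≤-refl (achieves-all G)) (≤-reflexive (*-identityʳ n))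

module DoubleBounds {n} {G H : Graph n} (st : Setting G H) where
  open Setting st
  open Bounds st public
  open Bounds (Setting-sym st) public
    renaming ( a₊ to b₊ ; a* to b* ; a× to b× ; 3≤a₊ to 3≤b₊ ; 2≤a* to 2≤b* ; 3≤a× to 3≤b×
             ; a₊<n to b₊<n ; a*<n to b*<n ; a×≤n to b×≤n )

  n<sum₊ : n < a₊ + b₊
  n<sum₊ = sum₊-bound (pair {t = Th₊.Optimum.time o} {s = Th₊.Optimum.time p} st (Th₊.Optimum.1≤size o) (Th₊.Optimum.1≤size p) (Th₊.Optimum.achieved o) (Th₊.Optimum.achieved p))
    where
    o = opt₊ st
    p = opt₊ (Setting-sym st)

  n≤sum* : n ≤ a* + b* + 1
  n≤sum* = sum*-bound (pair {t = Th*.Optimum.time o} {s = Th*.Optimum.time p} st (Th*.Optimum.1≤size o) (Th*.Optimum.1≤size p) (Th*.Optimum.achieved o) (Th*.Optimum.achieved p))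
    (Th*.Optimum.inRange o) (Th*.Optimum.inRange p)
    where
    o = opt* st
    p = opt* (Setting-sym st)

  private
    o = opt× st
    p = opt× (Setting-sym st)

  pair× : Pair n (Th×.Optimum.size o) (Th×.Optimum.time o) (Th×.Optimum.size p) (Th×.Optimum.time p)
  pair× = pair {t = Th×.Optimum.time o} {s = Th×.Optimum.time p} st (Th×.Optimum.1≤size o) (Th×.Optimum.1≤size p) (Th×.Optimum.achieved o) (Th×.Optimum.achieved p)

  n≤sum× : n ≤ a× + b×
  n≤sum× = sum×-bound pair×

  3n≤a₊b₊+6 : 3 * n ≤ a₊ * b₊ + 6
  3n≤a₊b₊+6 = product₊-bound 3≤a₊ 3≤b₊ n<sum₊

  9≤a₊b₊ : 9 ≤ a₊ * b₊
  9≤a₊b₊ = *-mono-≤ 3≤a₊ 3≤b₊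

  -- 3n - 6 is at least 2n from n = 6 on, and for n = 4 the product 9 exceeds 8. At n = 5 both give
  -- only 9, short of 10.
  2n≤a₊b₊ : n ≢ 5 → 2 * n ≤ a₊ * b₊
  2n≤a₊b₊ n≢5 with m≤n⇒m<n∨m≡n 4≤n
  ... | inj₂ refl = ≤-trans (n≤1+n 8) 9≤a₊b₊
  ... | inj₁ 5≤n  = +-cancelʳ-≤ n (2 * n) (a₊ * b₊) (begin
    2 * n + n    ≡⟨ eq n ⟩
    3 * n        ≤⟨ 3n≤a₊b₊+6 ⟩
    a₊ * b₊ + 6  ≤⟨ +-monoʳ-≤ (a₊ * b₊) (≤∧≢⇒< 5≤n (n≢5 ∘ sym)) ⟩
    a₊ * b₊ + n  ∎)
    where
    open ≤-Reasoning
    eq : ∀ n → 2 * n + n ≡ 3 * n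
    eq = solve-∀

sum≤2n∸1 : ∀ {n a b} → a + 1 ≤ n → b + 1 ≤ n → a + b ≤ 2 * n ∸ 1
sum≤2n∸1 {n} {a} {b} p q = begin
  a + b              ≡⟨ m+n∸n≡m (a + b) 1 ⟨
  (a + b + 1) ∸ 1    ≤⟨ ∸-monoˡ-≤ 1 (≤-trans (≤-trans (m≤m+n (a + b + 1) 1) (≤-reflexive (eq a b))) (≤-trans (+-mono-≤ p q) (≤-reflexive (eq′ n)))) ⟩
  2 * n ∸ 1          ∎
  where
  open ≤-Reasoning
  eq : ∀ a b → a + b + 1 + 1 ≡ a + 1 + (b + 1)
  eq = solve-∀
  eq′ : ∀ n → n + n ≡ 2 * n
  eq′ = solve-∀

product≤n²∸1 : ∀ {n a b} → a + 1 ≤ n → b + 1 ≤ n → a * b ≤ n ^ 2 ∸ 1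
product≤n²∸1 {n} {a} {b} p q = begin
  a * b              ≡⟨ m+n∸n≡m (a * b) 1 ⟨
  (a * b + 1) ∸ 1    ≤⟨ ∸-monoˡ-≤ 1 (≤-trans (≤-trans (m≤m+n (a * b + 1) (a + b)) (≤-reflexive (eq a b))) (≤-trans (*-mono-≤ p q) (≤-reflexive (eq′ n)))) ⟩
  n ^ 2 ∸ 1          ∎
  where
  open ≤-Reasoning
  eq : ∀ a b → a * b + 1 + (a + b) ≡ (a + 1) * (b + 1)
  eq = solve-∀
  eq′ : ∀ n → n * n ≡ n ^ 2
  eq′ n = cong (n *_) (sym (*-identityʳ n))

-- The o-term can be the constant 1.
upperBound-o : ∀ {C : Pred ℕ 0ℓ} (Q : Quantity) (b g : ℕ → ℕ) → (∀ n → 1 ≤ n → 0 < g n) →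
  (∀ K → ∃[ N ] ∀ n → N ≤ n → K * 1 < g n) →
  (∀ {n} (G : Graph n) → C n → BothConnected G → 1 ≤ b n × ∃[ m ] (Q G m × m ≤ b n ∸ 1)) → UpperBound-o C Q b g
upperBound-o Q b g pos small bound = (λ _ → ι 1) , littleO (λ _ → 1) g (λ n 1≤n → s≤s z≤n , pos n 1≤n) small ,
  λ {n} G c conn → let 1≤b , m , q , m≤ = bound G c conn in
    m , q , subst (ι m ℚ.≤_) (ι-∸ 1≤b) (ι-mono m≤)

n≤n² : ∀ n → n ≤ n ^ 2
n≤n² zero    = z≤n
n≤n² (suc n) = ≤-trans (≤-reflexive (sym (*-identityʳ (suc n)))) (*-monoʳ-≤ (suc n) (≤-trans (s≤s z≤n) (≤-reflexive (sym (*-identityʳ (suc n))))))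

eventually-n : ∀ K → ∃[ N ] ∀ n → N ≤ n → K * 1 < n
eventually-n K = suc K , λ n K<n → ≤-trans (s≤s (≤-reflexive (*-identityʳ K))) K<n

eventually-n² : ∀ K → ∃[ N ] ∀ n → N ≤ n → K * 1 < n ^ 2
eventually-n² K = suc K , λ n K<n → ≤-trans (proj₂ (eventually-n K) n K<n) (n≤n² n)

-- Orders four and five by inspection of all adjacency matrices

-- A symmetric Boolean matrix with zero diagonal, given by its strict upper triangle.
Matrix : ℕ → Set
Matrix zero    = ⊤
Matrix (suc n) = Vec Bool n × Matrix n

entry : ∀ {n} → Matrix n → Fin n → Fin n → Bool
entry {suc n} (r , m) zero    zero    = false
entry {suc n} (r , m) zero    (suc j) = lookup r j
entry {suc n} (r , m) (suc i) zero    = lookup r i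
entry {suc n} (r , m) (suc i) (suc j) = entry m i j

matrix : ∀ n → (Fin n → Fin n → Bool) → Matrix n
matrix zero    A = tt
matrix (suc n) A = tabulate (A zero ∘ suc) , matrix n (λ i j → A (suc i) (suc j))

entry-matrix : ∀ {n} {A : Fin n → Fin n → Bool} → (∀ i j → A i j ≡ A j i) → (∀ i → A i i ≡ false) →
               ∀ i j → entry (matrix n A) i j ≡ A i j
entry-matrix A-sym A-irr zero    zero    = sym (A-irr zero)
entry-matrix A-sym A-irr zero    (suc j) = lookup∘tabulate _ j
entry-matrix A-sym A-irr (suc i) zero    = trans (lookup∘tabulate _ i) (A-sym zero (suc i))
entry-matrix A-sym A-irr (suc i) (suc j) = entry-matrix (λ i j → A-sym (suc i) (suc j)) (λ i → A-irr (suc i)) i j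

decided : ∀ {P : Set} (d : Dec P) → does d ≡ true → P
decided (yes p) _ = p

allVec? : ∀ k {P : Vec Bool k → Set} → (∀ v → Dec (P v)) → Dec (∀ v → P v)
allVec? zero    P? = map′ (λ p → λ { [] → p }) (λ f → f []) (P? [])
allVec? (suc k) P? = map′ (λ (f , g) → λ { (false ∷ v) → f v ; (true ∷ v) → g v }) (λ h → h ∘ (false ∷_) , h ∘ (true ∷_))
  (allVec? k (P? ∘ (false ∷_)) ×-dec allVec? k (P? ∘ (true ∷_)))

allMatrix? : ∀ n {P : Matrix n → Set} → (∀ m → Dec (P m)) → Dec (∀ m → P m)
allMatrix? zero    P? = map′ (λ p _ → p) (λ f → f tt) (P? tt)
allMatrix? (suc n) P? = map′ (λ f (r , m) → f m r) (λ f m r → f (r , m))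
  (allMatrix? n λ m → allVec? n λ r → P? (r , m))

module _ {n} (G : Graph n) where

  -- A graph carries an arbitrary decidable relation and cannot be enumerated; the exhaustive checks
  -- run over matrices and are transferred along this map.
  adjacency : Matrix n
  adjacency = matrix n λ x y → does (Graph._~?_ G x y)

  entry-adjacency : ∀ x y → entry adjacency x y ≡ does (Graph._~?_ G x y)
  entry-adjacency = entry-matrix does-sym does-irr
    where
    does-sym : ∀ x y → does (Graph._~?_ G x y) ≡ does (Graph._~?_ G y x)
    does-sym x y with Graph._~?_ G x y | Graph._~?_ G y x
    ... | yes _ | yes _ = refl
    ... | no _  | no _  = refl
    ... | yes e | no ¬e = ⊥-elim (¬e (Graph.sym G e))
    ... | no ¬e | yes e = ⊥-elim (¬e (Graph.sym G e))
    does-irr : ∀ x → does (Graph._~?_ G x x) ≡ false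
    does-irr x with Graph._~?_ G x x
    ... | yes e = ⊥-elim (Graph.irrefl G refl e)
    ... | no _  = refl

  edge⁺ : ∀ {x y} → entry adjacency x y ≡ true → Graph._~_ G x y
  edge⁺ {x} {y} eq with Graph._~?_ G x y | trans (sym (entry-adjacency x y)) eq
  ... | yes e | _ = e

  edge⁻ : ∀ {x y} → Graph._~_ G x y → entry adjacency x y ≡ true
  edge⁻ {x} {y} e with Graph._~?_ G x y | entry-adjacency x y
  ... | yes _ | eq = eq
  ... | no ¬e | _  = ⊥-elim (¬e e)

  nonedge : ∀ {x y} → entry adjacency x y ≡ false → ¬ Graph._~_ G x y
  nonedge eq e = case trans (sym eq) (edge⁻ e) of λ ()

Triple : ∀ {n} → Matrix n → Bool → Fin n → Fin n → Fin n → Set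
Triple m c x y z = x ≢ y × x ≢ z × y ≢ z × entry m x y ≡ c × entry m x z ≡ c × entry m y z ≡ c

-- A sufficient condition for v to force w when p and q are filled: the component
-- of w has radius at most 1 around w.
ForcedBy : ∀ {n} → Matrix n → (p q v w : Fin n) → Set
ForcedBy m p q v w = entry m v w ≡ true × (∀ z → z ≢ p × z ≢ q → entry m w z ≡ true → entry m v z ≡ false ×
                       (∀ y → y ≢ p × y ≢ q → entry m z y ≡ true → y ≡ w))

Fast : ∀ {n} → Matrix n → Fin n → Fin n → Set
Fast m p q = p ≢ q × (∀ w → w ≡ p ⊎ w ≡ q ⊎ ForcedBy m p q p w ⊎ ForcedBy m p q q w)

triple? : ∀ {n} (m : Matrix n) c x y z → Dec (Triple m c x y z)
triple? m c x y z = ¬? (x ≟ y) ×-dec ¬? (x ≟ z) ×-dec ¬? (y ≟ z) ×-dec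
  (entry m x y Bool.≟ c) ×-dec (entry m x z Bool.≟ c) ×-dec (entry m y z Bool.≟ c)

fast? : ∀ {n} (m : Matrix n) p q → Dec (Fast m p q)
fast? m p q = ¬? (p ≟ q) ×-dec all? λ w → (w ≟ p) ⊎-dec (w ≟ q) ⊎-dec by? p w ⊎-dec by? q w
  where
  out? : ∀ u → Dec (u ≢ p × u ≢ q)
  out? u = ¬? (u ≟ p) ×-dec ¬? (u ≟ q)
  by? : ∀ v w → Dec (ForcedBy m p q v w)
  by? v w = (entry m v w Bool.≟ true) ×-dec all? λ z → out? z →-dec ((entry m w z Bool.≟ true) →-dec
    ((entry m v z Bool.≟ false) ×-dec all? λ y → out? y →-dec ((entry m z y Bool.≟ true) →-dec (y ≟ w))))

abstract
  -- The 5-cycle is the only graph on five vertices with neither a triangle nor three independent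
  -- vertices. There, two nonadjacent filled vertices leave a single vertex and an edge whose ends
  -- have different filled neighbours, so one step suffices.
  order-5 : ∀ (m : Matrix 5) → (∃₂ λ x y → ∃[ z ] Triple m false x y z) ⊎ (∃₂ λ x y → ∃[ z ] Triple m true x y z) ⊎
                               (∃₂ λ p q → Fast m p q)
  order-5 = decided (allMatrix? 5 λ m →
    (any? λ x → any? λ y → any? λ z → triple? m false x y z) ⊎-dec (any? λ x → any? λ y → any? λ z → triple? m true x y z)
    ⊎-dec (any? λ p → any? λ q → fast? m p q)) refl

IsPath : Matrix 4 → Fin 4 → Fin 4 → Fin 4 → Fin 4 → Set
IsPath m a b c d = (∀ u → u ≡ a ⊎ u ≡ b ⊎ u ≡ c ⊎ u ≡ d) ×
  entry m b a ≡ true × entry m b c ≡ true × entry m c d ≡ true ×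
  entry m a c ≡ false × entry m b d ≡ false × entry m a d ≡ false

-- `u` and `v` may coincide. On four vertices, every way of falling apart has a side with one or two
-- vertices, so this covers disconnectedness of the graph (`false`) and of its complement (`true`).
Cut : ∀ {n} → Matrix n → Bool → Fin n → Fin n → Set
Cut m c u v = ∀ x y → x ≡ u ⊎ x ≡ v → ¬ (y ≡ u ⊎ y ≡ v) → entry m x y ≡ c

abstract
  -- The path is the only graph of order four that is connected along with its complement.
  order-4 : ∀ (m : Matrix 4) → (∃₂ λ u v → Cut m false u v) ⊎ (∃₂ λ u v → Cut m true u v) ⊎
                               (∃₂ λ a b → ∃₂ λ c d → IsPath m a b c d)
  order-4 = decided (allMatrix? 4 λ m →
    (any? λ u → any? λ v → cut? m false u v) ⊎-dec (any? λ u → any? λ v → cut? m true u v) ⊎-dec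
    (any? λ a → any? λ b → any? λ c → any? λ d → path? m a b c d)) refl
    where
    cut? : ∀ (m : Matrix 4) c u v → Dec (Cut m c u v)
    cut? m c u v = all? λ x → all? λ y → ((x ≟ u) ⊎-dec (x ≟ v)) →-dec (¬? ((y ≟ u) ⊎-dec (y ≟ v)) →-dec (entry m x y Bool.≟ c))
    path? : ∀ (m : Matrix 4) a b c d → Dec (IsPath m a b c d)
    path? m a b c d = (all? λ u → (u ≟ a) ⊎-dec (u ≟ b) ⊎-dec (u ≟ c) ⊎-dec (u ≟ d)) ×-dec
      (entry m b a Bool.≟ true) ×-dec (entry m b c Bool.≟ true) ×-dec (entry m c d Bool.≟ true) ×-dec
      (entry m a c Bool.≟ false) ×-dec (entry m b d Bool.≟ false) ×-dec (entry m a d Bool.≟ false)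

card-triple : ∀ {n} {x y z : Fin n} → x ≢ y → x ≢ z → y ≢ z → card (λ u → (u ≟ x) ⊎-dec (u ≟ y) ⊎-dec (u ≟ z)) ≡ 3
card-triple {x = x} {y} {z} x≢y x≢z y≢z = ≤-antisym
  (≤-trans (card-⊎ (_≟ x) yz? xyz? (λ _ → id)) (≤-reflexive eq))
  (≤-trans (≤-reflexive (sym eq)) (card-disjoint (_≟ x) yz? xyz? (λ _ → inj₁) (λ _ → inj₂)
    (λ { _ refl → [ x≢y , x≢z ]′ })))
  where
  yz? = λ u → (u ≟ y) ⊎-dec (u ≟ z)
  xyz? = λ u → (u ≟ x) ⊎-dec (u ≟ y) ⊎-dec (u ≟ z)
  eq : card (_≟ x) + card yz? ≡ 3
  eq = cong₂ _+_ (card-singleton x) (card-pair y≢z)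

triple⇒achieves : ∀ {n} {G H : Graph n} → Setting G H → ∀ {x y z} → x ≢ y → x ≢ z → y ≢ z →
  ¬ Graph._~_ G x y → ¬ Graph._~_ G x z → ¬ Graph._~_ G y z → Achieves G (n ∸ 3) 1
triple⇒achieves {n} {G} st {x} {y} {z} x≢y x≢z y≢z xy xz yz =
  subst (λ k → Achieves G (n ∸ k) 1) (card-triple x≢y x≢z y≢z)
    (achieves-independent G (2≤n st) (Setting.connG st) (λ u → (u ≟ x) ⊎-dec (u ≟ y) ⊎-dec (u ≟ z)) indep)
  where
  irr : ∀ {u} → ¬ Graph._~_ G u u
  irr = Graph.irrefl G refl
  indep : ∀ {u v} → u ≡ x ⊎ u ≡ y ⊎ u ≡ z → v ≡ x ⊎ v ≡ y ⊎ v ≡ z → ¬ Graph._~_ G u v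
  indep (inj₁ refl)        (inj₁ refl)        = irr
  indep (inj₁ refl)        (inj₂ (inj₁ refl)) = xy
  indep (inj₁ refl)        (inj₂ (inj₂ refl)) = xz
  indep (inj₂ (inj₁ refl)) (inj₁ refl)        = xy ∘ Graph.sym G
  indep (inj₂ (inj₁ refl)) (inj₂ (inj₁ refl)) = irr
  indep (inj₂ (inj₁ refl)) (inj₂ (inj₂ refl)) = yz
  indep (inj₂ (inj₂ refl)) (inj₁ refl)        = xz ∘ Graph.sym G
  indep (inj₂ (inj₂ refl)) (inj₂ (inj₁ refl)) = yz ∘ Graph.sym G
  indep (inj₂ (inj₂ refl)) (inj₂ (inj₂ refl)) = irr

fast⇒achieves : ∀ {n} (G : Graph n) {p q} → Fast (adjacency G) p q → Achieves G 2 1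
fast⇒achieves G {p} {q} (p≢q , by) = subst (λ k → Achieves G k 1) (card-pair p≢q)
  (achieves G (λ u → (u ≟ p) ⊎-dec (u ≟ q)) 1 fill)
  where
  open Graph G using (_~_)
  B : Fin _ → Set
  B u = u ≡ p ⊎ u ≡ q
  out : ∀ {u} → ¬ B u → u ≢ p × u ≢ q
  out ¬b = ¬b ∘ inj₁ , ¬b ∘ inj₂
  force : ∀ {v w} → B v → ¬ B w → ForcedBy (adjacency G) p q v w → _^[_] G B 1 w
  force {v} {w} Bv ¬Bw (v~w , radius) = inj₂ (v , forcing⇒forces G (Bv , ¬Bw , edge⁺ G v~w , only))
    where
    near-w : ∀ {z u} → ¬ B z → z ≡ w ⊎ w ~ z → Reach G B z u → u ≡ w ⊎ w ~ u
    near-w ¬Bz e ε = e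
    near-w ¬Bz (inj₁ refl) ((_ , ¬By , e) ◅ r) = near-w ¬By (inj₂ e) r
    near-w ¬Bz (inj₂ w~z) ((_ , ¬By , e) ◅ r) =
      near-w ¬By (inj₁ (proj₂ (radius _ (out ¬Bz) (edge⁻ G w~z)) _ (out ¬By) (edge⁻ G e))) r
    only : ∀ u → ¬ B u → v ~ u → Reach G B w u → u ≡ w
    only u ¬Bu v~u r with near-w ¬Bw (inj₁ refl) r
    ... | inj₁ eq  = eq
    ... | inj₂ w~u = ⊥-elim (nonedge G (proj₁ (radius u (out ¬Bu) (edge⁻ G w~u))) v~u)
  fill : ∀ w → _^[_] G B 1 w
  fill w with (w ≟ p) ⊎-dec (w ≟ q)
  ... | yes Bw = inj₁ Bw
  ... | no ¬Bw with by w
  ...   | inj₁ eq                 = ⊥-elim (¬Bw (inj₁ eq))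
  ...   | inj₂ (inj₁ eq)          = ⊥-elim (¬Bw (inj₂ eq))
  ...   | inj₂ (inj₂ (inj₁ b))    = force (inj₁ refl) ¬Bw b
  ...   | inj₂ (inj₂ (inj₂ b))    = force (inj₂ refl) ¬Bw b

achieves-2-1 : ∀ {G H : Graph 5} → Setting G H → Achieves G 2 1 ⊎ Achieves H 2 1
achieves-2-1 {G} {H} st with order-5 (adjacency G)
... | inj₁ (x , y , z , x≢y , x≢z , y≢z , xy , xz , yz) =
  inj₁ (triple⇒achieves st x≢y x≢z y≢z (nonedge G xy) (nonedge G xz) (nonedge G yz))
... | inj₂ (inj₁ (x , y , z , x≢y , x≢z , y≢z , xy , xz , yz)) =
  inj₂ (triple⇒achieves (Setting-sym st) x≢y x≢z y≢z (excl (edge⁺ G xy)) (excl (edge⁺ G xz)) (excl (edge⁺ G yz)))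
  where open Setting st
... | inj₂ (inj₂ (p , q , f)) = inj₁ (fast⇒achieves G f)

crossing : ∀ {n} {R : Rel (Fin n) 0ℓ} {S : Pred (Fin n) 0ℓ} → Decidable S → ∀ {u v} → S u → ¬ S v → Star R u v →
           ∃₂ λ x y → S x × ¬ S y × R x y
crossing S? Su ¬Sv ε = ⊥-elim (¬Sv Su)
crossing S? {u} Su ¬Sv (_◅_ {j = y} e p) with S? y
... | yes Sy = crossing S? Sy ¬Sv p
... | no ¬Sy = u , y , Su , ¬Sy , e

no-cut : ∀ {n} {m : Matrix n} {c} {R : Rel (Fin n) 0ℓ} → 3 ≤ n → (∀ {x y} → R x y → entry m x y ≢ c) →
         (∀ u v → Star R u v) → ∀ u v → ¬ Cut m c u v
no-cut {n} 3≤n R⇒≢ conn u v cut with any? (λ w → ¬? ((w ≟ u) ⊎-dec (w ≟ v)))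
... | yes (w , w∉) = let x , y , Sx , ¬Sy , e = crossing (λ z → (z ≟ u) ⊎-dec (z ≟ v)) (inj₁ refl) w∉ (conn u w)
                     in R⇒≢ e (cut x y Sx ¬Sy)
... | no none = <⇒≱ 3≤n (begin
  n                                          ≡⟨ card-all uv? (λ w → decidable-stable (uv? w) λ ¬w → none (w , ¬w)) ⟨
  card uv?                                   ≤⟨ card-⊎ (_≟ u) (_≟ v) uv? (λ _ → id) ⟩
  card (_≟ u) + card (_≟ v)                  ≡⟨ cong₂ _+_ (card-singleton u) (card-singleton v) ⟩
  2                                          ∎)
  where
  open ≤-Reasoning
  uv? : ∀ w → Dec (w ≡ u ⊎ w ≡ v)
  uv? w = (w ≟ u) ⊎-dec (w ≟ v)

-- Filling the inner vertex `b` leaves the components {a} and {c, d}; `b` forces `a` and `c`, and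
-- then `c` forces `d`.
path⇒achieves : ∀ (G : Graph 4) {a b c d} → IsPath (adjacency G) a b c d → Achieves G 1 2
path⇒achieves G {a} {b} {c} {d} (cover , ba , bc , cd , ac , bd , ad) =
  subst (λ k → Achieves G k 2) (card-singleton b) (achieves G (_≟ b) 2 fill)
  where
  open Graph G using (_~_)
  irr : ∀ {u v} → u ≡ v → ¬ u ~ v
  irr = Graph.irrefl G
  b~a = edge⁺ G ba
  b~c = edge⁺ G bc
  c~d = edge⁺ G cd
  only-a : ∀ {u} → Reach G (_≡ b) a u → u ≡ a
  only-a ε = refl
  only-a (_◅_ {j = y} (_ , y≢b , a~y) _) with cover y
  ... | inj₁ refl               = ⊥-elim (irr refl a~y)
  ... | inj₂ (inj₁ y≡b)         = ⊥-elim (y≢b y≡b)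
  ... | inj₂ (inj₂ (inj₁ refl)) = ⊥-elim (nonedge G ac a~y)
  ... | inj₂ (inj₂ (inj₂ refl)) = ⊥-elim (nonedge G ad a~y)
  first-a : _^[_] G (_≡ b) 1 a
  first-a = inj₂ (b , forcing⇒forces G (refl , (λ a≡b → irr (sym a≡b) b~a) , b~a , λ _ _ _ → only-a))
  first-c : _^[_] G (_≡ b) 1 c
  first-c = inj₂ (b , forcing⇒forces G (refl , (λ c≡b → irr (sym c≡b) b~c) , b~c , only-c))
    where
    only-c : ∀ u → ¬ u ≡ b → b ~ u → Reach G (_≡ b) c u → u ≡ c
    only-c u u≢b b~u r with cover u
    ... | inj₁ refl               = sym (only-a (reach-sym G r))
    ... | inj₂ (inj₁ u≡b)         = ⊥-elim (u≢b u≡b)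
    ... | inj₂ (inj₂ (inj₁ refl)) = refl
    ... | inj₂ (inj₂ (inj₂ refl)) = ⊥-elim (nonedge G bd b~u)
  -- A force needs an unfilled target; deciding whether `d` is already filled avoids having to show
  -- that it is not.
  fill-d : Dec (_^[_] G (_≡ b) 1 d) → _^[_] G (_≡ b) 2 d
  fill-d (yes f) = inj₁ f
  fill-d (no ¬f) = inj₂ (c , forcing⇒forces G (first-c , ¬f , c~d , last))
    where
    last : ∀ v → ¬ _^[_] G (_≡ b) 1 v → c ~ v → Reach G (_^[_] G (_≡ b) 1) d v → v ≡ d
    last v ¬f′ _ _ with cover v
    ... | inj₁ refl               = ⊥-elim (¬f′ first-a)
    ... | inj₂ (inj₁ eq)          = ⊥-elim (¬f′ (inj₁ eq))
    ... | inj₂ (inj₂ (inj₁ refl)) = ⊥-elim (¬f′ first-c)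
    ... | inj₂ (inj₂ (inj₂ eq))   = eq
  fill : ∀ u → _^[_] G (_≡ b) 2 u
  fill u with cover u
  ... | inj₁ refl               = inj₁ first-a
  ... | inj₂ (inj₁ eq)          = inj₁ (inj₁ eq)
  ... | inj₂ (inj₂ (inj₁ refl)) = inj₁ first-c
  ... | inj₂ (inj₂ (inj₂ refl)) = fill-d (filled? G (_≟ b) 1 d)

achieves-1-2 : ∀ {G H : Graph 4} → Setting G H → Achieves G 1 2
achieves-1-2 {G} {H} st with order-4 (adjacency G)
... | inj₁ (u , v , cut) = ⊥-elim (no-cut (s≤s (s≤s (s≤s z≤n))) (λ e eq → nonedge G eq e) (Setting.connG st) u v cut)
... | inj₂ (inj₁ (u , v , cut)) = ⊥-elim (no-cut (s≤s (s≤s (s≤s z≤n))) (λ e eq → excl (edge⁺ G eq) e) (Setting.connH st) u v cut)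
  where open Setting st
... | inj₂ (inj₂ (a , b , c , d , p)) = path⇒achieves G p

-- Infinite families close to the lower bounds

-- Unbounded order suffices: an isomorphism onto a listed graph would inject `Fin n` into a smaller
-- set.
infinitelyMany : ∀ {P : ∀ {n} → Graph n → Set} → (∀ N → ∃₂ λ n (G : Graph n) → N < n × P G) → InfinitelyMany P
infinitelyMany {P} big Hs =
  let n , G , N<n , p = big (maxOrder Hs) in n , G , p , larger {G = G} Hs N<n
  where
  maxOrder : List (∃ Graph) → ℕ
  maxOrder []             = 0
  maxOrder ((m , _) ∷ Hs) = m ⊔ maxOrder Hs
  larger : ∀ {n} {G : Graph n} Hs → maxOrder Hs < n → All (λ (_ , H) → ¬ (G ≅ H)) Hs
  larger []             _   = []
  larger {G = G} ((m , _) ∷ Hs) N<n =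
    (λ (φ , _) → <⇒notInjective (≤-<-trans (m≤m⊔n m (maxOrder Hs)) N<n)
       λ {x} {y} eq → trans (sym (Inverse.strictlyInverseʳ φ x)) (trans (cong (Inverse.from φ) eq) (Inverse.strictlyInverseʳ φ y)))
    ∷ larger {G = G} Hs (≤-<-trans (m≤n⊔m m (maxOrder Hs)) N<n)

module _ {n} (E : Fin n → Fin n → Bool) (E-irr : ∀ x → E x x ≡ false) where

  private
    A : Fin n → Fin n → Bool
    A x y = E x y ∨ E y x

  -- Only one orientation of each edge has to be listed in E.
  graph : Graph n
  graph = record
    { _~_    = λ x y → A x y ≡ true
    ; _~?_   = λ x y → A x y Bool.≟ true
    ; sym    = λ {x} {y} e → trans (Bool.∨-comm (E y x) (E x y)) e
    ; irrefl = λ { {x} refl e → case trans (sym e) (cong₂ _∨_ (E-irr x) (E-irr x)) of λ () }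
    }

connected : ∀ {n} (G : Graph n) r → (∀ u → Star (Graph._~_ G) u r) → Connected G
connected G r to u v = to u ◅◅ Star.reverse (Graph.sym G) (to v)

-- A triangle 0, 1, 2 with one pendant vertex at 0 and all others at 1. Vertices 0 and 1 meet every
-- edge, so they force the rest in one step; the triangle is independent in the complement, where n
-- - 3 vertices therefore suffice. From order 9 on, 3n - 9 is the larger term of the product bound
-- for `th₊`.
double-broom-edges : ∀ {i} → Fin (9 + i) → Fin (9 + i) → Bool
double-broom-edges 0F 1F = true
double-broom-edges 0F 2F = true
double-broom-edges 0F 3F = true
double-broom-edges 1F 2F = true
double-broom-edges 1F (suc (suc (suc (suc _)))) = true
double-broom-edges _  _  = false

double-broom : ∀ i → Graph (9 + i)
double-broom i = graph (double-broom-edges {i}) λ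
  { 0F → refl ; 1F → refl ; 2F → refl ; 3F → refl ; (suc (suc (suc (suc _)))) → refl }

double-broom-setting : ∀ i → Setting (double-broom i) (complement (double-broom i))
double-broom-setting i = setting (double-broom i) (m≤m+n 4 (5 + i)) (connected (double-broom i) 1F toG , connected (complement (double-broom i)) 3F toH)
  where
  _~_ = Graph._~_ (double-broom i)
  _≁_ = Graph._~_ (complement (double-broom i))
  toG : ∀ u → Star _~_ u 1F
  toG 0F = refl ◅ ε
  toG 1F = ε
  toG 2F = refl ◅ ε
  toG 3F = _◅_ {j = 0F} refl (refl ◅ ε)
  toG (suc (suc (suc (suc _)))) = refl ◅ ε
  toH : ∀ u → Star _≁_ u 3F
  toH 0F = _◅_ {j = 4F} ((λ ()) , λ ()) (((λ ()) , λ ()) ◅ ε)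
  toH 1F = ((λ ()) , λ ()) ◅ ε
  toH 2F = ((λ ()) , λ ()) ◅ ε
  toH 3F = ε
  toH (suc (suc (suc (suc _)))) = ((λ ()) , λ ()) ◅ ε

double-broom-achieves : ∀ i → Achieves (double-broom i) 2 1
double-broom-achieves i = subst (λ k → Achieves (double-broom i) k 1)
  (trans (cong (_∸ card (¬? ∘ B?)) (sym (card-compl B?))) (trans (m+n∸n≡m (card B?) (card (¬? ∘ B?))) (card-pair {9 + i} {0F} {1F} λ ())))
  (achieves-independent (double-broom i) (m≤m+n 2 (7 + i)) (Setting.connG (double-broom-setting i)) (¬? ∘ B?) (indep _ _))
  where
  B? : ∀ (u : Fin (9 + i)) → Dec (u ≡ 0F ⊎ u ≡ 1F)
  B? u = (u ≟ 0F) ⊎-dec (u ≟ 1F)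
  indep : ∀ u v → ¬ (u ≡ 0F ⊎ u ≡ 1F) → ¬ (v ≡ 0F ⊎ v ≡ 1F) → ¬ Graph._~_ (double-broom i) u v
  indep 0F v ¬u ¬v = ⊥-elim (¬u (inj₁ refl))
  indep 1F v ¬u ¬v = ⊥-elim (¬u (inj₂ refl))
  indep u 0F ¬u ¬v = ⊥-elim (¬v (inj₁ refl))
  indep u 1F ¬u ¬v = ⊥-elim (¬v (inj₂ refl))
  indep (suc (suc _)) (suc (suc _)) _ _ ()

double-broom-co-achieves : ∀ i → Achieves (complement (double-broom i)) (6 + i) 1
double-broom-co-achieves i = triple⇒achieves (Setting-sym (double-broom-setting i)) {0F} {1F} {2F}
  (λ ()) (λ ()) (λ ()) (λ (_ , ¬e) → ¬e refl) (λ (_ , ¬e) → ¬e refl) (λ (_ , ¬e) → ¬e refl)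

module DoubleBroom (i : ℕ) where
  private
    st = double-broom-setting i
  open DoubleBounds st

  a₊≡3 : a₊ ≡ 3
  a₊≡3 = ≤-antisym (Th₊.Optimum.least (opt₊ st) 2 1 (s≤s z≤n) (s≤s (s≤s z≤n)) (double-broom-achieves i)) 3≤a₊

  b₊≡7+i : b₊ ≡ 7 + i
  b₊≡7+i = ≤-antisym
    (≤-trans (Th₊.Optimum.least (opt₊ (Setting-sym st)) (6 + i) 1 (s≤s z≤n) (m≤n+m (6 + i) 3) (double-broom-co-achieves i))
      (≤-reflexive (+-comm (6 + i) 1)))
    (+-cancelˡ-≤ 3 _ _ (≤-trans n<sum₊ (≤-reflexive (cong (_+ b₊) a₊≡3))))

  a*≡2 : a* ≡ 2
  a*≡2 = ≤-antisym (Th*.Optimum.least (opt* st) 2 1 (s≤s z≤n) (s≤s (s≤s (s≤s z≤n))) (double-broom-achieves i)) 2≤a*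

  b*≡6+i : b* ≡ 6 + i
  b*≡6+i = ≤-antisym
    (≤-trans (Th*.Optimum.least (opt* (Setting-sym st)) (6 + i) 1 (s≤s z≤n) (m≤n+m (7 + i) 2) (double-broom-co-achieves i))
      (≤-reflexive (*-identityʳ (6 + i))))
    (+-cancelˡ-≤ 3 _ _ (≤-trans n≤sum* (≤-reflexive (trans (cong (λ a → a + b* + 1) a*≡2) (+-comm (2 + b*) 1)))))

-- A star with centre 0 and one edge subdivided by 2. The centre forces its neighbours and 2 then
-- forces 1, so `th₊×` has its least possible value 3. The product bound, valid from order 6 on,
-- pushes the value of the complement up to n.
broom-edges : ∀ {i} → Fin (6 + i) → Fin (6 + i) → Bool
broom-edges 0F (suc (suc _)) = true
broom-edges 1F 2F = true
broom-edges _  _  = false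

broom : ∀ i → Graph (6 + i)
broom i = graph (broom-edges {i}) λ { 0F → refl ; 1F → refl ; (suc (suc _)) → refl }

broom-setting : ∀ i → Setting (broom i) (complement (broom i))
broom-setting i = setting (broom i) (m≤m+n 4 (2 + i)) (connected (broom i) 0F toG , connected (complement (broom i)) 1F toH)
  where
  toG : ∀ u → Star (Graph._~_ (broom i)) u 0F
  toG 0F = ε
  toG 1F = _◅_ {j = 2F} refl (refl ◅ ε)
  toG (suc (suc _)) = refl ◅ ε
  toH : ∀ u → Star (Graph._~_ (complement (broom i))) u 1F
  toH 0F = ((λ ()) , λ ()) ◅ ε
  toH 1F = ε
  toH 2F = _◅_ {j = 3F} ((λ ()) , λ ()) (((λ ()) , λ ()) ◅ ε)
  toH (suc (suc (suc _))) = ((λ ()) , λ ()) ◅ ε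

broom-achieves : ∀ i → Achieves (broom i) 1 2
broom-achieves i = subst (λ k → Achieves (broom i) k 2) (card-singleton {6 + i} 0F) (achieves (broom i) (_≟ 0F) 2 fill)
  where
  G = broom i
  _~_ = Graph._~_ G
  leaf : ∀ {u v} → Reach G (_≡ 0F) (suc (suc u)) v → v ≡ suc (suc u) ⊎ v ≡ 1F ⊎ v ≡ 2F
  leaf-2 : ∀ {v} → Reach G (_≡ 0F) 2F v → v ≡ 2F ⊎ v ≡ 1F
  leaf-1 : ∀ {v} → Reach G (_≡ 0F) 1F v → v ≡ 2F ⊎ v ≡ 1F
  leaf-2 ε = inj₁ refl
  leaf-2 (_◅_ {j = 0F} (_ , ≢0 , _) _) = ⊥-elim (≢0 refl)
  leaf-2 (_◅_ {j = 1F} _ r) = leaf-1 r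
  leaf-2 (_◅_ {j = suc (suc _)} (_ , _ , ()) _)
  leaf-1 ε = inj₂ refl
  leaf-1 (_◅_ {j = 0F} (_ , ≢0 , _) _) = ⊥-elim (≢0 refl)
  leaf-1 (_◅_ {j = 1F} (_ , _ , ()) _)
  leaf-1 (_◅_ {j = 2F} _ r) = leaf-2 r
  leaf-1 (_◅_ {j = suc (suc (suc _))} (_ , _ , ()) _)
  leaf ε = inj₁ refl
  leaf (_◅_ {j = 0F} (_ , ≢0 , _) _) = ⊥-elim (≢0 refl)
  leaf (_◅_ {j = 1F} _ r) = inj₂ (Sum.swap (leaf-1 r))
  leaf (_◅_ {j = suc (suc _)} (_ , _ , ()) _)
  only : ∀ u v → ¬ v ≡ 0F → 0F ~ v → Reach G (_≡ 0F) (suc (suc u)) v → v ≡ suc (suc u)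
  only zero    v ≢0 e r with leaf-2 r
  ... | inj₁ eq   = eq
  ... | inj₂ refl = case e of λ ()
  only (suc u) v ≢0 e ε = refl
  only (suc u) v ≢0 e (_◅_ {j = 0F} (_ , ≢0′ , _) _) = ⊥-elim (≢0′ refl)
  only (suc u) v ≢0 e (_◅_ {j = 1F} (_ , _ , ()) _)
  only (suc u) v ≢0 e (_◅_ {j = suc (suc _)} (_ , _ , ()) _)
  first : ∀ u → _^[_] G (_≡ 0F) 1 (suc (suc u))
  first u = inj₂ (0F , forcing⇒forces G (refl , (λ ()) , refl , only u))
  fill-1 : Dec (_^[_] G (_≡ 0F) 1 1F) → _^[_] G (_≡ 0F) 2 1F
  fill-1 (yes f) = inj₁ f
  fill-1 (no ¬f) = inj₂ (2F , forcing⇒forces G (first zero , ¬f , refl , last))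
    where
    last : ∀ v → ¬ _^[_] G (_≡ 0F) 1 v → 2F ~ v → Reach G (_^[_] G (_≡ 0F) 1) 1F v → v ≡ 1F
    last 0F ¬f′ _ _ = ⊥-elim (¬f′ (inj₁ refl))
    last 1F _ _ _ = refl
    last (suc (suc v)) ¬f′ _ _ = ⊥-elim (¬f′ (first v))
  fill : ∀ u → _^[_] G (_≡ 0F) 2 u
  fill 0F = inj₁ (inj₁ refl)
  fill 1F = fill-1 (filled? G (_≟ 0F) 1 1F)
  fill (suc (suc u)) = inj₁ (first u)

module Broom (i : ℕ) where
  private
    st = broom-setting i
  open DoubleBounds st

  a×≡3 : a× ≡ 3
  a×≡3 = ≤-antisym (Th×.Optimum.least (opt× st) 1 2 (s≤s z≤n) (s≤s z≤n) (broom-achieves i)) 3≤a×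

  b×≡n : b× ≡ 6 + i
  b×≡n = ≤-antisym b×≤n (*-cancelˡ-≤ 3 (≤-trans (product×-bound pair× (m≤m+n 6 i)) (≤-reflexive (cong (_* b×) a×≡3))))

-- Forcing sets and bipartite holes

-- Two disjoint vertex sets of size at least s without edges between them are known as a bipartite
-- hole; their absence in the complement says that G has no complete bipartite pair of that size.
NoBihole : ∀ {n} → ℕ → Graph n → Set₁
NoBihole {n} s G = ∀ {P Q : Pred (Fin n) 0ℓ} (P? : Decidable P) (Q? : Decidable Q) →
  (∀ x → P x → ¬ Q x) → (∀ u v → P u → Q v → ¬ Graph._~_ G u v) → card P? < s ⊎ card Q? < s

-- When exactly 3s vertices are unfilled, all components of the unfilled part have
-- fewer than s vertices, since at least s filled vertices lie off their boundary.
-- Hence some union of components has between s and 2s vertices.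
module _ {n k s} {G : Graph n} (1≤s : 1 ≤ s) (none : NoBihole s G) (F : Filling G k) where
  open Graph G using (_~_)
  open Filling F

  private
    3s : ℕ
    3s = s + s + s

    -- Each stage fills a single vertex, so the number of unfilled vertices cannot jump over 3s.
    stage-3s : ∀ fuel i → card (unfilled? F i) ≤ fuel → 3s ≤ card (unfilled? F i) → ∃[ j ] card (unfilled? F j) ≡ 3s
    stage-3s fuel i le ge with card (unfilled? F i) ℕ.≟ 3s
    ... | yes eq = i , eq
    ... | no ≢3s with any? (unfilled? F i)
    ...   | no all = ⊥-elim (<⇒≱ 1≤s (≤-trans (≤-trans (m≤n+m s (s + s)) ge) (≤-reflexive (card-none (unfilled? F i) λ x x∉ → all (x , x∉)))))
    stage-3s zero i le ge | no _ | yes (x , x∉) = case ≤-trans (card-pos (unfilled? F i) x x∉) le of λ ()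
    stage-3s (suc fuel) i le ge | no ≢3s | yes (x , x∉) =
      stage-3s fuel (suc i) (≤-pred (≤-trans (shrinks F i x∉) le)) (≤-pred (≤-trans (≤∧≢⇒< ge (≢3s ∘ sym)) (slow-shrink (adds i x∉))))
      where
      slow-shrink : ∃[ w ] (w ∉ stage i × w ∈ stage (suc i) × (∀ {y} → y ∈ stage (suc i) → y ∈ stage i ⊎ y ≡ w)) →
                    card (unfilled? F i) ≤ suc (card (unfilled? F (suc i)))
      slow-shrink (w , _ , _ , split) = ≤-trans (card-⊎ (_≟ w) (unfilled? F (suc i)) (unfilled? F i) cov)
        (≤-reflexive (cong (_+ card (unfilled? F (suc i))) (card-singleton w)))
        where
        cov : ∀ y → y ∉ stage i → y ≡ w ⊎ y ∉ stage (suc i)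
        cov y y∉ with y ∈? stage (suc i)
        ... | no y∉′ = inj₂ y∉′
        ... | yes y∈ = inj₁ ([ (λ y∈′ → ⊥-elim (y∉ y∈′)) , id ]′ (split y∈))

    module AtStage (i : ℕ) (∣U∣ : card (unfilled? F i) ≡ 3s) (large : k + 4 * s ≤ n) where
      S : Fin n → Set
      S = _∈ stage i
      S? : Decidable S
      S? = _∈? stage i

      k+s≤∣S∣ : k + s ≤ card S?
      k+s≤∣S∣ = +-cancelʳ-≤ 3s (k + s) (card S?) (begin
        k + s + 3s                     ≡⟨ eq k s ⟩
        k + 4 * s                      ≤⟨ large ⟩
        n                              ≡⟨ card-compl S? ⟨
        card S? + card (unfilled? F i) ≡⟨ cong (card S? +_) ∣U∣ ⟩
        card S? + 3s                   ∎)
        where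
        open ≤-Reasoning
        eq : ∀ k s → k + s + (s + s + s) ≡ k + 4 * s
        eq = solve-∀

      small : ∀ {b} → ¬ S b → card (reach? G S? b) < s
      small {b} ¬Sb = [ id , (λ lt → ⊥-elim (<⇒≱ lt s≤∣Z∣)) ]′ (none (reach? G S? b) Z?
          (λ x r (Sx , _) → reach-unfilled G ¬Sb r Sx) (λ u v r (_ , far) e → far (u , r , inj₂ e)))
        where
        Z? : Decidable (λ z → S z × ¬ Near G S b z)
        Z? z = S? z ×-dec ¬? (near? G S? b z)
        cov : ∀ z → S z → Boundary G S b z ⊎ (S z × ¬ Near G S b z)
        cov z Sz with near? G S? b z
        ... | yes near = inj₁ (Sz , near)
        ... | no far   = inj₂ (Sz , far)
        s≤∣Z∣ : s ≤ card Z?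
        s≤∣Z∣ = +-cancelˡ-≤ k s (card Z?) (≤-trans k+s≤∣S∣
          (≤-trans (card-⊎ (boundary? G S? b) Z? S? cov) (+-monoˡ-≤ (card Z?) (boundary i ¬Sb))))

      -- The components that meet the first `j` vertices. Raising `j` by one adds at most one
      -- component, and this has fewer than s vertices, so the size of the union cannot jump over
      -- the interval from s to 2s.
      X : ℕ → Fin n → Set
      X j u = ∃[ c ] (toℕ c < j × ¬ S c × Reach G S c u)

      X? : ∀ j → Decidable (X j)
      X? j u = any? λ c → (toℕ c <? j) ×-dec ¬? (S? c) ×-dec reach? G S? c u

      X-step : ∀ j → card (X? (suc j)) < card (X? j) + s
      X-step j with any? (λ c → (toℕ c ℕ.≟ j) ×-dec ¬? (S? c))
      ... | yes (c , c≡j , ¬Sc) = ≤-<-trans (card-⊎ (X? j) (reach? G S? c) (X? (suc j)) cov) (+-monoʳ-< (card (X? j)) (small ¬Sc))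
        where
        cov : ∀ u → X (suc j) u → X j u ⊎ Reach G S c u
        cov u (d , d≤j , ¬Sd , r) with m≤n⇒m<n∨m≡n (≤-pred d≤j)
        ... | inj₁ d<j = inj₁ (d , d<j , ¬Sd , r)
        ... | inj₂ d≡j = inj₂ (subst (λ d → Reach G S d u) (toℕ-injective (trans d≡j (sym c≡j))) r)
      ... | no filled = ≤-<-trans (card-mono (X? (suc j)) (X? j) sub) (≤-trans (≤-reflexive (+-comm 1 _)) (+-monoʳ-≤ (card (X? j)) 1≤s))
        where
        sub : ∀ u → X (suc j) u → X j u
        sub u (d , d≤j , ¬Sd , r) with m≤n⇒m<n∨m≡n (≤-pred d≤j)
        ... | inj₁ d<j = d , d<j , ¬Sd , r
        ... | inj₂ d≡j = ⊥-elim (filled (d , d≡j , ¬Sd))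

      balanced : ∀ j → card (X? j) < s ⊎ ∃[ j ] (s ≤ card (X? j) × card (X? j) < s + s)
      balanced zero = inj₁ (≤-trans (s≤s (≤-reflexive (card-none (X? 0) λ { _ (_ , () , _) }))) 1≤s)
      balanced (suc j) with balanced j
      ... | inj₂ found = inj₂ found
      ... | inj₁ lt with card (X? (suc j)) <? s
      ...   | yes lt′ = inj₁ lt′
      ...   | no ge   = inj₂ (suc j , ≮⇒≥ ge , <-trans (X-step j) (+-monoˡ-< s lt))

      impossible : ⊥
      impossible with balanced n
      ... | inj₁ lt = <⇒≱ lt (≤-trans (≤-trans (m≤n+m s (s + s)) (≤-reflexive (sym ∣U∣)))
                        (card-mono (unfilled? F i) (X? n) λ u u∉ → u , toℕ<n u , u∉ , ε))
      ... | inj₂ (j , ge , lt) = [ (λ lt′ → <⇒≱ lt′ ge) , (λ lt′ → <⇒≱ lt′ s≤∣Y∣) ]′ (none (X? j) Y?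
            (λ u Xu (_ , ¬Xu) → ¬Xu Xu)
            (λ { u v (c , c<j , ¬Sc , r) (¬Sv , ¬Xv) e → ¬Xv (c , c<j , ¬Sc , reach-edge G ¬Sc r e ¬Sv) }))
        where
        Y? : Decidable (λ u → ¬ S u × ¬ X j u)
        Y? u = ¬? (S? u) ×-dec ¬? (X? j u)
        cov : ∀ u → ¬ S u → X j u ⊎ (¬ S u × ¬ X j u)
        cov u ¬Su with X? j u
        ... | yes Xu = inj₁ Xu
        ... | no ¬Xu = inj₂ (¬Su , ¬Xu)
        s≤∣Y∣ : s ≤ card Y?
        s≤∣Y∣ = +-cancelˡ-≤ (s + s) s (card Y?) (≤-trans (≤-reflexive (sym ∣U∣))
          (≤-trans (card-⊎ (X? j) Y? (unfilled? F i) cov) (+-monoˡ-≤ (card Y?) (<⇒≤ lt))))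

  -- The 4s is made of 3s unfilled vertices and s filled ones in excess of the `k` that a boundary
  -- can hold.
  bihole-bound : n < k + 4 * s
  bihole-bound = ≰⇒> λ large →
    let i , ∣U∣ = stage-3s _ 0 ≤-refl (start large) in AtStage.impossible i ∣U∣ large
    where
    start : k + 4 * s ≤ n → 3s ≤ card (unfilled? F 0)
    start large = +-cancelˡ-≤ k _ _ (begin
      k + 3s                                      ≤⟨ +-monoʳ-≤ k (≤-trans (m≤n+m 3s s) (≤-reflexive (eq s))) ⟩
      k + 4 * s                                   ≤⟨ large ⟩
      n                                           ≡⟨ card-compl (_∈? stage 0) ⟨
      card (_∈? stage 0) + card (unfilled? F 0)   ≡⟨ cong (_+ card (unfilled? F 0)) size ⟩
      k + card (unfilled? F 0)                    ∎)
      where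
      open ≤-Reasoning
      eq : ∀ s → s + (s + s + s) ≡ 4 * s
      eq = solve-∀

-- Inner product graphs

_∙_ : ∀ {d} → Vec Bool d → Vec Bool d → Bool
[]      ∙ []      = false
(x ∷ u) ∙ (y ∷ v) = (x ∧ y) xor (u ∙ v)

∙-comm : ∀ {d} (u v : Vec Bool d) → u ∙ v ≡ v ∙ u
∙-comm []      []      = refl
∙-comm (x ∷ u) (y ∷ v) = cong₂ _xor_ (Bool.∧-comm x y) (∙-comm u v)

card-≤1 : ∀ {n} {P : Pred (Fin n) 0ℓ} (P? : Decidable P) → (∀ {x y} → P x → P y → x ≡ y) → card P? ≤ 1
card-≤1 P? unique with any? P?
... | no none     = ≤-trans (≤-reflexive (card-none P? λ x p → none (x , p))) z≤n
... | yes (y , q) = ≤-trans (card-mono P? (_≟ y) λ x p → unique p q) (≤-reflexive (card-singleton y))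

xor-cancel : ∀ x y w → x xor y ≡ w → y ≡ w xor x
xor-cancel false y _ refl = sym (Bool.xor-identityʳ y)
xor-cancel true  false _ refl = refl
xor-cancel true  true  _ refl = refl

∷-head-tail : ∀ {d} (u v : Vec Bool (suc d)) → Vec.head u ≡ Vec.head v → Vec.tail u ≡ Vec.tail v → u ≡ v
∷-head-tail (_ ∷ _) (_ ∷ _) refl refl = refl

∙-head-tail : ∀ {d} (u v : Vec Bool (suc d)) → u ∙ v ≡ (Vec.head u ∧ Vec.head v) xor (Vec.tail u ∙ Vec.tail v)
∙-head-tail (_ ∷ _) (_ ∷ _) = refl

xor-shift : ∀ w x y → (w xor x) xor (w xor y) ≡ x xor y
xor-shift false x     y     = refl
xor-shift true  false false = refl
xor-shift true  false true  = refl
xor-shift true  true  false = refl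
xor-shift true  true  true  = refl

-- If the inner product splits as f + g on A × B, then |A| |B| ≤ 2 ^ d.  Either
-- the tails of the codes of B are distinct, and A may be cut in two by the first
-- bit; or two elements of B differ in the first bit only, which fixes the first
-- bit on A, and the tails of the codes of A are distinct.
Splits : ∀ {m d} (A B : Pred (Fin m) 0ℓ) (code : Fin m → Vec Bool d) → Set
Splits {m} A B code = ∃₂ λ (f g : Fin m → Bool) → ∀ {a b} → A a → B b → code a ∙ code b ≡ f a xor g b

InjectiveOn : ∀ {m} {X : Set} → Pred (Fin m) 0ℓ → (Fin m → X) → Set
InjectiveOn A code = ∀ {x y} → A x → A y → code x ≡ code y → x ≡ y

SplitBound : ℕ → Set₁
SplitBound d = ∀ {m} {A B : Pred (Fin m) 0ℓ} (A? : Decidable A) (B? : Decidable B) (code : Fin m → Vec Bool d) →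
  InjectiveOn A code → InjectiveOn B code → Splits A B code → card A? * card B? ≤ 2 ^ d

-- On the half of `A` with first bit `c`, the contribution of the first bits is `c ∧ head b`, which
-- depends on `b` alone and is absorbed into `g`. This is why the induction is about split products
-- and not only constant ones.
split-step : ∀ {d} → SplitBound d → ∀ {m} {A B : Pred (Fin m) 0ℓ} (A? : Decidable A) (B? : Decidable B)
  (code : Fin m → Vec Bool (suc d)) → InjectiveOn A code → InjectiveOn B (Vec.tail ∘ code) →
  Splits A B code → card A? * card B? ≤ 2 ^ suc d
split-step {d} ih {m} {A} {B} A? B? code injA injB (f , g , splits) = begin
  card A? * card B?                                      ≤⟨ *-monoˡ-≤ (card B?) (card-⊎ (half? false) (half? true) A? cov) ⟩
  (card (half? false) + card (half? true)) * card B?     ≡⟨ *-distribʳ-+ (card B?) (card (half? false)) (card (half? true)) ⟩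
  card (half? false) * card B? + card (half? true) * card B?
                                                         ≤⟨ +-mono-≤ (bound false) (bound true) ⟩
  2 ^ d + 2 ^ d                                          ≡⟨ cong (2 ^ d +_) (sym (+-identityʳ (2 ^ d))) ⟩
  2 ^ suc d                                              ∎
  where
  open ≤-Reasoning
  head = Vec.head ∘ code
  half? : ∀ c → Decidable (λ a → A a × head a ≡ c)
  half? c a = A? a ×-dec (head a Bool.≟ c)
  cov : ∀ a → A a → (A a × head a ≡ false) ⊎ (A a × head a ≡ true)
  cov a Aa with head a
  ... | false = inj₁ (Aa , refl)
  ... | true  = inj₂ (Aa , refl)
  bound : ∀ c → card (half? c) * card B? ≤ 2 ^ d
  bound c = ih (half? c) B? (Vec.tail ∘ code)
    (λ (Ax , x≡c) (Ay , y≡c) eq → injA Ax Ay (∷-head-tail _ _ (trans x≡c (sym y≡c)) eq)) injB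
    (f , (λ b → g b xor (c ∧ head b)) , λ { {a} {b} (Aa , refl) Bb →
      trans (xor-cancel (head a ∧ head b) _ (f a xor g b) (trans (sym (∙-head-tail (code a) (code b))) (splits Aa Bb)))
            (Bool.xor-assoc (f a) (g b) (head a ∧ head b)) })

split-bound : ∀ d → SplitBound d
split-bound zero A? B? code injA injB _ = *-mono-≤ (card-≤1 A? λ p q → injA p q (Vec-0 _ _)) (card-≤1 B? λ p q → injB p q (Vec-0 _ _))
  where
  Vec-0 : ∀ (u v : Vec Bool 0) → u ≡ v
  Vec-0 [] [] = refl
split-bound (suc d) {m} {A} {B} A? B? code injA injB (f , g , splits)
  with any? (λ x → any? λ y → B? x ×-dec B? y ×-dec ¬? (x ≟ y) ×-dec ≡-dec Bool._≟_ (Vec.tail (code x)) (Vec.tail (code y)))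
... | no distinct = split-step (split-bound d) A? B? code injA
        (λ {x} {y} Bx By eq → decidable-stable (x ≟ y) λ x≢y → distinct (x , y , Bx , By , x≢y , eq)) (f , g , splits)
... | yes (x , y , Bx , By , x≢y , tails) = ≤-trans (≤-reflexive (*-comm (card A?) (card B?)))
        (split-step (split-bound d) B? A? code injB injA-tail
          (g , f , λ {b} {a} Bb Aa → trans (∙-comm (code b) (code a)) (trans (splits Aa Bb) (Bool.xor-comm (f a) (g b)))))
  where
  head = Vec.head ∘ code
  tail = Vec.tail ∘ code
  fixed : ∀ {x y} → B x → B y → head x ≡ true → head y ≡ false → tail x ≡ tail y →
          ∀ {a} → A a → head a ≡ g x xor g y
  fixed {x} {y} Bx By x≡true y≡false eq {a} Aa =
    trans (xor-cancel D (head a) (f a xor g x) (trans (Bool.xor-comm D (head a)) at-x))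
          (trans (cong ((f a xor g x) xor_) at-y) (xor-shift (f a) (g x) (g y)))
    where
    D = tail a ∙ tail x
    at-x : head a xor D ≡ f a xor g x
    at-x = trans (cong (_xor D) (sym (trans (cong (head a ∧_) x≡true) (Bool.∧-identityʳ (head a)))))
      (trans (sym (∙-head-tail (code a) (code x))) (splits Aa Bx))
    at-y : D ≡ f a xor g y
    at-y = trans (cong (tail a ∙_) eq)
      (trans (cong (_xor (tail a ∙ tail y)) (sym (trans (cong (head a ∧_) y≡false) (Bool.∧-zeroʳ (head a)))))
        (trans (sym (∙-head-tail (code a) (code y))) (splits Aa By)))
  constant : ∀ c d → head x ≡ c → head y ≡ d → ∃[ h ] (∀ {a} → A a → head a ≡ h)
  constant false false p q = ⊥-elim (x≢y (injB Bx By (∷-head-tail (code x) (code y) (trans p (sym q)) tails)))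
  constant true  true  p q = ⊥-elim (x≢y (injB Bx By (∷-head-tail (code x) (code y) (trans p (sym q)) tails)))
  constant true  false p q = g x xor g y , fixed Bx By p q tails
  constant false true  p q = g y xor g x , fixed By Bx q p (sym tails)
  injA-tail : InjectiveOn A (Vec.tail ∘ code)
  injA-tail Aa Ab eq = let h , const = constant (head x) (head y) refl refl in
    injA Aa Ab (∷-head-tail _ _ (trans (const Aa) (sym (const Ab))) eq)

odd : ℕ → Bool
odd 0             = false
odd 1             = true
odd (suc (suc x)) = odd x

binary : ∀ d → ℕ → Vec Bool d
binary zero    x = []
binary (suc d) x = odd x ∷ binary d ⌊ x /2⌋

odd-half-injective : ∀ x y → odd x ≡ odd y → ⌊ x /2⌋ ≡ ⌊ y /2⌋ → x ≡ y
odd-half-injective 0 0 _ _ = refl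
odd-half-injective 0 (suc (suc y)) _ ()
odd-half-injective 1 1 _ _ = refl
odd-half-injective 1 (suc (suc y)) _ ()
odd-half-injective (suc (suc x)) 0 _ ()
odd-half-injective (suc (suc x)) 1 _ ()
odd-half-injective (suc (suc x)) (suc (suc y)) p q = cong (2 +_) (odd-half-injective x y p (ℕ.suc-injective q))

⌊x/2⌋<m : ∀ {x m} → x < m + (m + 0) → ⌊ x /2⌋ < m
⌊x/2⌋<m {x} {m} x<2m = ≰⇒> λ m≤ → <⇒≱ x<2m (begin
  m + (m + 0)            ≡⟨ cong (m +_) (+-identityʳ m) ⟩
  m + m                  ≤⟨ +-mono-≤ m≤ (≤-trans m≤ (⌊n/2⌋≤⌈n/2⌉ x)) ⟩
  ⌊ x /2⌋ + ⌈ x /2⌉      ≡⟨ ⌊n/2⌋+⌈n/2⌉≡n x ⟩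
  x                      ∎)
  where open ≤-Reasoning

binary-injective : ∀ d {x y} → x < 2 ^ d → y < 2 ^ d → binary d x ≡ binary d y → x ≡ y
binary-injective zero    (s≤s z≤n) (s≤s z≤n) _ = refl
binary-injective (suc d) {x} {y} x< y< eq = odd-half-injective x y (proj₁ (Vec.∷-injective eq))
  (binary-injective d (⌊x/2⌋<m x<) (⌊x/2⌋<m y<) (proj₂ (Vec.∷-injective eq)))

-- The lower estimate leaves room for distinct codes of `suc j` vertices; the upper one turns the
-- bound 2 ^ d on a product of sizes into one that is linear in the number of vertices.
power-of-2-between : ∀ j → ∃[ d ] (suc j ≤ 2 ^ d × 2 ^ d ≤ 2 * suc j)
power-of-2-between zero    = 0 , s≤s z≤n , s≤s z≤n
power-of-2-between (suc j) with power-of-2-between j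
... | d , le , ge with suc (suc j) ≤? 2 ^ d
...   | yes le′ = d , le′ , ≤-trans ge (*-monoʳ-≤ 2 (n≤1+n (suc j)))
...   | no gt   = suc d , ≤-trans (+-monoʳ-≤ 1 (m≤n+m (suc j) j)) (≤-trans (≤-reflexive (eq j)) (*-monoʳ-≤ 2 le)) ,
                  *-monoʳ-≤ 2 (≤-trans (≤-pred (≰⇒> gt)) (n≤1+n (suc j)))
  where
  eq : ∀ j → 1 + (j + suc j) ≡ 2 * suc j
  eq = solve-∀

module InnerProduct (j : ℕ) where

  dim : ℕ
  dim = proj₁ (power-of-2-between j)

  code : Fin (suc j) → Vec Bool dim
  code i = binary dim (toℕ i)

  code-injective : ∀ {x y} → code x ≡ code y → x ≡ y
  code-injective {x} {y} eq = toℕ-injective (binary-injective dim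
    (<-≤-trans (toℕ<n x) (proj₁ (proj₂ (power-of-2-between j))))
    (<-≤-trans (toℕ<n y) (proj₁ (proj₂ (power-of-2-between j)))) eq)

  -- The inner product graph may be disconnected, as the zero code is orthogonal to everything. The
  -- three extra vertices connect both the graph and its complement, whatever the block looks like.
  -- The factor with `does` removes loops at codes of odd weight.
  edges : Fin (4 + j) → Fin (4 + j) → Bool
  edges 0F (suc (suc (suc _))) = true
  edges 1F 2F = true
  edges 1F (suc (suc (suc _))) = true
  edges (suc (suc (suc i))) (suc (suc (suc k))) = not (does (i ≟ k)) ∧ (code i ∙ code k)
  edges _ _ = false

  edges-irr : ∀ x → edges x x ≡ false
  edges-irr 0F = refl
  edges-irr 1F = refl
  edges-irr 2F = refl
  edges-irr (suc (suc (suc i))) with i ≟ i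
  ... | yes _ = refl
  ... | no ¬p = ⊥-elim (¬p refl)

  -- A path 0 – b – 1 – 2 with b blown up to the inner product graph.
  G H : Graph (4 + j)
  G = graph edges edges-irr
  H = complement G

  isSetting : Setting G H
  isSetting = setting G (m≤m+n 4 j) (connected G 1F toG , connected H 2F toH)
    where
    toG : ∀ u → Star (Graph._~_ G) u 1F
    toG 0F = _◅_ {j = 3F} refl (refl ◅ ε)
    toG 1F = ε
    toG 2F = refl ◅ ε
    toG (suc (suc (suc _))) = refl ◅ ε
    toH : ∀ u → Star (Graph._~_ H) u 2F
    toH 0F = ((λ ()) , λ ()) ◅ ε
    toH 1F = _◅_ {j = 0F} ((λ ()) , λ ()) (((λ ()) , λ ()) ◅ ε)
    toH 2F = ε
    toH (suc (suc (suc _))) = ((λ ()) , λ ()) ◅ ε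

  block-edge : ∀ {i k} → i ≢ k → edges (suc (suc (suc i))) (suc (suc (suc k))) ∨ edges (suc (suc (suc k))) (suc (suc (suc i))) ≡ code i ∙ code k
  block-edge {i} {k} i≢k with i ≟ k | k ≟ i
  ... | yes eq | _      = ⊥-elim (i≢k eq)
  ... | no _   | yes eq = ⊥-elim (i≢k (sym eq))
  ... | no _   | no _   = trans (cong ((code i ∙ code k) ∨_) (∙-comm (code k) (code i))) (Bool.∨-idem (code i ∙ code k))

  block : Fin (suc j) → Fin (4 + j)
  block i = suc (suc (suc i))

  if-≤1 : ∀ b → (if b then 1 else 0) ≤ 1
  if-≤1 true  = s≤s z≤n
  if-≤1 false = z≤n

  card-block : ∀ {P : Pred (Fin (4 + j)) 0ℓ} (P? : Decidable P) → card P? ≤ 3 + card (P? ∘ block)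
  card-block P? = +-mono-≤ (if-≤1 (does (P? 0F))) (+-mono-≤ (if-≤1 (does (P? 1F))) (+-mono-≤ (if-≤1 (does (P? 2F))) ≤-refl))

  -- A constant product is split with f = c and g = 0. The value `false` corresponds to holes of
  -- `G`, `true` to holes of `H`; the 3 allows for the vertices outside the block.
  no-homogeneous : ∀ c t → 2 * suc j < t * t → ∀ {P Q : Pred (Fin (4 + j)) 0ℓ} (P? : Decidable P) (Q? : Decidable Q) →
    (∀ i k → P (block i) → Q (block k) → code i ∙ code k ≡ c) → card P? < 3 + t ⊎ card Q? < 3 + t
  no-homogeneous c t 2m<t² P? Q? hom with card (P? ∘ block) <? t | card (Q? ∘ block) <? t
  ... | yes lt | _      = inj₁ (≤-<-trans (card-block P?) (+-monoʳ-< 3 lt))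
  ... | no _   | yes lt = inj₂ (≤-<-trans (card-block Q?) (+-monoʳ-< 3 lt))
  ... | no p   | no q   = ⊥-elim (<⇒≱ 2m<t² (≤-trans (*-mono-≤ (≮⇒≥ p) (≮⇒≥ q)) (≤-trans
          (split-bound dim (P? ∘ block) (Q? ∘ block) code (λ _ _ → code-injective) (λ _ _ → code-injective)
            ((λ _ → c) , (λ _ → false) , λ Pi Qk → trans (hom _ _ Pi Qk) (sym (Bool.xor-identityʳ c))))
          (proj₂ (proj₂ (power-of-2-between j))))))

  noBihole-G : ∀ t → 2 * suc j < t * t → NoBihole (3 + t) G
  noBihole-G t lt P? Q? dis none = no-homogeneous false t lt P? Q? λ i k Pi Qk →
    trans (sym (block-edge (λ { refl → dis _ Pi Qk }))) (Bool.¬-not (none _ _ Pi Qk))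

  noBihole-H : ∀ t → 2 * suc j < t * t → NoBihole (3 + t) H
  noBihole-H t lt P? Q? dis none = no-homogeneous true t lt P? Q? λ i k Pi Qk →
    trans (sym (block-edge (λ { refl → dis _ Pi Qk })))
      (decidable-stable (_ Bool.≟ true) λ ne → none _ _ Pi Qk ((λ { refl → dis _ Pi Qk }) , ne))

-- Tightness and sharpness of the upper bounds

module Large {n} {G H : Graph n} (st : Setting G H) {s} (1≤s : 1 ≤ s) (none : NoBihole s G) where
  open Setting st using (4≤n)
  open Bounds st

  n<a₊+4s : n < a₊ + 4 * s
  n<a₊+4s = ≤-trans (bihole-bound 1≤s none (filling G {t = Th₊.Optimum.time o} (Th₊.Optimum.achieved o)))
    (+-monoˡ-≤ (4 * s) (m≤m+n (Th₊.Optimum.size o) (Th₊.Optimum.time o)))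
    where o = opt₊ st

  n<a*+4s : n < a* + 4 * s
  n<a*+4s = ≤-trans (bihole-bound 1≤s none (filling G {t = Th*.Optimum.time o} (Th*.Optimum.achieved o)))
    (+-monoˡ-≤ (4 * s) (shape-elim (λ k t → k < n → k ≤ k * t)
      (λ n<n → ⊥-elim (<-irrefl refl n<n)) (λ x _ → m≤m*n (suc (suc x)) 1) (λ x i _ → m≤m*n (suc x) (suc (suc i)))
      (shape {t = Th*.Optimum.time o} st (Th*.Optimum.1≤size o) (Th*.Optimum.achieved o)) (Th*.Optimum.inRange o)))
    where o = opt* st

  -- A set with positive time has more than n - 4s ≥ n / 2 vertices, and the factor 1 + t is at
  -- least 2, so it costs at least n, as much as filling everything at once.
  a×≡n : 8 * s ≤ n → a× ≡ n
  a×≡n 8s≤n = ≤-antisym a×≤n (shape-elim (λ k t → n < k + 4 * s → n ≤ k * (1 + t))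
      (λ _ → ≤-reflexive (sym (*-identityʳ n)))
      (λ x h → half (suc (suc x)) 0 h) (λ x i h → half (suc x) (suc i) h)
      (shape {t = Th×.Optimum.time o} st (Th×.Optimum.1≤size o) (Th×.Optimum.achieved o))
      (bihole-bound 1≤s none (filling G {t = Th×.Optimum.time o} (Th×.Optimum.achieved o))))
    where
    o = opt× st
    half : ∀ k i → n < k + 4 * s → n ≤ k * (1 + suc i)
    half k i h = ≤-trans (+-cancelʳ-≤ n n (k + k) (begin
      n + n                       ≤⟨ +-mono-≤ (<⇒≤ h) (<⇒≤ h) ⟩
      (k + 4 * s) + (k + 4 * s)   ≡⟨ eq k s ⟩
      (k + k) + 8 * s             ≤⟨ +-monoʳ-≤ (k + k) 8s≤n ⟩
      (k + k) + n                 ∎)) (≤-trans (≤-reflexive (eq₂ k)) (*-monoʳ-≤ k (s≤s (s≤s z≤n))))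
      where
      open ≤-Reasoning
      eq : ∀ k s → (k + 4 * s) + (k + 4 * s) ≡ (k + k) + 8 * s
      eq = solve-∀
      eq₂ : ∀ k → k + k ≡ k * 2
      eq₂ = solve-∀

-- Take t = ⌊m / L⌋ with L = 2 K + 1.
square-root-gap : ∀ K → ∃[ N ] ∀ j → N ≤ j → ∃[ t ] (2 * suc j < t * t × K * (3 + t) < 4 + j)
-- This threshold forces t ≥ 3 + 2L, whence t² ≥ (1 + 2L) t ≥ 2 (1 + t) L > 2m. The choice of L
-- gives K (3 + t) ≤ 2 K t ≤ t L ≤ m.
square-root-gap K = (3 + 2 * L) * L , λ j N≤j →
  let m = suc j
      t = m / L
      m<[t+1]L : m < (1 + t) * L
      m<[t+1]L = ≤-trans (s≤s (≤-reflexive (m≡m%n+[m/n]*n m L))) (+-monoˡ-≤ (t * L) (m%n<n m L))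
      3+2L≤t : 3 + 2 * L ≤ t
      3+2L≤t = ≮⇒≥ λ t< → <⇒≱ m<[t+1]L (≤-trans (*-monoˡ-≤ L t<) (m≤n⇒m≤1+n N≤j))
  in t , square m t m<[t+1]L 3+2L≤t , linear j t (≤-trans (m/n*n≤m m L) ≤-refl) (≤-trans (m≤m+n 3 (2 * L)) 3+2L≤t)
  where
  open ≤-Reasoning
  L = suc (2 * K)
  eq₁ : ∀ t L → 2 * ((1 + t) * L) ≡ 2 * L * t + 2 * L
  eq₁ = solve-∀
  eq₂ : ∀ t L → 2 * L * t + t ≡ (1 + 2 * L) * t
  eq₂ = solve-∀
  square : ∀ m t → m < (1 + t) * L → 3 + 2 * L ≤ t → 2 * m < t * t
  square m t m< le = begin-strict
    2 * m                 <⟨ *-monoʳ-< 2 m< ⟩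
    2 * ((1 + t) * L)     ≡⟨ eq₁ t L ⟩
    2 * L * t + 2 * L     ≤⟨ +-monoʳ-≤ (2 * L * t) (≤-trans (m≤n+m (2 * L) 3) le) ⟩
    2 * L * t + t         ≡⟨ eq₂ t L ⟩
    (1 + 2 * L) * t       ≤⟨ *-monoˡ-≤ t (≤-trans (m≤n+m (1 + 2 * L) 2) le) ⟩
    t * t                 ∎
  eq₃ : ∀ K t → K * (t + t) + t ≡ t * suc (2 * K)
  eq₃ = solve-∀
  linear : ∀ j t → t * L ≤ suc j → 3 ≤ t → K * (3 + t) < 4 + j
  linear j t tL≤m 3≤t = begin-strict
    K * (3 + t)           ≤⟨ *-monoʳ-≤ K (+-monoˡ-≤ t 3≤t) ⟩
    K * (t + t)           ≤⟨ m≤m+n (K * (t + t)) t ⟩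
    K * (t + t) + t       ≡⟨ eq₃ K t ⟩
    t * L                 ≤⟨ tL≤m ⟩
    suc j                 <⟨ m≤n+m (2 + j) 2 ⟩
    4 + j                 ∎

module _ where
  open InnerProduct

  eventually : ∀ K → ∃[ N ] ∀ j → N ≤ j → ∃[ s ] (1 ≤ s × NoBihole s (G j) × NoBihole s (H j) × K * (8 * s) < 4 + j)
  eventually K = let N , f = square-root-gap (K * 8) in N , λ j N≤j →
    let t , square , linear = f j N≤j in
    3 + t , s≤s z≤n , (λ {P} {Q} → noBihole-G j t square {P} {Q}) , (λ {P} {Q} → noBihole-H j t square {P} {Q}) ,
    ≤-trans (s≤s (≤-reflexive (sym (*-assoc K 8 (3 + t))))) linear

  connectedBoth : ∀ j → BothConnected (G j)
  connectedBoth j = Setting.connG (isSetting j) , Setting.connH (isSetting j)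

  -- The o-term is the exact difference between the bound and the value, which is possible because
  -- the family has one graph of every order from 4 on.
  tight : (Q : Quantity) (b g v : ℕ → ℕ) → (∀ n → 1 ≤ n → 0 < g n) → (∀ j → Q (G j) (v j)) → (∀ j → v j < b (4 + j)) →
          (∀ K → ∃[ N ] ∀ j → N ≤ j → K * (b (4 + j) ∸ v j) < g (4 + j)) → Tight-o Q b g
  tight Q b g v g-pos isQ v<b small = ι ∘ gap , littleO gap g (λ n 1≤n → gap-pos n , g-pos n 1≤n) gap-small ,
    infinitelyMany λ N → 4 + N , G N , m≤n+m (suc N) 3 , connectedBoth N , v N , isQ N ,
      trans (cong ι (sym (m∸[m∸n]≡n (<⇒≤ (v<b N))))) (ι-∸ (m∸n≤m (b (4 + N)) (v N)))
    where
    gap : ℕ → ℕ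
    gap (suc (suc (suc (suc j)))) = b (4 + j) ∸ v j
    -- An o-term must be positive at every n ≥ 1, also at the orders 1, 2 and 3, where the family
    -- has no graph.
    gap _ = 1
    gap-pos : ∀ n → 0 < gap n
    gap-pos (suc (suc (suc (suc j)))) = m<n⇒0<n∸m (v<b j)
    gap-pos 0 = s≤s z≤n
    gap-pos 1 = s≤s z≤n
    gap-pos 2 = s≤s z≤n
    gap-pos 3 = s≤s z≤n
    gap-small : ∀ K → ∃[ N ] ∀ n → N ≤ n → K * gap n < g n
    gap-small K = let N , f = small K in 4 + N , λ { (suc (suc (suc (suc j)))) (s≤s (s≤s (s≤s (s≤s N≤j)))) → f j N≤j }

  module _ (th : Quantity) (α β : ℕ → ℕ) (isα : ∀ j → th (G j) (α j)) (isβ : ∀ j → th (H j) (β j))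
           (α<n : ∀ j → α j + 1 ≤ 4 + j) (β<n : ∀ j → β j + 1 ≤ 4 + j)
           (α-large : ∀ j {s} → 1 ≤ s → NoBihole s (G j) → 4 + j < α j + 4 * s)
           (β-large : ∀ j {s} → 1 ≤ s → NoBihole s (H j) → 4 + j < β j + 4 * s) where

    tight-sum : Tight-o (Sum th) (λ n → 2 * n) (λ n → n)
    tight-sum = tight (Sum th) (λ n → 2 * n) (λ n → n) (λ j → α j + β j) (λ _ → id) (λ j → α j , β j , isα j , isβ j , refl)
      (λ j → ≤-<-trans (sum≤2n∸1 {4 + j} {α j} {β j} (α<n j) (β<n j)) (s≤s ≤-refl))
      λ K → let N , f = eventually K in N , λ j N≤j → let s , 1≤s , p , q , lt = f j N≤j in
        ≤-<-trans (*-monoʳ-≤ K (m≤n+o⇒m∸n≤o (2 * (4 + j)) (α j + β j)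
          (bound (4 + j) (α j) (β j) s (<⇒≤ (α-large j 1≤s p)) (<⇒≤ (β-large j 1≤s q))))) lt
      where
      bound : ∀ n a b s → n ≤ a + 4 * s → n ≤ b + 4 * s → 2 * n ≤ a + b + 8 * s
      bound n a b s p q = ≤-trans (≤-reflexive (eq n)) (≤-trans (+-mono-≤ p q) (≤-reflexive (eq₂ a b s)))
        where
        eq : ∀ n → 2 * n ≡ n + n
        eq = solve-∀
        eq₂ : ∀ a b s → (a + 4 * s) + (b + 4 * s) ≡ a + b + 8 * s
        eq₂ = solve-∀

    tight-product : Tight-o (Prod th) (λ n → n ^ 2) (λ n → n ^ 2)
    tight-product = tight (Prod th) (λ n → n ^ 2) (λ n → n ^ 2) (λ j → α j * β j) (λ n 1≤n → ≤-trans 1≤n (n≤n² n))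
      (λ j → α j , β j , isα j , isβ j , refl)
      (λ j → ≤-<-trans (product≤n²∸1 {4 + j} {α j} {β j} (α<n j) (β<n j)) (s≤s ≤-refl))
      λ K → let N , f = eventually K in N , λ j N≤j → let s , 1≤s , p , q , lt = f j N≤j in
        ≤-<-trans (*-monoʳ-≤ K (m≤n+o⇒m∸n≤o ((4 + j) ^ 2) (α j * β j)
          (bound (4 + j) (α j) (β j) s (≤-trans (m≤m+n (α j) 1) (α<n j)) (<⇒≤ (α-large j 1≤s p)) (<⇒≤ (β-large j 1≤s q)))))
          (scale K s (4 + j) (s≤s z≤n) lt)
      where
      open ≤-Reasoning
      -- Each factor falls short of n by at most 4s, which costs at most 4sn twice; a sublinear s is
      -- thus enough for the product as well.
      bound : ∀ n a b s → a ≤ n → n ≤ a + 4 * s → n ≤ b + 4 * s → n ^ 2 ≤ a * b + 8 * s * n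
      bound n a b s a≤n p q = begin
        n ^ 2                             ≡⟨ cong (n *_) (*-identityʳ n) ⟩
        n * n                             ≤⟨ *-monoˡ-≤ n p ⟩
        (a + 4 * s) * n                   ≡⟨ *-distribʳ-+ n a (4 * s) ⟩
        a * n + 4 * s * n                 ≤⟨ +-monoˡ-≤ (4 * s * n) (*-monoʳ-≤ a q) ⟩
        a * (b + 4 * s) + 4 * s * n       ≡⟨ cong (_+ 4 * s * n) (*-distribˡ-+ a b (4 * s)) ⟩
        a * b + a * (4 * s) + 4 * s * n   ≤⟨ +-monoˡ-≤ (4 * s * n) (+-monoʳ-≤ (a * b) (*-monoˡ-≤ (4 * s) a≤n)) ⟩
        a * b + n * (4 * s) + 4 * s * n   ≡⟨ eq n a b s ⟩
        a * b + 8 * s * n                 ∎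
        where
        eq : ∀ n a b s → a * b + n * (4 * s) + 4 * s * n ≡ a * b + 8 * s * n
        eq = solve-∀
      scale : ∀ K s n → 0 < n → K * (8 * s) < n → K * (8 * s * n) < n ^ 2
      scale K s (suc n) _ lt = begin-strict
        K * (8 * s * suc n)   ≡⟨ *-assoc K (8 * s) (suc n) ⟨
        K * (8 * s) * suc n   <⟨ *-monoˡ-< (suc n) lt ⟩
        suc n * suc n         ≡⟨ cong (suc n *_) (*-identityʳ (suc n)) ⟨
        suc n ^ 2             ∎

  extremal-× : ∀ N → ∃[ j ] (N < 4 + j × Bounds.a× (isSetting j) ≡ 4 + j × Bounds.a× (Setting-sym (isSetting j)) ≡ 4 + j)
  extremal-× N = let M , f = eventually 1
                     s , 1≤s , p , q , lt = f (N ⊔ M) (m≤n⊔m N M)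
                     8s≤n = ≤-trans (≤-reflexive (sym (*-identityˡ (8 * s)))) (<⇒≤ lt)
    in N ⊔ M , ≤-<-trans (m≤m⊔n N M) (m≤n+m (suc (N ⊔ M)) 3) ,
       Large.a×≡n (isSetting (N ⊔ M)) 1≤s p 8s≤n , Large.a×≡n (Setting-sym (isSetting (N ⊔ M))) 1≤s q 8s≤n

-- Assembly of the bounds and of the extremal families

module _ {n} {G : Graph n} (4≤n : 4 ≤ n) (conn : BothConnected G) where
  private
    st = setting G 4≤n conn
  open DoubleBounds st

  sum₊ : Sum th₊ G (a₊ + b₊)
  sum₊ = a₊ , b₊ , Th₊.Optimum.isTh (opt₊ st) , Th₊.Optimum.isTh (opt₊ (Setting-sym st)) , refl

  prod₊ : Prod th₊ G (a₊ * b₊)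
  prod₊ = a₊ , b₊ , Th₊.Optimum.isTh (opt₊ st) , Th₊.Optimum.isTh (opt₊ (Setting-sym st)) , refl

  sum* : Sum th₊* G (a* + b*)
  sum* = a* , b* , Th*.Optimum.isTh (opt* st) , Th*.Optimum.isTh (opt* (Setting-sym st)) , refl

  prod* : Prod th₊* G (a* * b*)
  prod* = a* , b* , Th*.Optimum.isTh (opt* st) , Th*.Optimum.isTh (opt* (Setting-sym st)) , refl

  sum× : Sum th₊× G (a× + b×)
  sum× = a× , b× , Th×.Optimum.isTh (opt× st) , Th×.Optimum.isTh (opt× (Setting-sym st)) , refl

  prod× : Prod th₊× G (a× * b×)
  prod× = a× , b× , Th×.Optimum.isTh (opt× st) , Th×.Optimum.isTh (opt× (Setting-sym st)) , refl

module Order5 {G : Graph 5} (conn : BothConnected G) where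
  private
    st = setting G (n≤1+n 4) conn
    st′ = Setting-sym st
  open DoubleBounds st

  -- One of the two graphs has two vertices that force everything in one step, hence value 3; the
  -- other has value at most n - 1 = 4.
  a₊b₊≤12 : a₊ * b₊ ≤ 12
  a₊b₊≤12 = [ (λ a → *-mono-≤ {a₊} {3} {b₊} {4} (Th₊.Optimum.least (opt₊ st) 2 1 (s≤s z≤n) (s≤s (s≤s z≤n)) a) (small b₊<n))
            , (λ b → *-mono-≤ {a₊} {4} {b₊} {3} (small a₊<n) (Th₊.Optimum.least (opt₊ st′) 2 1 (s≤s z≤n) (s≤s (s≤s z≤n)) b)) ]′
            (achieves-2-1 st)
    where
    small : ∀ {a} → a + 1 ≤ 5 → a ≤ 4
    small = +-cancelʳ-≤ 1 _ 4

  a×b×≤20 : a× * b× ≤ 20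
  a×b×≤20 = [ (λ a → *-mono-≤ {a×} {4} {b×} {5} (Th×.Optimum.least (opt× st) 2 1 (s≤s z≤n) (s≤s (s≤s z≤n)) a) b×≤n)
            , (λ b → *-mono-≤ {a×} {5} {b×} {4} a×≤n (Th×.Optimum.least (opt× st′) 2 1 (s≤s z≤n) (s≤s (s≤s z≤n)) b)) ]′
            (achieves-2-1 st)

order-4-product× : ∀ (G : Graph 4) → BothConnected G → Prod th₊× G 9
order-4-product× G conn = subst (Prod th₊× G) (cong₂ _*_ (exact st) (exact (Setting-sym st))) (prod× ≤-refl conn)
  where
  st = setting G ≤-refl conn
  exact : ∀ {G H : Graph 4} (st : Setting G H) → Bounds.a× st ≡ 3
  exact st = ≤-antisym (Th×.Optimum.least (opt× st) 1 2 (s≤s z≤n) (s≤s z≤n) (achieves-1-2 st)) (Bounds.3≤a× st)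

at-5 : ∀ {P : ∀ {n} → Graph n → Set} → (∀ (G : Graph 5) → BothConnected G → P G) →
       ∀ {n} (G : Graph n) → n ≡ 5 → BothConnected G → P G
at-5 f G refl conn = f G conn

module _ (Q : Quantity) (b : ℕ → ℕ) (order : ℕ → ℕ) (G : ∀ i → Graph (order i)) (big : ∀ i → i < order i)
         (conn : ∀ i → BothConnected (G i)) (v : ℕ → ℕ) (isQ : ∀ i → Q (G i) (v i)) where

  sharp : (∀ i → v i ≡ b (order i)) → Sharp Q b
  sharp eq = infinitelyMany λ N → order N , G N , big N , conn N , subst (Q (G N)) (eq N) (isQ N)

  almostSharp : ∀ k → 1 ≤ k → k < 10 → (∀ i → v i ≡ b (order i) + k) → AlmostSharp Q b
  almostSharp k 1≤k k<10 eq = k , 1≤k , k<10 , infinitelyMany λ N → order N , G N , big N , conn N , v N , isQ N , inj₁ (eq N)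

sum₊-lower : LowerBound (λ n → 4 ≤ n) (Sum th₊) (λ n → n)
sum₊-lower G 4≤n conn = _ , sum₊ 4≤n conn , <⇒≤ (DoubleBounds.n<sum₊ (setting G 4≤n conn))

2n≥1 : ∀ {n} → 4 ≤ n → 1 ≤ 2 * n
2n≥1 {n} 4≤n = ≤-trans (≤-trans (s≤s z≤n) 4≤n) (m≤m+n n (n + 0))

n²≥1 : ∀ {n} → 4 ≤ n → 1 ≤ n ^ 2
n²≥1 {n} 4≤n = ≤-trans (≤-trans (s≤s z≤n) 4≤n) (n≤n² n)

sum₊-upper : UpperBound-o (λ n → 4 ≤ n) (Sum th₊) (λ n → 2 * n) (λ n → n)
sum₊-upper = upperBound-o (Sum th₊) (λ n → 2 * n) (λ n → n) (λ _ → id) eventually-n λ {n} G 4≤n conn →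
  let open DoubleBounds (setting G 4≤n conn) in
  2n≥1 4≤n , _ , sum₊ 4≤n conn , sum≤2n∸1 {n} {a₊} {b₊} a₊<n b₊<n

prod₊-lower : LowerBound (λ n → 4 ≤ n × n ≢ 5) (Prod th₊) (λ n → (2 * n) ⊔ (3 * n ∸ 9))
prod₊-lower {n} G (4≤n , n≢5) conn =
  let open DoubleBounds (setting G 4≤n conn) in
  _ , prod₊ 4≤n conn , ⊔-lub (2n≤a₊b₊ n≢5)
    -- The estimate at hand is 3n - 6, because the sum exceeds n; the 3 to spare reappears as the
    -- offset in the almost sharpness.
    (m≤n+o⇒m∸n≤o (3 * n) 9 (≤-trans 3n≤a₊b₊+6 (≤-trans (≤-reflexive (+-comm (a₊ * b₊) 6)) (+-monoˡ-≤ (a₊ * b₊) (m≤m+n 6 3)))))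

prod₊-upper : UpperBound-o (λ n → 4 ≤ n × n ≢ 5) (Prod th₊) (λ n → n ^ 2) (λ n → n ^ 2)
prod₊-upper = upperBound-o (Prod th₊) (λ n → n ^ 2) (λ n → n ^ 2) (λ n 1≤n → ≤-trans 1≤n (n≤n² n)) eventually-n²
  λ {n} G (4≤n , _) conn → let open DoubleBounds (setting G 4≤n conn) in
  n²≥1 4≤n , _ , prod₊ 4≤n conn , product≤n²∸1 {n} {a₊} {b₊} a₊<n b₊<n

prod₊-lower-5 : LowerBound (λ n → n ≡ 5) (Prod th₊) (λ n → 9)
prod₊-lower-5 = at-5 {λ G → ∃[ m ] (Prod th₊ G m × 9 ≤ m)} λ G conn →
  _ , prod₊ (n≤1+n 4) conn , DoubleBounds.9≤a₊b₊ (setting G (n≤1+n 4) conn)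

prod₊-upper-5 : UpperBound (λ n → n ≡ 5) (Prod th₊) (λ n → 12)
prod₊-upper-5 = at-5 {λ G → ∃[ m ] (Prod th₊ G m × m ≤ 12)} λ G conn →
  _ , prod₊ (n≤1+n 4) conn , Order5.a₊b₊≤12 conn

sum*-lower : LowerBound (λ n → 4 ≤ n) (Sum th₊*) (λ n → n ∸ 2)
sum*-lower {n} G 4≤n conn = let open DoubleBounds (setting G 4≤n conn) in
  _ , sum* 4≤n conn , m≤n+o⇒m∸n≤o n 2 (≤-trans n≤sum* (≤-trans (≤-reflexive (+-comm (a* + b*) 1)) (n≤1+n (1 + (a* + b*)))))

sum*-upper : UpperBound-o (λ n → 4 ≤ n) (Sum th₊*) (λ n → 2 * n) (λ n → n)
sum*-upper = upperBound-o (Sum th₊*) (λ n → 2 * n) (λ n → n) (λ _ → id) eventually-n λ {n} G 4≤n conn →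
  let open DoubleBounds (setting G 4≤n conn) in
  2n≥1 4≤n , _ , sum* 4≤n conn , sum≤2n∸1 {n} {a*} {b*} a*<n b*<n

prod*-lower : LowerBound (λ n → 4 ≤ n) (Prod th₊*) (λ n → (n ∸ 1) ⊔ (2 * n ∸ 8))
prod*-lower {n} G 4≤n conn = let open DoubleBounds (setting G 4≤n conn) in
  _ , prod* 4≤n conn , ⊔-lub
    (m≤n+o⇒m∸n≤o n 1 (≤-trans (product*-bound′ 2≤a* 2≤b* n≤sum*) (≤-reflexive (+-comm (a* * b*) 1))))
    (m≤n+o⇒m∸n≤o (2 * n) 8 (≤-trans (product*-bound 2≤a* 2≤b* n≤sum*)
      (≤-trans (≤-reflexive (+-comm (a* * b*) 6)) (+-monoˡ-≤ (a* * b*) (m≤m+n 6 2)))))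

prod*-upper : UpperBound-o (λ n → 4 ≤ n) (Prod th₊*) (λ n → n ^ 2) (λ n → n ^ 2)
prod*-upper = upperBound-o (Prod th₊*) (λ n → n ^ 2) (λ n → n ^ 2) (λ n 1≤n → ≤-trans 1≤n (n≤n² n)) eventually-n²
  λ {n} G 4≤n conn → let open DoubleBounds (setting G 4≤n conn) in
  n²≥1 4≤n , _ , prod* 4≤n conn , product≤n²∸1 {n} {a*} {b*} a*<n b*<n

sum×-lower : LowerBound (λ n → 4 ≤ n) (Sum th₊×) (λ n → n)
sum×-lower G 4≤n conn = _ , sum× 4≤n conn , DoubleBounds.n≤sum× (setting G 4≤n conn)

sum×-upper : UpperBound (λ n → 4 ≤ n) (Sum th₊×) (λ n → 2 * n)
sum×-upper {n} G 4≤n conn = let open DoubleBounds (setting G 4≤n conn) in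
  _ , sum× 4≤n conn , +-mono-≤ a×≤n (≤-trans b×≤n (≤-reflexive (sym (+-identityʳ n))))

prod×-lower : LowerBound (λ n → 6 ≤ n) (Prod th₊×) (λ n → 3 * n)
prod×-lower G 6≤n conn = _ , prod× 4≤n conn , product×-bound (DoubleBounds.pair× (setting G 4≤n conn)) 6≤n
  where 4≤n = ≤-trans (m≤m+n 4 2) 6≤n

prod×-upper : UpperBound (λ n → 6 ≤ n) (Prod th₊×) (λ n → n ^ 2)
prod×-upper {n} G 6≤n conn = let open DoubleBounds (setting G 4≤n conn) in
  _ , prod× 4≤n conn , *-mono-≤ a×≤n (≤-trans b×≤n (≤-reflexive (sym (*-identityʳ n))))
  where 4≤n = ≤-trans (m≤m+n 4 2) 6≤n

prod×-lower-5 : LowerBound (λ n → n ≡ 5) (Prod th₊×) (λ n → 12)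
prod×-lower-5 = at-5 {λ G → ∃[ m ] (Prod th₊× G m × 12 ≤ m)} λ G conn →
  _ , prod× (n≤1+n 4) conn , 12≤product× (DoubleBounds.pair× (setting G (n≤1+n 4) conn))

prod×-upper-5 : UpperBound (λ n → n ≡ 5) (Prod th₊×) (λ n → 20)
prod×-upper-5 = at-5 {λ G → ∃[ m ] (Prod th₊× G m × m ≤ 20)} λ G conn →
  _ , prod× (n≤1+n 4) conn , Order5.a×b×≤20 conn

module _ where
  open InnerProduct

  private
    st : ∀ j → Setting (G j) (H j)
    st = isSetting
    st′ : ∀ j → Setting (H j) (G j)
    st′ j = Setting-sym (isSetting j)

  tight₊ : Tight-o (Sum th₊) (λ n → 2 * n) (λ n → n) × Tight-o (Prod th₊) (λ n → n ^ 2) (λ n → n ^ 2)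
  tight₊ = tight-sum th₊ α β isα isβ (λ j → Bounds.a₊<n (st j)) (λ j → Bounds.a₊<n (st′ j)) large large′ ,
           tight-product th₊ α β isα isβ (λ j → Bounds.a₊<n (st j)) (λ j → Bounds.a₊<n (st′ j)) large large′
    where
    α β : ℕ → ℕ
    α j = Bounds.a₊ (st j)
    β j = Bounds.a₊ (st′ j)
    isα : ∀ j → th₊ (G j) (α j)
    isα j = Th₊.Optimum.isTh (opt₊ (st j))
    isβ : ∀ j → th₊ (H j) (β j)
    isβ j = Th₊.Optimum.isTh (opt₊ (st′ j))
    large : ∀ j {s} → 1 ≤ s → NoBihole s (G j) → 4 + j < α j + 4 * s
    large j 1≤s none = Large.n<a₊+4s (st j) 1≤s none
    large′ : ∀ j {s} → 1 ≤ s → NoBihole s (H j) → 4 + j < β j + 4 * s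
    large′ j 1≤s none = Large.n<a₊+4s (st′ j) 1≤s none

  tight* : Tight-o (Sum th₊*) (λ n → 2 * n) (λ n → n) × Tight-o (Prod th₊*) (λ n → n ^ 2) (λ n → n ^ 2)
  tight* = tight-sum th₊* α β isα isβ (λ j → Bounds.a*<n (st j)) (λ j → Bounds.a*<n (st′ j)) large large′ ,
           tight-product th₊* α β isα isβ (λ j → Bounds.a*<n (st j)) (λ j → Bounds.a*<n (st′ j)) large large′
    where
    α β : ℕ → ℕ
    α j = Bounds.a* (st j)
    β j = Bounds.a* (st′ j)
    isα : ∀ j → th₊* (G j) (α j)
    isα j = Th*.Optimum.isTh (opt* (st j))
    isβ : ∀ j → th₊* (H j) (β j)
    isβ j = Th*.Optimum.isTh (opt* (st′ j))
    large : ∀ j {s} → 1 ≤ s → NoBihole s (G j) → 4 + j < α j + 4 * s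
    large j 1≤s none = Large.n<a*+4s (st j) 1≤s none
    large′ : ∀ j {s} → 1 ≤ s → NoBihole s (H j) → 4 + j < β j + 4 * s
    large′ j 1≤s none = Large.n<a*+4s (st′ j) 1≤s none

  upper×-sharp : Sharp (Sum th₊×) (λ n → 2 * n) × Sharp (Prod th₊×) (λ n → n ^ 2)
  upper×-sharp =
    infinitelyMany (λ N → let j , N<n , a , b = extremal-× N in 4 + j , G j , N<n , connectedBoth j ,
      double (4 + j) (G j) (subst (th₊× (G j)) a (isα j)) (subst (th₊× (H j)) b (isβ j))) ,
    infinitelyMany (λ N → let j , N<n , a , b = extremal-× N in 4 + j , G j , N<n , connectedBoth j ,
      square (4 + j) (G j) (subst (th₊× (G j)) a (isα j)) (subst (th₊× (H j)) b (isβ j)))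
    where
    isα : ∀ j → th₊× (G j) (Bounds.a× (st j))
    isα j = Th×.Optimum.isTh (opt× (st j))
    isβ : ∀ j → th₊× (H j) (Bounds.a× (st′ j))
    isβ j = Th×.Optimum.isTh (opt× (st′ j))
    double : ∀ n (G : Graph n) → th₊× G n → th₊× (complement G) n → Sum th₊× G (2 * n)
    double n G p q = n , n , p , q , cong (n +_) (+-identityʳ n)
    square : ∀ n (G : Graph n) → th₊× G n → th₊× (complement G) n → Prod th₊× G (n ^ 2)
    square n G p q = n , n , p , q , cong (n *_) (*-identityʳ n)

module _ where
  private
    st : ∀ i → Setting (double-broom i) (complement (double-broom i))
    st = double-broom-setting
    conn : ∀ i → BothConnected (double-broom i)
    conn i = Setting.connG (st i) , Setting.connH (st i)
    big : ∀ i → i < 9 + i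
    big i = m≤n+m (suc i) 8
    is₊ : ∀ i → th₊ (double-broom i) 3
    is₊ i = subst (th₊ (double-broom i)) (DoubleBroom.a₊≡3 i) (Th₊.Optimum.isTh (opt₊ (st i)))
    co₊ : ∀ i → th₊ (complement (double-broom i)) (7 + i)
    co₊ i = subst (th₊ (complement (double-broom i))) (DoubleBroom.b₊≡7+i i) (Th₊.Optimum.isTh (opt₊ (Setting-sym (st i))))
    is* : ∀ i → th₊* (double-broom i) 2
    is* i = subst (th₊* (double-broom i)) (DoubleBroom.a*≡2 i) (Th*.Optimum.isTh (opt* (st i)))
    co* : ∀ i → th₊* (complement (double-broom i)) (6 + i)
    co* i = subst (th₊* (complement (double-broom i))) (DoubleBroom.b*≡6+i i) (Th*.Optimum.isTh (opt* (Setting-sym (st i))))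

    ⊔-value : ∀ {x y} z c → x ≤ z → y ≡ c + z → x ⊔ (y ∸ c) ≡ z
    ⊔-value {x} z c x≤z refl = trans (cong (x ⊔_) (m+n∸m≡n c z)) (m≤n⇒m⊔n≡n x≤z)

  sum₊-almostSharp : AlmostSharp (Sum th₊) (λ n → n)
  sum₊-almostSharp = almostSharp (Sum th₊) (λ n → n) (9 +_) double-broom big conn (λ i → 3 + (7 + i))
    (λ i → 3 , 7 + i , is₊ i , co₊ i , refl) 1 (s≤s z≤n) (s≤s (s≤s z≤n)) (λ i → +-comm 1 (9 + i))

  prod₊-almostSharp : AlmostSharp (Prod th₊) (λ n → (2 * n) ⊔ (3 * n ∸ 9))
  prod₊-almostSharp = almostSharp (Prod th₊) (λ n → (2 * n) ⊔ (3 * n ∸ 9)) (9 +_) double-broom big conn (λ i → 3 * (7 + i))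
    (λ i → 3 , 7 + i , is₊ i , co₊ i , refl) 3 (s≤s z≤n) (s≤s (s≤s (s≤s (s≤s z≤n)))) value
    where
    eq₁ : ∀ i → 2 * (9 + i) + i ≡ 18 + 3 * i
    eq₁ = solve-∀
    eq₂ : ∀ i → 3 * (9 + i) ≡ 9 + (18 + 3 * i)
    eq₂ = solve-∀
    eq₃ : ∀ i → 3 * (7 + i) ≡ 18 + 3 * i + 3
    eq₃ = solve-∀
    value : ∀ i → 3 * (7 + i) ≡ (2 * (9 + i)) ⊔ (3 * (9 + i) ∸ 9) + 3
    value i = trans (eq₃ i) (cong (_+ 3) (sym (⊔-value {2 * (9 + i)} {3 * (9 + i)} (18 + 3 * i) 9 (slack i ≤-refl (eq₁ i)) (eq₂ i))))

  sum*-almostSharp : AlmostSharp (Sum th₊*) (λ n → n ∸ 2)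
  sum*-almostSharp = almostSharp (Sum th₊*) (λ n → n ∸ 2) (9 +_) double-broom big conn (λ i → 2 + (6 + i))
    (λ i → 2 , 6 + i , is* i , co* i , refl) 1 (s≤s z≤n) (s≤s (s≤s z≤n)) (λ i → +-comm 1 (7 + i))

  -- The family attains 2(n - 3) = 2n - 6, the value to which a sum of at least n - 1 with both
  -- terms at least 2 leads; at these orders 2n - 8 is the larger term of the bound, hence the
  -- offset 2.
  prod*-almostSharp : AlmostSharp (Prod th₊*) (λ n → (n ∸ 1) ⊔ (2 * n ∸ 8))
  prod*-almostSharp = almostSharp (Prod th₊*) (λ n → (n ∸ 1) ⊔ (2 * n ∸ 8)) (9 +_) double-broom big conn (λ i → 2 * (6 + i))
    (λ i → 2 , 6 + i , is* i , co* i , refl) 2 (s≤s z≤n) (s≤s (s≤s (s≤s z≤n))) value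
    where
    eq₁ : ∀ i → 8 + i + (2 + i) ≡ 10 + 2 * i
    eq₁ = solve-∀
    eq₂ : ∀ i → 2 * (9 + i) ≡ 8 + (10 + 2 * i)
    eq₂ = solve-∀
    eq₃ : ∀ i → 2 * (6 + i) ≡ 10 + 2 * i + 2
    eq₃ = solve-∀
    value : ∀ i → 2 * (6 + i) ≡ (8 + i) ⊔ (2 * (9 + i) ∸ 8) + 2
    value i = trans (eq₃ i) (cong (_+ 2) (sym (⊔-value {8 + i} {2 * (9 + i)} (10 + 2 * i) 8 (slack (2 + i) ≤-refl (eq₁ i)) (eq₂ i))))

module _ where
  private
    conn : ∀ i → BothConnected (broom i)
    conn i = Setting.connG (broom-setting i) , Setting.connH (broom-setting i)
    big : ∀ i → i < 6 + i
    big i = m≤n+m (suc i) 5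
    is× : ∀ i → th₊× (broom i) 3
    is× i = subst (th₊× (broom i)) (Broom.a×≡3 i) (Th×.Optimum.isTh (opt× (broom-setting i)))
    co× : ∀ i → th₊× (complement (broom i)) (6 + i)
    co× i = subst (th₊× (complement (broom i))) (Broom.b×≡n i) (Th×.Optimum.isTh (opt× (Setting-sym (broom-setting i))))

  prod×-sharp : Sharp (Prod th₊×) (λ n → 3 * n)
  prod×-sharp = sharp (Prod th₊×) (λ n → 3 * n) (6 +_) broom big conn (λ i → 3 * (6 + i))
    (λ i → 3 , 6 + i , is× i , co× i , refl) (λ _ → refl)

  sum×-almostSharp : AlmostSharp (Sum th₊×) (λ n → n)
  sum×-almostSharp = almostSharp (Sum th₊×) (λ n → n) (6 +_) broom big conn (λ i → 3 + (6 + i))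
    (λ i → 3 , 6 + i , is× i , co× i , refl) 3 (s≤s z≤n) (s≤s (s≤s (s≤s (s≤s z≤n)))) (λ i → +-comm 3 (6 + i))

corollary3p8 : ( LowerBound (λ n → 4 ≤ n) (Sum th₊) (λ n → n)
    × UpperBound-o (λ n → 4 ≤ n) (Sum th₊) (λ n → 2 * n) (λ n → n)
    × LowerBound (λ n → 4 ≤ n × n ≢ 5) (Prod th₊) (λ n → (2 * n) ⊔ (3 * n ∸ 9))
    × UpperBound-o (λ n → 4 ≤ n × n ≢ 5) (Prod th₊) (λ n → n ^ 2) (λ n → n ^ 2)
    × LowerBound (λ n → n ≡ 5) (Prod th₊) (λ n → 9)
    × UpperBound (λ n → n ≡ 5) (Prod th₊) (λ n → 12)
    × Tight-o (Sum th₊) (λ n → 2 * n) (λ n → n)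
    × Tight-o (Prod th₊) (λ n → n ^ 2) (λ n → n ^ 2)
    × AlmostSharp (Sum th₊) (λ n → n)
    × AlmostSharp (Prod th₊) (λ n → (2 * n) ⊔ (3 * n ∸ 9))
    )
    × ( LowerBound (λ n → 4 ≤ n) (Sum th₊*) (λ n → n ∸ 2)
    × UpperBound-o (λ n → 4 ≤ n) (Sum th₊*) (λ n → 2 * n) (λ n → n)
    × LowerBound (λ n → 4 ≤ n) (Prod th₊*) (λ n → (n ∸ 1) ⊔ (2 * n ∸ 8))
    × UpperBound-o (λ n → 4 ≤ n) (Prod th₊*) (λ n → n ^ 2) (λ n → n ^ 2)
    × Tight-o (Sum th₊*) (λ n → 2 * n) (λ n → n)
    × Tight-o (Prod th₊*) (λ n → n ^ 2) (λ n → n ^ 2)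
    × AlmostSharp (Sum th₊*) (λ n → n ∸ 2)
    × AlmostSharp (Prod th₊*) (λ n → (n ∸ 1) ⊔ (2 * n ∸ 8))
    )
    × ( LowerBound (λ n → 4 ≤ n) (Sum th₊×) (λ n → n)
    × UpperBound (λ n → 4 ≤ n) (Sum th₊×) (λ n → 2 * n)
    × LowerBound (λ n → 6 ≤ n) (Prod th₊×) (λ n → 3 * n)
    × UpperBound (λ n → 6 ≤ n) (Prod th₊×) (λ n → n ^ 2)
    × (∀ (G : Graph 4) → BothConnected G → Prod th₊× G 9)
    × LowerBound (λ n → n ≡ 5) (Prod th₊×) (λ n → 12)
    × UpperBound (λ n → n ≡ 5) (Prod th₊×) (λ n → 20)
    × Sharp (Sum th₊×) (λ n → 2 * n)
    × Sharp (Prod th₊×) (λ n → n ^ 2)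
    × Sharp (Prod th₊×) (λ n → 3 * n)
    × AlmostSharp (Sum th₊×) (λ n → n)
    )
corollary3p8 =
  ( (λ {n} → sum₊-lower {n}) , sum₊-upper , (λ {n} → prod₊-lower {n}) , prod₊-upper
  , (λ {n} → prod₊-lower-5 {n}) , (λ {n} → prod₊-upper-5 {n})
  , proj₁ tight₊ , proj₂ tight₊ , sum₊-almostSharp , prod₊-almostSharp ) ,
  ( (λ {n} → sum*-lower {n}) , sum*-upper , (λ {n} → prod*-lower {n}) , prod*-upper
  , proj₁ tight* , proj₂ tight* , sum*-almostSharp , prod*-almostSharp ) ,
  (λ {n} → sum×-lower {n}) , (λ {n} → sum×-upper {n}) , (λ {n} → prod×-lower {n}) , (λ {n} → prod×-upper {n})
  , order-4-product× , (λ {n} → prod×-lower-5 {n}) , (λ {n} → prod×-upper-5 {n})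
  , proj₁ upper×-sharp , proj₂ upper×-sharp , prod×-sharp , sum×-almostSharp
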